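{- Let $G=(V,E)$ be a connected undirected unweighted graph with $n=|V|\ge 2$ nodes. (a) The problem ADIM$_{=1}$ admits a $(1+\ln(n-1))$-approximation in $O(n^3)$ time. (b) If $G$ has at least one node of degree $1$, then $L_{\mathrm{opt}}^{=1}=1$, and thus ADIM$_{=1}$ can be solved in $O(n^3)$ time (on such graphs). (c) If $G$ does not contain a cycle of $4$ edges, then $L_{\mathrm{opt}}^{=1}\le 2$, and thus ADIM$_{=1}$ can be solved in $O(n^3)$ time (on such graphs).
   Context: Let $\mathrm{dist}_{u,v}$ be the number of edges in a shortest path between $u,v\in V$. For $\emptyset\subset V'\subset V$ (proper inclusions) and $v\in V\setminus V'$, let $\mathbf{d}_{v,-V'}=(\mathrm{dist}_{v,u})_{u\in V'}$ be the metric representation of $v$ with respect to $V'$. Two nodes of $V\setminus V'$ are equivalent if they have the same metric representation with respect to $V'$; $\mu(\mathcal{D}_{V\setminus V',-V'})$ is the minimum cardinality of an equivalence class of $V\setminus V'$. Problem ADIM$_{=1}$: given $G$, find a set $V'$ with $\emptyset\subset V'\subset V$ of minimum cardinality such that $\mu(\mathcal{D}_{V\setminus V',-V'})=1$. The minimum cardinality is denoted $L_{\mathrm{opt}}^{=1}$. "Contains a cycle of $4$ edges" means that $G$ has a (not necessarily induced) subgraph that is a cycle on $4$ nodes. A $\rho$-approximation is a polynomial-time algorithm producing a feasible solution of cardinality at most $\rho$ times the optimum. Running times are in the standard unit-cost RAM model. -}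

module Defs where

open import Data.Bool.Base using (Bool; true; false)
open import Data.Fin.Base using (Fin; toℕ; fromℕ<; remQuot)
import Data.Fin.Properties as Fin
open import Data.Fin.Subset using (Subset; _∈_; _∉_; _⊂_; ⊥; ⊤; ∣_∣)
open import Data.Integer.Base using (+_)
open import Data.List.Base using (List; []; _∷_; applyUpTo; foldr)
open import Data.List.Relation.Unary.Unique.Propositional using (Unique)
open import Data.Maybe.Base using (Maybe; just; nothing)
open import Data.Nat.Base using (ℕ; zero; suc; _≤_; _<_; _∸_)
import Data.Nat.Base as ℕ
open import Data.Nat.Properties using (_≟_; _<?_; ≮⇒≥; anyUpTo?)
open import Data.Nat.Induction using (<-rec)
open import Data.Product.Base using (∃; ∃-syntax; Σ-syntax; _×_; _,_; proj₁; uncurry)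
open import Data.Rational.Base using (ℚ; 0ℚ; 1ℚ; _/_)
import Data.Rational.Base as ℚ
open import Data.Vec.Base using (lookup; tabulate)
open import Function.Bundles using (_⇔_)
open import Level using (0ℓ)
open import Relation.Binary.Core using (Rel)
open import Relation.Binary.Definitions using (Decidable; Symmetric; Irreflexive)
open import Relation.Binary.PropositionalEquality using (_≡_; _≗_; refl)
open import Relation.Nullary.Decidable using (yes; no; does; map′; _×-dec_)
import Relation.Unary as U

Least : (ℕ → Set) → ℕ → Set
Least P k = P k × (∀ j → P j → k ≤ j)

least : ∀ {P : ℕ → Set} → U.Decidable P → ∃ P → ∃ (Least P)
least {P} P? (k , p) = <-rec (λ k → P k → ∃ (Least P)) go k p
  where
  go : ∀ k → (∀ {j} → j < k → P j → ∃ (Least P)) → P k → ∃ (Least P)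
  go k rec p with anyUpTo? P? k
  ... | yes (j , j<k , pj) = rec j<k pj
  ... | no none            = k , p , λ j pj → ≮⇒≥ λ j<k → none (j , j<k , pj)

record Graph (n : ℕ) : Set₁ where
  field
    Adj    : Rel (Fin n) 0ℓ
    adj?   : Decidable Adj
    symm   : Symmetric Adj
    irrefl : Irreflexive _≡_ Adj

open Graph public

-- Nodes on a path may repeat; a path of minimum length never repeats one.
data Path {n} (G : Graph n) : Fin n → Fin n → ℕ → Set where
  []  : ∀ {u} → Path G u u 0
  _∷_ : ∀ {u w v k} → Adj G u w → Path G w v k → Path G u v (suc k)

path? : ∀ {n} (G : Graph n) u v → U.Decidable (Path G u v)
path? G u v zero    = map′ (λ { refl → [] }) (λ { [] → refl }) (u Fin.≟ v)
path? G u v (suc k) =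
  map′ (λ (_ , e , p) → e ∷ p) (λ { (e ∷ p) → _ , e , p })
       (Fin.any? λ w → adj? G u w ×-dec path? G w v k)

record ConnectedGraph (n : ℕ) : Set₁ where
  field
    graph     : Graph n
    connected : ∀ u v → ∃ (Path graph u v)

open ConnectedGraph public

dist-least : ∀ {n} (G : ConnectedGraph n) u v → ∃ (Least (Path (graph G) u v))
dist-least G u v = least (path? (graph G) u v) (connected G u v)

dist : ∀ {n} → ConnectedGraph n → Fin n → Fin n → ℕ
dist G u v = proj₁ (dist-least G u v)

degree : ∀ {n} → Graph n → Fin n → ℕ
degree G v = ∣ tabulate (λ w → does (adj? G v w)) ∣

HasFourCycle : ∀ {n} → Graph n → Set
HasFourCycle G =
  ∃[ a ] ∃[ b ] ∃[ c ] ∃[ d ]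
    Unique (a ∷ b ∷ c ∷ d ∷ []) ×
    Adj G a b × Adj G b c × Adj G c d × Adj G d a

metricRep : ∀ {n} → ConnectedGraph n → (V′ : Subset n) → Fin n → Σ[ u ∈ Fin n ] u ∈ V′ → ℕ
metricRep G V′ v (u , _) = dist G v u

-- C is the class, in V ∖ V′, of some node v of V ∖ V′.
IsClass : ∀ {n} → ConnectedGraph n → Subset n → Subset n → Set
IsClass {n} G V′ C =
  ∃[ v ] v ∉ V′ × (∀ w → w ∈ C ⇔ (w ∉ V′ × metricRep G V′ w ≗ metricRep G V′ v))

-- IsMu G V′ k says that μ(𝒟_{V∖V′,−V′}) = k.
IsMu : ∀ {n} → ConnectedGraph n → Subset n → ℕ → Set
IsMu G V′ = Least λ k → ∃[ C ] IsClass G V′ C × ∣ C ∣ ≡ k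

Feasible : ∀ {n} → ConnectedGraph n → Subset n → Set
Feasible G V′ = ⊥ ⊂ V′ × V′ ⊂ ⊤ × IsMu G V′ 1

IsLopt : ∀ {n} → ConnectedGraph n → ℕ → Set
IsLopt G = Least λ k → ∃[ V′ ] Feasible G V′ × ∣ V′ ∣ ≡ k

IsOptimal : ∀ {n} → ConnectedGraph n → Subset n → Set
IsOptimal G V′ = Feasible G V′ × IsLopt G ∣ V′ ∣

-- A real number ρ is represented by its upper cut { q ∈ ℚ ∣ ρ < q }.
UpperCut : Set₁
UpperCut = ℚ → Set

fromℕ : ℕ → ℚ
fromℕ k = + k / 1

1+_ : UpperCut → UpperCut
(1+ ρ) q = ρ (q ℚ.- 1ℚ)

-- The upper Darboux sum of ∫₁ᴺ dt/t for the partition into intervals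
-- [1 + i/m , 1 + (i+1)/m] with m = suc k: the i-th interval contributes
-- (1/m) · 1/(1 + i/m) = 1/(m + i).
upperSum : (N k : ℕ) → ℚ
upperSum N k =
  foldr ℚ._+_ 0ℚ (applyUpTo (λ i → + 1 / (suc k ℕ.+ i)) (suc k ℕ.* (N ∸ 1)))

-- ln N = ∫₁ᴺ dt/t is the infimum of these upper sums, for N ≥ 1.
ln : ℕ → UpperCut
ln N q = ∃[ k ] upperSum N k ℚ.< q

-- For 0 ≤ b, this is a ≤ ρ · b as real numbers.
_≤[_]·_ : ℕ → UpperCut → ℕ → Set
a ≤[ ρ ]· b = ∀ q → ρ q → fromℕ a ℚ.≤ q ℚ.* fromℕ b

IsApproximation : ∀ {n} → UpperCut → ConnectedGraph n → Subset n → Set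
IsApproximation ρ G V′ = Feasible G V′ × ∃[ L ] IsLopt G L × ∣ V′ ∣ ≤[ ρ ]· L

-- Registers have fixed addresses; the memory is addressed indirectly.
-- Multiplication is not an instruction: repeated squaring would build
-- numbers of exponential length at unit cost, and then "polynomially many
-- steps" would no longer mean polynomial time.
data Instr : Set where
  const     : (r k : ℕ) → Instr      -- r := k
  add sub   : (r s t : ℕ) → Instr    -- r := s + t,  r := s ∸ t
  load      : (r s : ℕ) → Instr      -- r := mem[s]
  store     : (r s : ℕ) → Instr      -- mem[r] := s
  jump      : (ℓ : ℕ) → Instr
  jumpZero  : (r ℓ : ℕ) → Instr

Program : Set
Program = List Instr

record Config : Set where
  constructor ⟨_,_,_⟩
  field
    pc  : ℕ
    reg : ℕ → ℕ
    mem : ℕ → ℕ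

open Config public

_[_≔_] : (ℕ → ℕ) → ℕ → ℕ → (ℕ → ℕ)
(f [ a ≔ x ]) b with b ≟ a
... | yes _ = x
... | no  _ = f b

fetch : Program → ℕ → Maybe Instr
fetch []      _       = nothing
fetch (i ∷ P) zero    = just i
fetch (i ∷ P) (suc k) = fetch P k

exec : Instr → Config → Config
exec (const r k)    ⟨ p , f , m ⟩ = ⟨ suc p , f [ r ≔ k ] , m ⟩
exec (add r s t)    ⟨ p , f , m ⟩ = ⟨ suc p , f [ r ≔ f s ℕ.+ f t ] , m ⟩
exec (sub r s t)    ⟨ p , f , m ⟩ = ⟨ suc p , f [ r ≔ f s ∸ f t ] , m ⟩
exec (load r s)     ⟨ p , f , m ⟩ = ⟨ suc p , f [ r ≔ m (f s) ] , m ⟩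
exec (store r s)    ⟨ p , f , m ⟩ = ⟨ suc p , f , m [ f r ≔ f s ] ⟩
exec (jump ℓ)       ⟨ p , f , m ⟩ = ⟨ ℓ , f , m ⟩
exec (jumpZero r ℓ) ⟨ p , f , m ⟩ with f r
... | zero  = ⟨ ℓ , f , m ⟩
... | suc _ = ⟨ suc p , f , m ⟩

-- P ⊢ c ⇓ c′ after t: started in c, the program halts in c′ after exactly
-- t steps; it halts when the program counter leaves the program.
data _⊢_⇓_after_ (P : Program) : Config → Config → ℕ → Set where
  halt : ∀ {c} → fetch P (pc c) ≡ nothing → P ⊢ c ⇓ c after 0
  step : ∀ {c c′ i t} → fetch P (pc c) ≡ just i →
         P ⊢ exec i c ⇓ c′ after t → P ⊢ c ⇓ c′ after suc t

bit : Bool → ℕ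
bit false = 0
bit true  = 1

-- On input G, register 0 holds n, the memory cells 0 … n² ∸ 1 hold the
-- adjacency matrix in row-major order, and everything else is 0.
inputReg : ℕ → ℕ → ℕ
inputReg n zero    = n
inputReg n (suc _) = 0

inputMem : ∀ {n} → Graph n → ℕ → ℕ
inputMem {n} G a with a <? n ℕ.* n
... | yes a<n² = uncurry (λ i j → bit (does (adj? G i j))) (remQuot n (fromℕ< a<n²))
... | no  _    = 0

start : ∀ {n} → Graph n → Config
start {n} G = ⟨ 0 , inputReg n , inputMem G ⟩

-- The output is read off the memory cells 0 … n ∸ 1.
Outputs : ∀ {n} → Config → Subset n → Set
Outputs c V′ = ∀ v → mem c (toℕ v) ≡ bit (lookup V′ v)

_∈O_ : (ℕ → ℕ) → (ℕ → ℕ) → Set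
f ∈O g = ∃[ C ] ∃[ n₀ ] (∀ n → n₀ ≤ n → f n ≤ C ℕ.* g n)

-- A single program which, on every connected graph of the class 𝒢, computes
-- in O(g(n)) steps a node set that is a correct answer for that graph.
SolvableInTimeO : (g : ℕ → ℕ)
                  (𝒢 : ∀ n → ConnectedGraph n → Set)
                  (Answer : ∀ n → ConnectedGraph n → Subset n → Set) → Set₁
SolvableInTimeO g 𝒢 Answer =
  Σ[ P ∈ Program ] Σ[ T ∈ (ℕ → ℕ) ] T ∈O g ×
    (∀ n (G : ConnectedGraph n) → 𝒢 n G →
      ∃[ c ] ∃[ t ] ∃[ V′ ]
        P ⊢ start (graph G) ⇓ c after t × t ≤ T n × Outputs c V′ × Answer n G V′)

{-# OPTIONS --safe #-}

-- A set W not containing v makes {v} a class iff every w ≠ v is separated from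
-- v by some u ∈ W, that is, dist w u ≠ dist v u; here u = w always separates w.
-- Hence the problem is the best of n set cover instances, one for each v, with
-- n − 1 elements each, and the greedy cover is within H(n − 1) ≤ 1 + ln(n − 1)
-- of the optimum. Keeping for each u the number of uncovered nodes that it
-- separates, a node costs O(n) once, when it is covered, and a pick costs O(n):
-- this is O(n²) for each v and O(n³) in all, like Floyd–Warshall. If a single
-- node suffices, greedy finds one; this happens if there is a leaf, which
-- separates its neighbour from everything else. Without a four-cycle, a node is
-- the only common neighbour of any two of its neighbours, so that these two
-- suffice whenever greedy needs more than one.
--
-- The programs are written in a loop language with a total semantics; compiled
-- code takes at most its length times one plus the number of loop iterations.

module Submission where

open import Defs
open import Data.Bool.Base using (Bool; true; false; T; if_then_else_; _∧_; _∨_)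
open import Data.Bool.Properties using (∨-conicalˡ; ∨-conicalʳ; ∧-conicalˡ; ∧-conicalʳ)
open import Data.Empty using (⊥; ⊥-elim)
open import Data.Fin.Base using (Fin; zero; suc; toℕ; fromℕ<; combine; remQuot)
open import Data.Fin.Properties using (toℕ<n; toℕ-fromℕ<; toℕ-injective; toℕ-combine; remQuot-combine; injective⇒≤; any?; all?) renaming (_≟_ to _≟ᶠ_)
open import Data.Fin.Subset using (Subset; _∈_; _∉_; ⁅_⁆; _∪_; ∁; ∣_∣)
open import Data.Fin.Subset.Properties using (_∈?_; anySubset?; ∉⊥; ∈⊤; x∈⁅x⁆; x∈⁅y⁆⇒x≡y; x≢y⇒x∉⁅y⁆; ∣⁅x⁆∣≡1; p⊆q⇒∣p∣≤∣q∣; p⊂q⇒∣p∣<∣q∣; x∈∁p⇒x∉p; x∉p⇒x∈∁p; x∈p∪q⁺; x∈p∪q⁻)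
import Data.Integer.Base as ℤ
import Data.Integer.Properties as ℤ
import Data.List.Base as List
open import Data.List.Base using (List; []; _∷_; applyUpTo; foldr)
open import Data.List.Relation.Unary.All using ([]; _∷_)
open import Data.List.Relation.Unary.AllPairs using ([]; _∷_)
open import Data.Maybe.Base using (just; nothing)
open import Data.Nat.Base hiding (_/_)
open import Data.Nat.Properties
open import Data.Nat.Tactic.RingSolver using (solve-∀)
open import Data.Product.Base using (_×_; _,_; ∃-syntax; proj₁; proj₂; uncurry)
open import Data.Rational.Base as ℚ using (ℚ; 0ℚ; 1ℚ; _/_)
import Data.Rational.Properties as ℚ
import Data.Rational.Unnormalised.Base as ℚᵘ
import Data.Rational.Unnormalised.Properties as ℚᵘ
open import Data.Sum.Base using (_⊎_; inj₁; inj₂)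
open import Data.Unit.Base using (⊤; tt)
open import Data.Vec.Base using (Vec; []; _∷_; _++_; [_]; lookup; replicate; tabulate; toList)
open import Data.Vec.Properties using (lookup∘tabulate; lookup⇒[]=; []=⇒lookup; lookup-zipWith)
open import Function.Base using (_∘_; case_of_)
open import Function.Bundles using (mk⇔; Equivalence)
open import Relation.Binary.PropositionalEquality hiding ([_]; J)
open import Relation.Nullary.Decidable using (Dec; yes; no; does; map′; _×-dec_; _→-dec_; ¬?; decidable-stable; dec-true; dec-false)
open import Relation.Nullary.Negation.Core using (¬_; contradiction)
open import Algebra.Properties.Semiring.Sum +-*-semiring using (sum; sum-cong-≗; ∑-comm; *-distribˡ-sum)


-- A loop language and its compilation to the machine

-- Without multiplication, matrix rows are addressed by offsets that grow by addition, and the only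
-- product formed is the common capacity n² of the arrays, by n additions at the start. The running
-- time is not a function of n alone: the number of picks and the nodes covered by each depend on
-- the graph. Here n times the number of uncovered nodes serves as a potential, and updating the
-- gains when a node is covered is paid for by its fall. The ratio is proved for abstract runs
-- (`Greedy`), where L times a harmonic number is a second potential. The program only has to show
-- that its picks form such a run against every competing set for the same v at once; an optimal set
-- is one of these competitors for some v, and the best result over all v is at least as good as the
-- one for that v. The logarithm is given by upper Darboux sums, each of which is at least the
-- harmonic number minus 1, so that no limit has to be taken.

infixl 6 _⊕_ _⊖_
infix 8 _⟦_⟧
infix 3 _:=_ _⟦_⟧:=_
infixr 2 _⨾_

data Expr : Set where
  var lit : ℕ → Expr
  _⊕_ _⊖_ : Expr → Expr → Expr
  _⟦_⟧    : ℕ → Expr → Expr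
  ifz     : Expr → Expr → Expr → Expr

-- The number of rounds of a `loop` is fixed on entry, so every command terminates. A conditional
-- command is a loop of 0 or 1 rounds.
data Cmd : Set where
  _:=_   : ℕ → Expr → Cmd
  _⟦_⟧:=_ : ℕ → Expr → Expr → Cmd
  _⨾_    : Cmd → Cmd → Cmd
  loop   : Expr → Cmd → Cmd

-- The clock is ghost state: it counts loop iterations only.
record State : Set where
  constructor state
  field
    vars  : ℕ → ℕ
    arrs  : ℕ → ℕ → ℕ
    clock : ℕ

open State public

ifzero : {A : Set} → ℕ → A → A → A
ifzero zero    x y = x
ifzero (suc _) x y = y

-- Boolean equality makes updates at numerals compute, so that for concrete variables an unaffected
-- value is often unchanged by `refl`.
set : (ℕ → ℕ) → ℕ → ℕ → ℕ → ℕ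
set f a x b = if b ≡ᵇ a then x else f b

-- The bounds check keeps the arrays disjoint in memory whatever the program does.
write : ℕ → (ℕ → ℕ → ℕ) → ℕ → ℕ → ℕ → ℕ → ℕ → ℕ
write cap A k i x k′ = if k′ ≡ᵇ k then (if i <ᵇ cap then set (A k′) i x else A k′) else A k′

eval : Expr → State → ℕ
eval (var x)     s = vars s x
eval (lit k)     s = k
eval (a ⊕ b)     s = eval a s + eval b s
eval (a ⊖ b)     s = eval a s ∸ eval b s
eval (k ⟦ a ⟧)   s = arrs s k (eval a s)
eval (ifz a b c) s = ifzero (eval a s) (eval b s) (eval c s)

tick : State → State
tick s = state (vars s) (arrs s) (suc (clock s))

iterate : ℕ → (State → State) → State → State
iterate zero    f s = s
iterate (suc k) f s = iterate k f (f s)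

run : ℕ → Cmd → State → State
run cap (x := e)       s = state (set (vars s) x (eval e s)) (arrs s) (clock s)
run cap (k ⟦ i ⟧:= e)  s = state (vars s) (write cap (arrs s) k (eval i s) (eval e s)) (clock s)
run cap (c ⨾ d)        s = run cap d (run cap c s)
run cap (loop e c)     s = iterate (eval e s) (λ s → run cap c (tick s)) s

≡ᵇ-refl : ∀ a → (a ≡ᵇ a) ≡ true
≡ᵇ-refl zero    = refl
≡ᵇ-refl (suc a) = ≡ᵇ-refl a

≢⇒≡ᵇ : ∀ {a b} → a ≢ b → (a ≡ᵇ b) ≡ false
≢⇒≡ᵇ {a} {b} a≢b with a ≡ᵇ b in eq
... | false = refl
... | true  = contradiction (≡ᵇ⇒≡ a b (subst T (sym eq) tt)) a≢b

<⇒<ᵇ≡ : ∀ {a b} → a < b → (a <ᵇ b) ≡ true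
<⇒<ᵇ≡ {a} {b} a<b with a <ᵇ b | <⇒<ᵇ a<b
... | true | _ = refl

≥⇒<ᵇ≡ : ∀ {a b} → b ≤ a → (a <ᵇ b) ≡ false
≥⇒<ᵇ≡ {a} {b} b≤a with a <ᵇ b in eq
... | false = refl
... | true  = contradiction (<ᵇ⇒< a b (subst T (sym eq) tt)) (≤⇒≯ b≤a)

set-same : ∀ f {a b} x → b ≡ a → set f a x b ≡ x
set-same f {a} x refl rewrite ≡ᵇ-refl a = refl

set-other : ∀ f {a b} x → b ≢ a → set f a x b ≡ f b
set-other f x b≢a rewrite ≢⇒≡ᵇ b≢a = refl

≔-same : ∀ f a {x} → (f [ a ≔ x ]) a ≡ x
≔-same f a with a ≟ a
... | yes _  = refl
... | no a≢a = contradiction refl a≢a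

≔-other : ∀ f {a x b} → b ≢ a → (f [ a ≔ x ]) b ≡ f b
≔-other f {a} {x} {b} b≢a with b ≟ a
... | yes b≡a = contradiction b≡a b≢a
... | no _    = refl

-- Variables live in the even registers; register 1 holds the array capacity,
-- and the odd registers from 3 on are temporaries. Array k occupies the
-- memory cells k·cap … k·cap + cap ∸ 1.
vreg treg : ℕ → ℕ
vreg x = 2 * x
treg d = suc (2 * d)

sizeE : Expr → ℕ
sizeE (var x)     = 2
sizeE (lit k)     = 1
sizeE (a ⊕ b)     = sizeE a + (sizeE b + 1)
sizeE (a ⊖ b)     = sizeE a + (sizeE b + 1)
sizeE (k ⟦ a ⟧)   = sizeE a + (2 + (k + 3))
sizeE (ifz a b c) = sizeE a + (1 + (sizeE c + (1 + sizeE b)))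

-- The value ends up in `treg d`; lower temporaries hold values that the surrounding code still
-- needs. Jumps are absolute, hence the load address `p`.
compileE : (e : Expr) (d p : ℕ) → Vec Instr (sizeE e)
-- No instruction copies a register; a copy is an addition to 0.
compileE (var x) d p = const (treg d) 0 ∷ add (treg d) (treg d) (vreg x) ∷ []
compileE (lit k) d p = const (treg d) k ∷ []
compileE (a ⊕ b) d p =
  compileE a d p ++ (compileE b (suc d) (sizeE a + p) ++ [ add (treg d) (treg d) (treg (suc d)) ])
compileE (a ⊖ b) d p =
  compileE a d p ++ (compileE b (suc d) (sizeE a + p) ++ [ sub (treg d) (treg d) (treg (suc d)) ])
-- The capacity minus the index is zero exactly when the index is out of bounds; the jump then leads
-- to the last instruction, which makes the value 0.
compileE (k ⟦ a ⟧) d p =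
  compileE a d p ++
  ((sub (treg (suc d)) 1 (treg d) ∷ jumpZero (treg (suc d)) (4 + (k + (sizeE a + p))) ∷ []) ++
   (replicate k (add (treg d) (treg d) 1) ++
    (load (treg d) (treg d) ∷ jump (5 + (k + (sizeE a + p))) ∷ const (treg d) 0 ∷ [])))
compileE (ifz a b c) d p =
  compileE a d p ++
  (jumpZero (treg d) (2 + (sizeE c + (sizeE a + p))) ∷
   (compileE c d (1 + (sizeE a + p)) ++
    (jump (2 + (sizeE b + (sizeE c + (sizeE a + p)))) ∷
     compileE b d (2 + (sizeE c + (sizeE a + p))))))

sizeC : Cmd → ℕ
sizeC (x := e)      = sizeE e + 2
sizeC (k ⟦ i ⟧:= e) = sizeE i + (sizeE e + (2 + (k + 1)))
sizeC (c ⨾ d)       = sizeC c + sizeC d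
sizeC (loop e c)    = sizeE e + (1 + (sizeC c + 3))

compileC : (c : Cmd) (d p : ℕ) → Vec Instr (sizeC c)
compileC (x := e) d p =
  compileE e d p ++ (const (vreg x) 0 ∷ add (vreg x) (vreg x) (treg d) ∷ [])
compileC (k ⟦ i ⟧:= e) d p =
  compileE i d p ++ (compileE e (suc d) (sizeE i + p) ++
  ((sub (treg (2 + d)) 1 (treg d) ∷
    jumpZero (treg (2 + d)) (3 + (k + (sizeE e + (sizeE i + p)))) ∷ []) ++
   (replicate k (add (treg d) (treg d) 1) ++ [ store (treg d) (treg (suc d)) ])))
compileC (c ⨾ e) d p = compileC c d p ++ compileC e d (sizeC c + p)
-- The counter stays in `treg d` for the whole loop, so the body is compiled one level deeper. The
-- last jump returns to the test, behind the code of `e`.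
compileC (loop e c) d p =
  compileE e d p ++
  (jumpZero (treg d) (4 + (sizeC c + (sizeE e + p))) ∷
   (compileC c (suc d) (1 + (sizeE e + p)) ++
    (const (treg (suc d)) 1 ∷ sub (treg d) (treg d) (treg (suc d)) ∷ jump (sizeE e + p) ∷ [])))

-- Correctness and running time of compiled code

At : ∀ {k} → Program → ℕ → Vec Instr k → Set
At P p []       = ⊤
At P p (i ∷ is) = fetch P p ≡ just i × At P (suc p) is

At-++ : ∀ {k l} P p (xs : Vec Instr k) {ys : Vec Instr l} →
        At P p (xs ++ ys) → At P p xs × At P (k + p) ys
At-++ P p []       at         = tt , at
At-++ {suc k} P p (x ∷ xs) {ys} (eq , at) with At-++ P (suc p) xs at
... | at₁ , at₂ = (eq , at₁) , subst (λ q → At P q ys) (+-suc k p) at₂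

-- Unlike `_⊢_⇓_after_`, this does not end in a halt, so runs can be concatenated.
data Steps (P : Program) : Config → Config → ℕ → Set where
  done : ∀ {c} → Steps P c c 0
  next : ∀ {c c′ i t} → fetch P (pc c) ≡ just i → Steps P (exec i c) c′ t → Steps P c c′ (suc t)

Steps-trans : ∀ {P c₁ c₂ c₃ t u} → Steps P c₁ c₂ t → Steps P c₂ c₃ u → Steps P c₁ c₃ (t + u)
Steps-trans done        q = q
Steps-trans (next eq p) q = next eq (Steps-trans p q)

Steps-halt : ∀ {P c₁ c₂ t} → Steps P c₁ c₂ t → fetch P (pc c₂) ≡ nothing → P ⊢ c₁ ⇓ c₂ after t
Steps-halt done        h = halt h
Steps-halt (next eq p) h = step eq (Steps-halt p h)

Reach : Program → Config → Config → ℕ → Set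
Reach P c c′ T = ∃[ t ] t ≤ T × Steps P c c′ t

infixr 5 _then_
_then_ : ∀ {P c₁ c₂ c₃ T U} → Reach P c₁ c₂ T → Reach P c₂ c₃ U → Reach P c₁ c₃ (T + U)
(t , t≤ , p) then (u , u≤ , q) = t + u , +-mono-≤ t≤ u≤ , Steps-trans p q

one : ∀ {P c i} → fetch P (pc c) ≡ just i → Reach P c (exec i c) 1
one eq = 1 , ≤-refl , next eq done

stay : ∀ {P c} → Reach P c c 0
stay = 0 , z≤n , done

weaken : ∀ {P c c′ T U} → T ≤ U → Reach P c c′ T → Reach P c c′ U
weaken T≤U (t , t≤ , p) = t , ≤-trans t≤ T≤U , p

at-pc : ∀ {P c p p′ f m T} → p ≡ p′ → Reach P c ⟨ p , f , m ⟩ T → Reach P c ⟨ p′ , f , m ⟩ T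
at-pc refl r = r

jz-zero : ∀ {P p f m r ℓ} → fetch P p ≡ just (jumpZero r ℓ) → f r ≡ 0 →
          Reach P ⟨ p , f , m ⟩ ⟨ ℓ , f , m ⟩ 1
jz-zero {P} {p} {f} {m} {r} {ℓ} eq z = subst (λ c → Reach P _ c 1) lemma (one eq)
  where
  lemma : exec (jumpZero r ℓ) ⟨ p , f , m ⟩ ≡ ⟨ ℓ , f , m ⟩
  lemma rewrite z = refl

jz-suc : ∀ {P p f m r ℓ k} → fetch P p ≡ just (jumpZero r ℓ) → f r ≡ suc k →
         Reach P ⟨ p , f , m ⟩ ⟨ suc p , f , m ⟩ 1
jz-suc {P} {p} {f} {m} {r} {ℓ} {k} eq z = subst (λ c → Reach P _ c 1) lemma (one eq)
  where
  lemma : exec (jumpZero r ℓ) ⟨ p , f , m ⟩ ≡ ⟨ suc p , f , m ⟩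
  lemma rewrite z = refl

vreg-inj : ∀ {x y} → vreg x ≡ vreg y → x ≡ y
vreg-inj {x} {y} = *-cancelˡ-≡ x y 2

treg-inj : ∀ {x y} → treg x ≡ treg y → x ≡ y
treg-inj = vreg-inj ∘ suc-injective

vreg≢treg : ∀ x d → vreg x ≢ treg d
vreg≢treg = even≢odd

-- `sim-out` mirrors the bounds check of compiled reads, which yield 0 beyond the capacity.
record Sim (cap : ℕ) (f m : ℕ → ℕ) (s : State) : Set where
  field
    sim-vars : ∀ x → f (vreg x) ≡ vars s x
    sim-cap  : f 1 ≡ cap
    sim-arrs : ∀ k i → i < cap → m (k * cap + i) ≡ arrs s k i
    sim-out  : ∀ k i → cap ≤ i → arrs s k i ≡ 0

open Sim

record Keeps (d : ℕ) (f f′ : ℕ → ℕ) : Set where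
  constructor keeps
  field
    keeps-vars  : ∀ x → f′ (vreg x) ≡ f (vreg x)
    keeps-temps : ∀ e → e < d → f′ (treg e) ≡ f (treg e)

open Keeps

Keeps-trans : ∀ {d d′ f g h} → d ≤ d′ → Keeps d f g → Keeps d′ g h → Keeps d f h
Keeps-trans d≤d′ (keeps a b) (keeps a′ b′) =
  keeps (λ x → trans (a′ x) (a x)) λ e e<d → trans (b′ e (≤-trans e<d d≤d′)) (b e e<d)

Keeps-other : ∀ {d e f f′} → d ≤ e → (∀ r → r ≢ treg d → r ≢ treg e → f′ r ≡ f r) → Keeps d f f′
Keeps-other {d} {e} d≤e other = keeps
  (λ x → other (vreg x) (vreg≢treg x d) (vreg≢treg x e))
  λ c c<d → other (treg c) (λ eq → <⇒≢ c<d (treg-inj eq)) (λ eq → <⇒≢ (≤-trans c<d d≤e) (treg-inj eq))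

Keeps-≔ : ∀ {d e f x} → d ≤ e → Keeps d f (f [ treg e ≔ x ])
Keeps-≔ {f = f} d≤e = Keeps-other d≤e λ r _ r≢ → ≔-other f r≢

-- Register 1, which holds the capacity, is `treg 0`; `1 ≤ d` protects it.
Keeps-sim : ∀ {cap d f f′ m s} → 1 ≤ d → Keeps d f f′ → Sim cap f m s → Sim cap f′ m s
Keeps-sim 1≤d (keeps a b) sim = record
  { sim-vars = λ x → trans (a x) (sim-vars sim x)
  ; sim-cap  = trans (b 0 1≤d) (sim-cap sim)
  ; sim-arrs = sim-arrs sim
  ; sim-out  = sim-out sim
  }

-- The machine does not multiply, so k · cap is added in k steps.
offset-correct : ∀ {cap P p d} k f m → At P p (replicate k (add (treg d) (treg d) 1)) → 1 ≤ d →
  f 1 ≡ cap →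
  ∃[ f′ ] Reach P ⟨ p , f , m ⟩ ⟨ k + p , f′ , m ⟩ k × f′ (treg d) ≡ k * cap + f (treg d) ×
    (∀ r → r ≢ treg d → f′ r ≡ f r)
offset-correct zero f m at 1≤d cap≡ = f , stay , refl , λ _ _ → refl
offset-correct {cap} {P} {p} {d} (suc k) f m (eq , at) 1≤d cap≡ =
  let f₁ = f [ treg d ≔ f (treg d) + f 1 ]
      f′ , r , v , keep = offset-correct k f₁ m at 1≤d (trans (≔-other f 1≢) cap≡)
  in f′ , at-pc (+-suc k p) (one eq then r) ,
     trans v (trans (cong (k * cap +_) (trans (≔-same f (treg d)) (cong (f (treg d) +_) cap≡)))
       (lemma (k * cap) (f (treg d)) cap)) ,
     λ r r≢ → trans (keep r r≢) (≔-other f r≢)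
  where
  1≢ : 1 ≢ treg d
  1≢ eq = <⇒≢ 1≤d (treg-inj {0} {d} eq)
  lemma : ∀ a b c → a + (b + c) ≡ c + a + b
  lemma = solve-∀

m<n⇒n∸m≡suc : ∀ {m n} → m < n → ∃[ j ] n ∸ m ≡ suc j
m<n⇒n∸m≡suc {zero}  {suc n} _       = n , refl
m<n⇒n∸m≡suc {suc m} {suc n} (s≤s q) = m<n⇒n∸m≡suc q

address-correct : ∀ {cap P p d e ℓ} k f m → 
  At P p ((sub (treg e) 1 (treg d) ∷ jumpZero (treg e) ℓ ∷ []) ++ replicate k (add (treg d) (treg d) 1)) →
  1 ≤ d → d < e → f 1 ≡ cap →
  (f (treg d) < cap × ∃[ f′ ] Reach P ⟨ p , f , m ⟩ ⟨ k + (2 + p) , f′ , m ⟩ (2 + k) ×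
     f′ (treg d) ≡ k * cap + f (treg d) × (∀ r → r ≢ treg d → r ≢ treg e → f′ r ≡ f r))
  ⊎ (cap ≤ f (treg d) × ∃[ f′ ] Reach P ⟨ p , f , m ⟩ ⟨ ℓ , f′ , m ⟩ 2 ×
     (∀ r → r ≢ treg e → f′ r ≡ f r))
address-correct {cap} {P} {p} {d} {e} {ℓ} k f m (eq₁ , eq₂ , at) 1≤d d<e cap≡ =
  case f (treg d) <? cap of λ
    { (yes i<cap) →
        let j , j≡ = m<n⇒n∸m≡suc i<cap
            f₂ , r , v , other = offset-correct k f₁ m at 1≤d (trans (≔-other f (1≢ (<-trans 1≤d d<e))) cap≡)
        in inj₁ (i<cap , f₂ , one eq₁ then jz-suc eq₂ (trans test j≡) then r ,
             trans v (cong (k * cap +_) (≔-other f (λ eq → <⇒≢ d<e (treg-inj eq)))) ,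
             λ r r≢d r≢e → trans (other r r≢d) (≔-other f r≢e))
    ; (no i≮cap) → inj₂ (≮⇒≥ i≮cap , f₁ ,
        one eq₁ then jz-zero eq₂ (trans test (m≤n⇒m∸n≡0 (≮⇒≥ i≮cap))) , λ r r≢ → ≔-other f r≢) }
  where
  f₁ = f [ treg e ≔ f 1 ∸ f (treg d) ]
  test : f₁ (treg e) ≡ cap ∸ f (treg d)
  test = trans (≔-same f (treg e)) (cong (_∸ f (treg d)) cap≡)
  1≢ : ∀ {e} → 1 ≤ e → 1 ≢ treg e
  1≢ {e} 1≤e eq = <⇒≢ 1≤e (treg-inj {0} {e} eq)

-- Code for expressions only jumps forwards, so its length bounds its steps and no clock is
-- involved.
ExprCorrect : ℕ → Expr → Set
ExprCorrect cap e = ∀ {P f m s} d p → At P p (compileE e d p) → Sim cap f m s → 1 ≤ d →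
  ∃[ f′ ] Reach P ⟨ p , f , m ⟩ ⟨ sizeE e + p , f′ , m ⟩ (sizeE e) ×
    f′ (treg d) ≡ eval e s × Keeps d f f′

At-join : ∀ {k l} P p (xs : Vec Instr k) {ys : Vec Instr l} → At P p xs → At P (k + p) ys → At P p (xs ++ ys)
At-join P p []       at₁        at₂ = at₂
At-join {suc k} P p (x ∷ xs) {ys} (eq , at₁) at₂ =
  eq , At-join P (suc p) xs at₁ (subst (λ q → At P q ys) (sym (+-suc k p)) at₂)

compileE-correct : ∀ cap e → ExprCorrect cap e
compileE-correct cap (var x) {f = f} {s = s} d p (eq₁ , eq₂ , _) sim 1≤d =
  let f₁ = f [ treg d ≔ 0 ]
      f₂ = f₁ [ treg d ≔ f₁ (treg d) + f₁ (vreg x) ]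
  in f₂ , one eq₁ then one eq₂ ,
     trans (≔-same f₁ (treg d)) (trans (cong₂ _+_ (≔-same f (treg d)) (≔-other f (vreg≢treg x d))) (sim-vars sim x)) ,
     Keeps-trans ≤-refl (Keeps-≔ ≤-refl) (Keeps-≔ ≤-refl)
compileE-correct cap (lit k) {f = f} d p (eq , _) sim 1≤d =
  f [ treg d ≔ k ] , one eq , ≔-same f (treg d) , Keeps-≔ ≤-refl
compileE-correct cap (a ⊕ b) {P} {f} {m} {s} d p at sim 1≤d =
  let at₁ , at′ = At-++ P p (compileE a d p) at
      at₂ , eq , _ = At-++ P (sizeE a + p) (compileE b (suc d) (sizeE a + p)) at′
      f₁ , r₁ , v₁ , k₁ = compileE-correct cap a d p at₁ sim 1≤d
      f₂ , r₂ , v₂ , k₂ = compileE-correct cap b (suc d) (sizeE a + p) at₂ (Keeps-sim 1≤d k₁ sim) (s≤s z≤n)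
  in f₂ [ treg d ≔ f₂ (treg d) + f₂ (treg (suc d)) ] ,
     at-pc (pc-end p (sizeE a) (sizeE b)) (r₁ then r₂ then one eq) ,
     trans (≔-same f₂ (treg d)) (cong₂ _+_ (trans (keeps-temps k₂ d ≤-refl) v₁) v₂) ,
     Keeps-trans ≤-refl (Keeps-trans (n≤1+n d) k₁ k₂) (Keeps-≔ ≤-refl)
  where
  pc-end : ∀ p k l → suc (l + (k + p)) ≡ k + (l + 1) + p
  pc-end = solve-∀
compileE-correct cap (a ⊖ b) {P} {f} {m} {s} d p at sim 1≤d =
  let at₁ , at′ = At-++ P p (compileE a d p) at
      at₂ , eq , _ = At-++ P (sizeE a + p) (compileE b (suc d) (sizeE a + p)) at′
      f₁ , r₁ , v₁ , k₁ = compileE-correct cap a d p at₁ sim 1≤d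
      f₂ , r₂ , v₂ , k₂ = compileE-correct cap b (suc d) (sizeE a + p) at₂ (Keeps-sim 1≤d k₁ sim) (s≤s z≤n)
  in f₂ [ treg d ≔ f₂ (treg d) ∸ f₂ (treg (suc d)) ] ,
     at-pc (pc-end p (sizeE a) (sizeE b)) (r₁ then r₂ then one eq) ,
     trans (≔-same f₂ (treg d)) (cong₂ _∸_ (trans (keeps-temps k₂ d ≤-refl) v₁) v₂) ,
     Keeps-trans ≤-refl (Keeps-trans (n≤1+n d) k₁ k₂) (Keeps-≔ ≤-refl)
  where
  pc-end : ∀ p k l → suc (l + (k + p)) ≡ k + (l + 1) + p
  pc-end = solve-∀
compileE-correct cap (k ⟦ a ⟧) {P} {f} {m} {s} d p at sim 1≤d =
  let at₁ , at′ = At-++ P p (compileE a d p) at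
      q = sizeE a + p
      test = sub (treg (suc d)) 1 (treg d) ∷ jumpZero (treg (suc d)) (4 + (k + q)) ∷ []
      at-test , at″ = At-++ P q test at′
      at-add , eq₁ , eq₂ , eq₃ , _ = At-++ P (2 + q) (replicate k (add (treg d) (treg d) 1)) at″
      f₁ , r₁ , v₁ , k₁ = compileE-correct cap a d p at₁ sim 1≤d
      sim₁ = Keeps-sim 1≤d k₁ sim
  in case address-correct k f₁ m (At-join P q test at-test at-add) 1≤d (n<1+n d) (sim-cap sim₁) of λ
    { (inj₁ (i<cap , f₂ , r₂ , v₂ , other)) →
        f₂ [ treg d ≔ m (f₂ (treg d)) ] ,
        weaken (time₁ (sizeE a) k) (at-pc (pc₁ p (sizeE a) k)
          (r₁ then r₂ then one eq₁ then one eq₂)) ,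
        trans (≔-same f₂ (treg d))
          (trans (cong m (trans v₂ (cong (k * cap +_) v₁)))
                 (sim-arrs sim k (eval a s) (subst (_< cap) v₁ i<cap))) ,
        Keeps-trans ≤-refl (Keeps-trans ≤-refl k₁ (Keeps-other (n≤1+n d) other)) (Keeps-≔ ≤-refl)
    ; (inj₂ (cap≤i , f₂ , r₂ , other)) →
        f₂ [ treg d ≔ 0 ] ,
        weaken (time₂ (sizeE a) k) (at-pc (pc₁ p (sizeE a) k)
          (r₁ then r₂ then one (trans (cong (fetch P) (pc₂ k q)) eq₃))) ,
        trans (≔-same f₂ (treg d)) (sym (sim-out sim k (eval a s) (subst (cap ≤_) v₁ cap≤i))) ,
        Keeps-trans ≤-refl (Keeps-trans ≤-refl k₁ (Keeps-other (n≤1+n d) (λ r _ → other r))) (Keeps-≔ ≤-refl) }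
  where
  time₁ : ∀ a k → a + (2 + k + (1 + 1)) ≤ a + (2 + (k + 3))
  time₁ a k = +-monoʳ-≤ a (≤-trans (≤-reflexive (+-assoc 2 k 2)) (+-monoʳ-≤ 2 (+-monoʳ-≤ k (n≤1+n 2))))
  time₂ : ∀ a k → a + (2 + 1) ≤ a + (2 + (k + 3))
  time₂ a k = +-monoʳ-≤ a (s≤s (s≤s (≤-trans (s≤s z≤n) (m≤n+m 3 k))))
  pc₁ : ∀ p a k → 5 + (k + (a + p)) ≡ a + (2 + (k + 3)) + p
  pc₁ = solve-∀
  pc₂ : ∀ k q → 4 + (k + q) ≡ suc (suc (k + (2 + q)))
  pc₂ = solve-∀
compileE-correct cap (ifz a b c) {P} {f} {m} {s} d p at sim 1≤d =
  let at₁ , eq₁ , at′ = At-++ P p (compileE a d p) at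
      q = sizeE a + p
      at-c , eq₂ , at-b′ = At-++ P (1 + q) (compileE c d (1 + q)) at′
      at-b = subst (λ x → At P x (compileE b d (2 + (sizeE c + q)))) (cong suc (+-suc (sizeE c) q)) at-b′
      f₁ , r₁ , v₁ , k₁ = compileE-correct cap a d p at₁ sim 1≤d
      sim₁ = Keeps-sim 1≤d k₁ sim
      f₂ , r₂ , v₂ , k₂ = compileE-correct cap b d (2 + (sizeE c + q)) at-b sim₁ 1≤d
      f₃ , r₃ , v₃ , k₃ = compileE-correct cap c d (1 + q) at-c sim₁ 1≤d
  in branch (eval a s) r₁ v₁ eq₁ r₂ v₂ (Keeps-trans ≤-refl k₁ k₂) r₃ v₃ (Keeps-trans ≤-refl k₁ k₃) eq₂
  where
  q = sizeE a + p
  pc-b : ∀ p a b c → b + (2 + (c + (a + p))) ≡ a + (1 + (c + (1 + b))) + p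
  pc-b = solve-∀
  pc-c : ∀ p a b c → 2 + (b + (c + (a + p))) ≡ a + (1 + (c + (1 + b))) + p
  pc-c = solve-∀
  time-b : ∀ a b c → a + (1 + b) ≤ a + (1 + (c + (1 + b)))
  time-b a b c = +-monoʳ-≤ a (s≤s (≤-trans (n≤1+n b) (m≤n+m (1 + b) c)))
  time-c : ∀ a b c → a + (1 + (c + 1)) ≤ a + (1 + (c + (1 + b)))
  time-c a b c = +-monoʳ-≤ a (s≤s (+-monoʳ-≤ c (s≤s z≤n)))
  branch : ∀ t {f₁ f₂ f₃ x y} →
    Reach P ⟨ p , f , m ⟩ ⟨ q , f₁ , m ⟩ (sizeE a) → f₁ (treg d) ≡ t →
    fetch P q ≡ just (jumpZero (treg d) (2 + (sizeE c + q))) →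
    Reach P ⟨ 2 + (sizeE c + q) , f₁ , m ⟩ ⟨ sizeE b + (2 + (sizeE c + q)) , f₂ , m ⟩ (sizeE b) →
    f₂ (treg d) ≡ x → Keeps d f f₂ →
    Reach P ⟨ 1 + q , f₁ , m ⟩ ⟨ sizeE c + (1 + q) , f₃ , m ⟩ (sizeE c) →
    f₃ (treg d) ≡ y → Keeps d f f₃ →
    fetch P (sizeE c + (1 + q)) ≡ just (jump (2 + (sizeE b + (sizeE c + q)))) →
    ∃[ f′ ] Reach P ⟨ p , f , m ⟩ ⟨ sizeE (ifz a b c) + p , f′ , m ⟩ (sizeE (ifz a b c)) ×
      f′ (treg d) ≡ ifzero t x y × Keeps d f f′
  branch zero    r₁ v₁ eq₁ r₂ v₂ k₂ r₃ v₃ k₃ eq₂ = _ ,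
    weaken (time-b (sizeE a) (sizeE b) (sizeE c)) (at-pc (pc-b p (sizeE a) (sizeE b) (sizeE c))
      (r₁ then jz-zero eq₁ v₁ then r₂)) , v₂ , k₂
  branch (suc t) r₁ v₁ eq₁ r₂ v₂ k₂ r₃ v₃ k₃ eq₂ = _ ,
    weaken (time-c (sizeE a) (sizeE b) (sizeE c)) (at-pc (pc-c p (sizeE a) (sizeE b) (sizeE c))
      (r₁ then jz-suc eq₁ v₁ then r₃ then one eq₂)) , v₃ , k₃

open Sim
open Keeps

-- Uniqueness of quotient and remainder. It keeps the arrays apart in memory and, with n for `cap`,
-- the entries of a matrix apart within their array.
cell-injective : ∀ {cap k i k′ i′} → i < cap → i′ < cap → k * cap + i ≡ k′ * cap + i′ → k ≡ k′ × i ≡ i′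
cell-injective {cap} {zero}  {i} {zero}   i< i′< eq = refl , eq
cell-injective {cap} {zero}  {i} {suc k′} {i′} i< i′< eq =
  contradiction i< (≤⇒≯ (≤-trans (m≤m+n cap (k′ * cap + i′)) (≤-reflexive (trans (sym (+-assoc cap (k′ * cap) i′)) (sym eq)))))
cell-injective {cap} {suc k} {i} {zero} {i′} i< i′< eq =
  contradiction i′< (≤⇒≯ (≤-trans (m≤m+n cap (k * cap + i)) (≤-reflexive (trans (sym (+-assoc cap (k * cap) i)) eq))))
cell-injective {cap} {suc k} {i} {suc k′} {i′} i< i′< eq =
  let k≡ , i≡ = cell-injective {cap} {k} {i} {k′} {i′} i< i′<
        (+-cancelˡ-≡ cap _ _ (trans (sym (+-assoc cap (k * cap) i)) (trans eq (+-assoc cap (k′ * cap) i′))))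
  in cong suc k≡ , i≡

write-out : ∀ {cap} A k i x → cap ≤ i → ∀ k′ i′ → write cap A k i x k′ i′ ≡ A k′ i′
write-out A k i x cap≤i k′ i′ with k′ ≡ᵇ k
... | false = refl
... | true rewrite ≥⇒<ᵇ≡ cap≤i = refl

write-same : ∀ {cap} A k {i} x → i < cap → ∀ j → write cap A k i x k j ≡ set (A k) i x j
write-same A k x i<cap j rewrite ≡ᵇ-refl k | <⇒<ᵇ≡ i<cap = refl

write-other : ∀ {cap} A {k} i x {k′} → k′ ≢ k → ∀ j → write cap A k i x k′ j ≡ A k′ j
write-other A i x k′≢k j rewrite ≢⇒≡ᵇ k′≢k = refl

write-beyond : ∀ {cap} A k i x k′ {j} → cap ≤ j → write cap A k i x k′ j ≡ A k′ j
write-beyond {cap} A k i x k′ {j} cap≤j with k′ ≡ᵇ k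
... | false = refl
... | true with i <? cap
... | yes i<cap rewrite <⇒<ᵇ≡ i<cap = set-other (A k′) x λ { refl → <⇒≱ i<cap cap≤j }
... | no i≮cap rewrite ≥⇒<ᵇ≡ (≮⇒≥ i≮cap) = refl

Sim-store : ∀ {cap f m s} k i x → i < cap → Sim cap f m s →
            Sim cap f (m [ k * cap + i ≔ x ]) (state (vars s) (write cap (arrs s) k i x) (clock s))
Sim-store {cap} {f} {m} {s} k i x i<cap sim = record
  { sim-vars = sim-vars sim
  ; sim-cap  = sim-cap sim
  ; sim-arrs = arrays
  ; sim-out  = λ k′ j cap≤j → trans (write-beyond (arrs s) k i x k′ cap≤j) (sim-out sim k′ j cap≤j)
  }
  where
  arrays : ∀ k′ j → j < cap → (m [ k * cap + i ≔ x ]) (k′ * cap + j) ≡ write cap (arrs s) k i x k′ j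
  arrays k′ j j<cap with k′ ≟ k
  ... | no k′≢k = trans (≔-other m λ eq → k′≢k (proj₁ (cell-injective {k = k′} j<cap i<cap eq)))
                  (trans (sim-arrs sim k′ j j<cap) (sym (write-other {cap} (arrs s) i x k′≢k j)))
  ... | yes refl with j ≟ i
  ... | yes refl = trans (≔-same m (k * cap + i)) (sym (trans (write-same (arrs s) k x i<cap i) (set-same (arrs s k) x refl)))
  ... | no j≢i = trans (≔-other m λ eq → j≢i (+-cancelˡ-≡ (k * cap) j i eq))
                 (trans (sim-arrs sim k j j<cap) (sym (trans (write-same (arrs s) k x i<cap j) (set-other (arrs s k) x j≢i))))

Sim-cong : ∀ {cap f m s s′} → (∀ x → vars s x ≡ vars s′ x) → (∀ k i → arrs s k i ≡ arrs s′ k i) →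
           Sim cap f m s → Sim cap f m s′
Sim-cong vs as sim = record
  { sim-vars = λ x → trans (sim-vars sim x) (vs x)
  ; sim-cap  = sim-cap sim
  ; sim-arrs = λ k i i< → trans (sim-arrs sim k i i<) (as k i)
  ; sim-out  = λ k i i≥ → trans (sym (as k i)) (sim-out sim k i i≥)
  }

iterate-mono : ∀ {f} → (∀ s → clock s ≤ clock (f s)) → ∀ k s → clock s ≤ clock (iterate k f s)
iterate-mono mono zero    s = ≤-refl
iterate-mono {f} mono (suc k) s = ≤-trans (mono s) (iterate-mono mono k (f s))

clock-mono : ∀ cap c s → clock s ≤ clock (run cap c s)
clock-mono cap (x := e)      s = ≤-refl
clock-mono cap (k ⟦ i ⟧:= e) s = ≤-refl
clock-mono cap (c ⨾ d)       s = ≤-trans (clock-mono cap c s) (clock-mono cap d (run cap c s))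
clock-mono cap (loop e c)    s =
  iterate-mono (λ s → ≤-trans (n≤1+n (clock s)) (clock-mono cap c (tick s))) (eval e s) s

-- At most z steps per clock tick and z further ones, where z is the length of
-- the code; stated without subtraction.
record Executes (cap : ℕ) (P : Program) (p p′ : ℕ) (d : ℕ) (f m : ℕ → ℕ) (z : ℕ) (s s′ : State) : Set where
  constructor executes
  field
    {f′ m′} : ℕ → ℕ
    {time}  : ℕ
    reach   : Reach P ⟨ p , f , m ⟩ ⟨ p′ , f′ , m′ ⟩ time
    bound   : time + z * clock s ≤ z * suc (clock s′)
    sim′    : Sim cap f′ m′ s′
    temps   : ∀ e → e < d → f′ (treg e) ≡ f (treg e)

open Executes

const-time : ∀ z c → z + z * c ≤ z * suc c
const-time z c = ≤-reflexive (sym (*-suc z c))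

-- Each part is charged to its own stretch of the clock; since the clock never goes back, both
-- charges extend to the whole stretch.
seq-time : ∀ {t t′} z z′ {c c₁ c₂} → c ≤ c₁ → c₁ ≤ c₂ →
           t + z * c ≤ z * suc c₁ → t′ + z′ * c₁ ≤ z′ * suc c₂ → t + t′ + (z + z′) * c ≤ (z + z′) * suc c₂
seq-time {t} {t′} z z′ {c} {c₁} {c₂} c≤ c₁≤ le le′ = begin
  t + t′ + (z + z′) * c          ≡⟨ lemma t t′ z z′ c ⟩
  (t + z * c) + (t′ + z′ * c)    ≤⟨ +-mono-≤ le (+-monoʳ-≤ t′ (*-monoʳ-≤ z′ c≤)) ⟩
  z * suc c₁ + (t′ + z′ * c₁)    ≤⟨ +-mono-≤ (*-monoʳ-≤ z (s≤s c₁≤)) le′ ⟩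
  z * suc c₂ + z′ * suc c₂       ≡⟨ *-distribʳ-+ (suc c₂) z z′ ⟨
  (z + z′) * suc c₂              ∎
  where
  open ≤-Reasoning
  lemma : ∀ t t′ z z′ c → t + t′ + (z + z′) * c ≡ (t + z * c) + (t′ + z′ * c)
  lemma = solve-∀

-- The body starts after the tick of its round, so that tick absorbs the additive `z` of the body's
-- bound. The same tick pays for four instructions: the test, the two that lower the counter, and
-- the jump back. The final 1 is the test that leaves the loop.
round-time : ∀ {t t′} z {c c₁ c₂} → suc c ≤ c₁ → t + z * suc c ≤ z * suc c₁ →
             t′ + (4 + z) * c₁ ≤ (4 + z) * c₂ + 1 →
             1 + (t + (1 + (1 + (1 + t′)))) + (4 + z) * c ≤ (4 + z) * c₂ + 1
round-time {t} {t′} z {c} {c₁} {c₂} c< le le′ = begin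
  1 + (t + (1 + (1 + (1 + t′)))) + (4 + z) * c ≡⟨ lemma₁ t t′ z c ⟩
  4 * suc c + (t + z * c) + t′                 ≤⟨ +-monoˡ-≤ t′ (+-mono-≤ (*-monoʳ-≤ 4 c<) body) ⟩
  4 * c₁ + z * c₁ + t′                         ≡⟨ lemma₂ c₁ z t′ ⟩
  t′ + (4 + z) * c₁                            ≤⟨ le′ ⟩
  (4 + z) * c₂ + 1                             ∎
  where
  open ≤-Reasoning
  lemma₁ : ∀ t t′ z c → 1 + (t + (1 + (1 + (1 + t′)))) + (4 + z) * c ≡ 4 * suc c + (t + z * c) + t′
  lemma₁ = solve-∀
  lemma₂ : ∀ c z t → 4 * c + z * c + t ≡ t + (4 + z) * c
  lemma₂ = solve-∀
  lemma₃ : ∀ t z c → z + (t + z * c) ≡ t + z * suc c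
  lemma₃ = solve-∀
  body : t + z * c ≤ z * c₁
  body = +-cancelˡ-≤ z _ _ (≤-trans (≤-reflexive (lemma₃ t z c)) (≤-trans le (≤-reflexive (*-suc z c₁))))

-- The additive part of the bound covers the evaluation of the count (`y`) and the last test.
loop-time : ∀ {t} y z {c c₁} → c ≤ c₁ → t + (4 + z) * c ≤ (4 + z) * c₁ + 1 →
            y + t + (y + (1 + (z + 3))) * c ≤ (y + (1 + (z + 3))) * suc c₁
loop-time {t} y z {c} {c₁} c≤ le = begin
  y + t + (y + (1 + (z + 3))) * c           ≡⟨ lemma₁ t y z c ⟩
  y + y * c + (t + (4 + z) * c)             ≤⟨ +-mono-≤ (+-monoʳ-≤ y (*-monoʳ-≤ y c≤)) le ⟩
  y + y * c₁ + ((4 + z) * c₁ + 1)           ≤⟨ m≤m+n _ (3 + z) ⟩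
  y + y * c₁ + ((4 + z) * c₁ + 1) + (3 + z) ≡⟨ lemma₂ y z c₁ ⟩
  (y + (1 + (z + 3))) * suc c₁              ∎
  where
  open ≤-Reasoning
  lemma₁ : ∀ t y z c → y + t + (y + (1 + (z + 3))) * c ≡ y + y * c + (t + (4 + z) * c)
  lemma₁ = solve-∀
  lemma₂ : ∀ y z c → y + y * c + ((4 + z) * c + 1) + (3 + z) ≡ (y + (1 + (z + 3))) * suc c
  lemma₂ = solve-∀

compileC-correct : ∀ cap c {P f m s} d p → At P p (compileC c d p) → Sim cap f m s → 1 ≤ d →
  Executes cap P p (sizeC c + p) d f m (sizeC c) s (run cap c s)
compileC-correct cap (x := e) {P} {f} {m} {s} d p at sim 1≤d =
  let at₁ , eq₁ , eq₂ , _ = At-++ P p (compileE e d p) at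
      f₁ , r₁ , v₁ , k₁ = compileE-correct cap e d p at₁ sim 1≤d
      sim₁ = Keeps-sim 1≤d k₁ sim
      f₂ = f₁ [ vreg x ≔ 0 ]
      val = trans (cong₂ _+_ (≔-same f₁ (vreg x)) (trans (≔-other f₁ (λ eq → vreg≢treg x d (sym eq))) v₁)) refl
  in executes (at-pc (pc-end (sizeE e) p) (r₁ then one eq₁ then one eq₂)) (const-time (sizeE e + 2) (clock s))
       (record
         { sim-vars = λ y → trans (vars-eq f₁ (f₂ (vreg x) + f₂ (treg d)) y)
                              (set-cong (sim-vars sim₁) val y)
         ; sim-cap  = trans (≔-other f₂ (λ eq → vreg≢treg x 0 (sym eq)))
                        (trans (≔-other f₁ (λ eq → vreg≢treg x 0 (sym eq))) (sim-cap sim₁))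
         ; sim-arrs = sim-arrs sim
         ; sim-out  = sim-out sim })
       λ c c<d → trans (≔-other f₂ (λ eq → vreg≢treg x c (sym eq)))
                   (trans (≔-other f₁ (λ eq → vreg≢treg x c (sym eq))) (keeps-temps k₁ c c<d))
  where
  pc-end : ∀ a p → 2 + (a + p) ≡ a + 2 + p
  pc-end = solve-∀
  vars-eq : ∀ g v y → ((g [ vreg x ≔ 0 ]) [ vreg x ≔ v ]) (vreg y) ≡ set (λ y → g (vreg y)) x v y
  vars-eq g v y with y ≟ x
  ... | yes refl = trans (≔-same (g [ vreg x ≔ 0 ]) (vreg x)) (sym (set-same (λ y → g (vreg y)) {x} v refl))
  ... | no y≢x = trans (≔-other _ (y≢x ∘ vreg-inj)) (trans (≔-other g (y≢x ∘ vreg-inj)) (sym (set-other (λ y → g (vreg y)) v y≢x)))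
  set-cong : ∀ {g h x v w} → (∀ y → g y ≡ h y) → v ≡ w → ∀ y → set g x v y ≡ set h x w y
  set-cong {x = x} g≗h refl y with y ≡ᵇ x
  ... | true  = refl
  ... | false = g≗h y
compileC-correct cap (k ⟦ i ⟧:= e) {P} {f} {m} {s} d p at sim 1≤d =
  let at₁ , at′ = At-++ P p (compileE i d p) at
      at₂ , at″ = At-++ P (sizeE i + p) (compileE e (suc d) (sizeE i + p)) at′
      q = sizeE e + (sizeE i + p)
      test = sub (treg (2 + d)) 1 (treg d) ∷ jumpZero (treg (2 + d)) (3 + (k + q)) ∷ []
      at-test , at‴ = At-++ P q test at″
      at-add , eq , _ = At-++ P (2 + q) (replicate k (add (treg d) (treg d) 1)) at‴
      f₁ , r₁ , v₁ , k₁ = compileE-correct cap i d p at₁ sim 1≤d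
      f₂ , r₂ , v₂ , k₂ = compileE-correct cap e (suc d) (sizeE i + p) at₂ (Keeps-sim 1≤d k₁ sim) (s≤s z≤n)
      k₁₂ = Keeps-trans (n≤1+n d) k₁ k₂
      sim₂ = Keeps-sim 1≤d k₁₂ sim
      addr = trans (keeps-temps k₂ d ≤-refl) v₁
  in case address-correct k f₂ m (At-join P q test at-test at-add) 1≤d (<-trans (n<1+n d) (n<1+n (suc d))) (sim-cap sim₂) of λ
    { (inj₁ (i<cap , f₃ , r₃ , v₃ , other)) →
        let k₃ = Keeps-trans ≤-refl k₁₂ (Keeps-other (m≤n+m d 2) other)
            val = trans (other (treg (suc d)) (λ eq → <⇒≢ (n<1+n d) (sym (treg-inj eq))) (λ eq → <⇒≢ (n<1+n (suc d)) (treg-inj eq))) v₂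
        in executes (at-pc (pc-end₁ (sizeE i) (sizeE e) k p) (r₁ then r₂ then r₃ then one eq))
             (≤-trans (+-monoˡ-≤ _ (≤-reflexive (time₁ (sizeE i) (sizeE e) k))) (const-time (sizeC (k ⟦ i ⟧:= e)) (clock s)))
             (subst₂ (λ a x → Sim cap f₃ (m [ a ≔ x ]) (run cap (k ⟦ i ⟧:= e) s))
                (sym (trans v₃ (cong (k * cap +_) addr))) (sym val)
                (Sim-store k (eval i s) (eval e s) (subst (_< cap) addr i<cap) (Keeps-sim 1≤d k₃ sim)))
             (keeps-temps k₃)
    ; (inj₂ (cap≤i , f₃ , r₃ , other)) →
        let k₃ = Keeps-trans ≤-refl k₁₂ (Keeps-other (m≤n+m d 2) (λ r _ → other r))
        in executes (at-pc (pc-end (sizeE i) (sizeE e) k p) (r₁ then r₂ then r₃))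
             (≤-trans (+-monoˡ-≤ _ (time₂ (sizeE i) (sizeE e) k)) (const-time (sizeC (k ⟦ i ⟧:= e)) (clock s)))
             (Sim-cong (λ _ → refl)
                (λ k′ j → sym (write-out (arrs s) k (eval i s) (eval e s) (subst (cap ≤_) addr cap≤i) k′ j))
                (Keeps-sim 1≤d k₃ sim))
             (keeps-temps k₃) }
  where
  pc-end₁ : ∀ a b k p → suc (k + (2 + (b + (a + p)))) ≡ a + (b + (2 + (k + 1))) + p
  pc-end₁ = solve-∀
  pc-end : ∀ a b k p → 3 + (k + (b + (a + p))) ≡ a + (b + (2 + (k + 1))) + p
  pc-end = solve-∀
  time₁ : ∀ a b k → a + (b + (2 + k + 1)) ≡ a + (b + (2 + (k + 1)))
  time₁ = solve-∀
  time₂ : ∀ a b k → a + (b + 2) ≤ a + (b + (2 + (k + 1)))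
  time₂ a b k = +-monoʳ-≤ a (+-monoʳ-≤ b (m≤m+n 2 (k + 1)))
compileC-correct cap (c ⨾ e) {P} {f} {m} {s} d p at sim 1≤d =
  let at₁ , at₂ = At-++ P p (compileC c d p) at
      x₁ = compileC-correct cap c d p at₁ sim 1≤d
      x₂ = compileC-correct cap e d (sizeC c + p) at₂ (sim′ x₁) 1≤d
  in executes (at-pc (pc-end (sizeC c) (sizeC e) p) (reach x₁ then reach x₂))
       (seq-time (sizeC c) (sizeC e) (clock-mono cap c s) (clock-mono cap e (run cap c s)) (bound x₁) (bound x₂))
       (sim′ x₂) λ y y<d → trans (temps x₂ y y<d) (temps x₁ y y<d)
  where
  pc-end : ∀ a b p → b + (a + p) ≡ a + b + p
  pc-end = solve-∀
compileC-correct cap (loop e c) {P} {f} {m} {s} d p at sim 1≤d =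
  let at₁ , eq₁ , at′ = At-++ P p (compileE e d p) at
      at₂ , eq₂ , eq₃ , eq₄ , _ = At-++ P (1 + q) (compileC c (suc d) (1 + q)) at′
      f₁ , r₁ , v₁ , k₁ = compileE-correct cap e d p at₁ sim 1≤d
      _ , _ , t , r₂ , b₂ , sim₂ , k₂ = iterations eq₁ at₂ eq₂ eq₃ eq₄ (eval e s) v₁ (Keeps-sim 1≤d k₁ sim)
  in executes (at-pc (pc-end (sizeE e) (sizeC c) p) (r₁ then r₂))
       (loop-time (sizeE e) (sizeC c) (clock-mono cap (loop e c) s) b₂)
       sim₂ λ y y<d → trans (k₂ y y<d) (keeps-temps k₁ y y<d)
  where
  q = sizeE e + p
  z = sizeC c
  pc-end : ∀ a b p → 4 + (b + (a + p)) ≡ a + (1 + (b + 3)) + p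
  pc-end = solve-∀
  iterations : fetch P q ≡ just (jumpZero (treg d) (4 + (z + q))) → At P (1 + q) (compileC c (suc d) (1 + q)) →
    fetch P (z + (1 + q)) ≡ just (const (treg (suc d)) 1) →
    fetch P (suc (z + (1 + q))) ≡ just (sub (treg d) (treg d) (treg (suc d))) →
    fetch P (suc (suc (z + (1 + q)))) ≡ just (jump q) →
    ∀ k {f m s} → f (treg d) ≡ k → Sim cap f m s →
    let s′ = iterate k (λ s → run cap c (tick s)) s in
    ∃[ f′ ] ∃[ m′ ] ∃[ t ] Reach P ⟨ q , f , m ⟩ ⟨ 4 + (z + q) , f′ , m′ ⟩ t ×
      t + (4 + z) * clock s ≤ (4 + z) * clock s′ + 1 × Sim cap f′ m′ s′ ×
      (∀ e → e < d → f′ (treg e) ≡ f (treg e))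
  iterations eq₁ at eq₂ eq₃ eq₄ zero {f} {m} {s} v sim =
    f , m , 1 , jz-zero eq₁ v , ≤-reflexive (+-comm 1 ((4 + z) * clock s)) , sim , λ _ _ → refl
  iterations eq₁ at eq₂ eq₃ eq₄ (suc k) {f} {m} {s} v sim =
    let x = compileC-correct cap c (suc d) (1 + q) at (Sim-cong {s′ = tick s} (λ _ → refl) (λ _ _ → refl) sim) (s≤s z≤n)
        g₁ = f′ x [ treg (suc d) ≔ 1 ]
        g₂ = g₁ [ treg d ≔ g₁ (treg d) ∸ g₁ (treg (suc d)) ]
        counter = trans (≔-same g₁ (treg d))
          (cong₂ _∸_ (trans (≔-other (f′ x) (λ eq → <⇒≢ (n<1+n d) (treg-inj eq))) (trans (temps x d ≤-refl) v))
                     (≔-same (f′ x) (treg (suc d))))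
        k₁ = Keeps-trans {f = f′ x} {g₁} {g₂} ≤-refl (Keeps-≔ (n≤1+n d)) (Keeps-≔ ≤-refl)
        f₃ , m₃ , t , r , b , sim₃ , k₃ = iterations eq₁ at eq₂ eq₃ eq₄ k {g₂} {m′ x} counter (Keeps-sim 1≤d k₁ (sim′ x))
    in f₃ , m₃ , _ , jz-suc eq₁ v then reach x then one eq₂ then one eq₃ then one eq₄ then r ,
       round-time z {c₂ = clock (iterate k (λ s → run cap c (tick s)) (run cap c (tick s)))} (clock-mono cap c (tick s)) (bound x) b , sim₃ ,
       λ y y<d → trans (k₃ y y<d) (trans (keeps-temps k₁ y y<d) (temps x y (<-trans y<d (n<1+n d))))

-- Complete programs, input and output

-- Adds n to register 1, n times, with the counter in register 3 and the constant 1 in register 5.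
-- All three are odd, so the variables keep their input values. With capacity n² the input matrix is
-- exactly array 0.
squareCode : List Instr
squareCode =
  add 3 3 0 ∷ const 5 1 ∷ jumpZero 3 6 ∷ add 1 1 0 ∷ sub 3 3 5 ∷ jump 2 ∷ []

program : Cmd → Program
program c = squareCode List.++ toList (compileC c 1 6)

fetch-skip : ∀ xs {k} (is : Vec Instr k) → At (xs List.++ toList is) (List.length xs) is
fetch-skip xs []       = tt
fetch-skip xs (i ∷ is) =
  here xs , subst₂ (λ P p → At P p is) (assoc xs) (length-snoc xs) (fetch-skip (xs List.++ i ∷ []) is)
  where
  here : ∀ xs → fetch (xs List.++ i ∷ toList is) (List.length xs) ≡ just i
  here []       = refl
  here (x ∷ xs) = here xs
  assoc : ∀ xs → (xs List.++ i ∷ []) List.++ toList is ≡ xs List.++ i ∷ toList is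
  assoc []       = refl
  assoc (x ∷ xs) = cong (x ∷_) (assoc xs)
  length-snoc : ∀ xs → List.length (xs List.++ i ∷ []) ≡ suc (List.length xs)
  length-snoc []       = refl
  length-snoc (x ∷ xs) = cong suc (length-snoc xs)

fetch-end : ∀ xs {k} (is : Vec Instr k) → fetch (xs List.++ toList is) (k + List.length xs) ≡ nothing
fetch-end []       {k} is rewrite +-identityʳ k = end is
  where
  end : ∀ {k} (is : Vec Instr k) → fetch (toList is) k ≡ nothing
  end []       = refl
  end (i ∷ is) = end is
fetch-end (x ∷ xs) {k} is rewrite +-suc k (List.length xs) = fetch-end xs is

initial : ℕ → (ℕ → ℕ) → State
initial n m = state (inputReg n) (λ k i → if i <ᵇ n * n then m (k * (n * n) + i) else 0) 0

initial-cell : ∀ {n} m k {i} → i < n * n → arrs (initial n m) k i ≡ m (k * (n * n) + i)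
initial-cell m k i< rewrite <⇒<ᵇ≡ i< = refl

square-correct : ∀ c n m →
  ∃[ f ] Reach (program c) ⟨ 0 , inputReg n , m ⟩ ⟨ 6 , f , m ⟩ (3 + n * 4) × Sim (n * n) f m (initial n m)
square-correct c n m =
  let f , r , cap≡ , even = rounds n f₀ refl refl refl
  in f , one refl then one refl then weaken (≤-reflexive (+-comm (n * 4) 1)) r , record
    { sim-vars = λ x → trans (even x) (f₀-vars x)
    ; sim-cap  = trans cap≡ (+-identityʳ (n * n))
    ; sim-arrs = λ k i i< → sym (initial-cell {n} m k i<)
    ; sim-out  = out-of-range
    }
  where
  P = program c
  f₀ : ℕ → ℕ
  f₀ = (inputReg n [ 3 ≔ n ]) [ 5 ≔ 1 ]
  f₀-vars : ∀ x → f₀ (vreg x) ≡ inputReg n x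
  f₀-vars x = trans (≔-other (inputReg n [ 3 ≔ n ]) (vreg≢treg x 2)) (trans (≔-other (inputReg n) (vreg≢treg x 1)) (lemma x))
    where
    lemma : ∀ x → inputReg n (vreg x) ≡ inputReg n x
    lemma zero    = refl
    lemma (suc x) = refl
  out-of-range : ∀ k i → n * n ≤ i → arrs (initial n m) k i ≡ 0
  out-of-range k i i≥ rewrite ≥⇒<ᵇ≡ i≥ = refl
  rounds : ∀ k f → f 0 ≡ n → f 3 ≡ k → f 5 ≡ 1 →
    ∃[ f′ ] Reach P ⟨ 2 , f , m ⟩ ⟨ 6 , f′ , m ⟩ (k * 4 + 1) × f′ 1 ≡ k * n + f 1 ×
      (∀ x → f′ (vreg x) ≡ f (vreg x))
  rounds zero    f f0 f3 f5 = f , jz-zero refl f3 , refl , λ _ → refl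
  rounds (suc k) f f0 f3 f5 =
    let f₁ = f [ 1 ≔ f 1 + f 0 ]
        f₂ = f₁ [ 3 ≔ f₁ 3 ∸ f₁ 5 ]
        f′ , r , sq , even = rounds k f₂ f0 (cong₂ _∸_ f3 f5) f5
    in f′ , jz-suc refl f3 then one refl then one refl then one refl then r ,
       trans sq (trans (cong (λ y → k * n + (f 1 + y)) f0) (lemma (k * n) (f 1) n)) ,
       λ x → trans (even x) (trans (≔-other f₁ (vreg≢treg x 1)) (≔-other f (vreg≢treg x 0)))
    where
    lemma : ∀ a b c → a + (b + c) ≡ c + a + b
    lemma = solve-∀

program-correct : ∀ c n m → let s = run (n * n) c (initial n m) in
  ∃[ f ] ∃[ m′ ] ∃[ t ] program c ⊢ ⟨ 0 , inputReg n , m ⟩ ⇓ ⟨ sizeC c + 6 , f , m′ ⟩ after t ×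
    t ≤ 3 + n * 4 + sizeC c * suc (clock s) × (∀ a → a < n * n → m′ a ≡ arrs s 0 a)
program-correct c n m =
  let f , (t₁ , t₁≤ , r₁) , sim = square-correct c n m
      x = compileC-correct (n * n) c {program c} 1 6 (fetch-skip squareCode (compileC c 1 6)) sim ≤-refl
      t₂ , t₂≤ , r₂ = reach x
  in f′ x , m′ x , t₁ + t₂ , Steps-halt (Steps-trans r₁ r₂) (fetch-end squareCode (compileC c 1 6)) ,
     +-mono-≤ t₁≤ (≤-trans t₂≤ (≤-trans (m≤m+n (time x) (sizeC c * 0)) (bound x))) , sim-arrs (sim′ x) 0

inputMem-entry : ∀ {n} (G : Graph n) i j → inputMem G (toℕ i * n + toℕ j) ≡ bit (does (adj? G i j))
inputMem-entry {n} G i j with toℕ i * n + toℕ j <? n * n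
... | no ≮ = contradiction (subst (_< n * n) (toℕ-combine′ i j) (toℕ<n (combine i j))) ≮
  where
  toℕ-combine′ : ∀ (i j : Fin n) → toℕ (combine i j) ≡ toℕ i * n + toℕ j
  toℕ-combine′ i j = trans (toℕ-combine i j) (cong (_+ toℕ j) (*-comm n (toℕ i)))
... | yes a<n² = cong (uncurry (λ i j → bit (does (adj? G i j))))
  (trans (cong (remQuot n) same) (remQuot-combine i j))
  where
  same : fromℕ< a<n² ≡ combine i j
  same = toℕ-injective (trans (toℕ-fromℕ< a<n²) (sym (trans (toℕ-combine i j) (cong (_+ toℕ j) (*-comm n (toℕ i))))))

-- Reasoning about loops

iterate-induct : ∀ {f} (I : State → Set) → (∀ s → I s → I (f s)) → ∀ k s → I s → I (iterate k f s)
iterate-induct I adv zero    s i = i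
iterate-induct I adv (suc k) s i = iterate-induct I adv k _ (adv s i)

-- `iterate` counts down while the invariant counts up; keeping `k + t ≡ N` shows that the index of
-- the current round lies in `Fin N`.
iterate-invariant : ∀ {f N} (I : ℕ → State → Set) → (∀ (i : Fin N) s → I (toℕ i) s → I (suc (toℕ i)) (f s)) →
                    ∀ s → I 0 s → I N (iterate N f s)
iterate-invariant {f} {N} I adv s = go N 0 s (+-identityʳ N)
  where
  go : ∀ k t s → k + t ≡ N → I t s → I N (iterate k f s)
  go zero    t s refl i = i
  go (suc k) t s eq   i = go k (suc t) (f s) (trans (+-suc k t) eq)
    (subst (λ t → I (suc t) (f s)) (toℕ-fromℕ< t<N) (adv (fromℕ< t<N) s (subst (λ t → I t s) (sym (toℕ-fromℕ< t<N)) i)))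
    where
    t<N : t < N
    t<N = ≤-trans (s≤s (m≤n+m t k)) (≤-reflexive eq)

-- A syntactic, Boolean over-approximation of the variables that change: for a concrete program the
-- frame condition is then proved by `refl`. `stores` does the same for arrays.
assigns : Cmd → ℕ → Bool
assigns (y := e)       x = x ≡ᵇ y
assigns (k ⟦ i ⟧:= e)  x = false
assigns (c ⨾ d)        x = assigns c x ∨ assigns d x
assigns (loop e c)     x = assigns c x

stores : Cmd → ℕ → Bool
stores (y := e)       k = false
stores (l ⟦ i ⟧:= e)  k = k ≡ᵇ l
stores (c ⨾ d)        k = stores c k ∨ stores d k
stores (loop e c)     k = stores c k

vars-frame : ∀ cap c {x} s → assigns c x ≡ false → vars (run cap c s) x ≡ vars s x
vars-frame cap (y := e)      s eq rewrite eq = refl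
vars-frame cap (k ⟦ i ⟧:= e) s eq = refl
vars-frame cap (c ⨾ d) {x} s eq =
  trans (vars-frame cap d (run cap c s) (∨-conicalʳ (assigns c x) _ eq)) (vars-frame cap c s (∨-conicalˡ _ _ eq))
vars-frame cap (loop e c) {x} s eq =
  iterate-induct (λ s′ → vars s′ x ≡ vars s x) (λ s′ i → trans (vars-frame cap c (tick s′) eq) i) (eval e s) s refl

arrs-frame : ∀ cap c {k} s → stores c k ≡ false → arrs (run cap c s) k ≡ arrs s k
arrs-frame cap (y := e)      s eq = refl
arrs-frame cap (l ⟦ i ⟧:= e) s eq rewrite eq = refl
arrs-frame cap (c ⨾ d) {k} s eq =
  trans (arrs-frame cap d (run cap c s) (∨-conicalʳ (stores c k) _ eq)) (arrs-frame cap c s (∨-conicalˡ _ _ eq))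
arrs-frame cap (loop e c) {k} s eq =
  iterate-induct (λ s′ → arrs s′ k ≡ arrs s k) (λ s′ i → trans (arrs-frame cap c (tick s′) eq) i) (eval e s) s refl

size : ℕ
size = 0

isSize : Expr → Bool
isSize (var x) = x ≡ᵇ size
isSize _       = false

-- If every loop runs n times, the clock is independent of the data and `cost` gives it exactly. The
-- loops of `decrease` and `greedy`, whose lengths depend on the data, are treated by the potential
-- instead.
regular : Cmd → Bool
regular (y := e)       = true
regular (l ⟦ i ⟧:= e)  = true
regular (c ⨾ d)        = regular c ∧ regular d
regular (loop e c)     = isSize e ∧ regular c

cost : Cmd → ℕ → ℕ
cost (y := e)      n = 0
cost (k ⟦ i ⟧:= e) n = 0
cost (c ⨾ d)       n = cost c n + cost d n
cost (loop e c)    n = n * (1 + cost c n)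

regular-clock : ∀ cap c n s → regular c ≡ true → assigns c size ≡ false → vars s size ≡ n →
                clock (run cap c s) ≡ cost c n + clock s
regular-clock cap (y := e)      n s reg fr sz = refl
regular-clock cap (k ⟦ i ⟧:= e) n s reg fr sz = refl
regular-clock cap (c ⨾ d)       n s reg fr sz =
  trans (regular-clock cap d n (run cap c s) (∧-conicalʳ (regular c) _ reg) (∨-conicalʳ (assigns c size) _ fr)
          (trans (vars-frame cap c s (∨-conicalˡ _ _ fr)) sz))
  (trans (cong (cost d n +_) (regular-clock cap c n s (∧-conicalˡ _ _ reg) (∨-conicalˡ _ _ fr) sz))
         (lemma (cost c n) (cost d n) (clock s)))
  where
  lemma : ∀ a b c → b + (a + c) ≡ a + b + c
  lemma = solve-∀
regular-clock cap (loop e c) n s reg fr sz =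
  subst (λ k → clock (iterate k body s) ≡ n * (1 + cost c n) + clock s) (sym (count e reg))
    (proj₂ (iterate-invariant {N = n} (λ t s′ → vars s′ size ≡ n × clock s′ ≡ t * (1 + cost c n) + clock s)
      (λ i s′ (sz′ , clk) →
        trans (vars-frame cap c (tick s′) fr) sz′ ,
        trans (regular-clock cap c n (tick s′) (∧-conicalʳ (isSize e) _ reg) fr sz′)
          (trans (+-suc (cost c n) (clock s′))
            (trans (cong (λ x → suc (cost c n + x)) clk) (cong suc (sym (+-assoc (cost c n) _ (clock s)))))))
      s (sz , refl)))
  where
  body = λ s → run cap c (tick s)
  count : ∀ e → isSize e ∧ regular c ≡ true → eval e s ≡ n
  count (var zero) _ = sz

write-this : ∀ {cap} A k {i} x → i < cap → write cap A k i x k ≡ set (A k) i x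
write-this A k x i<cap rewrite ≡ᵇ-refl k | <⇒<ᵇ≡ i<cap = refl

write-that : ∀ {cap} A {k} i x {k′} → k′ ≢ k → write cap A k i x k′ ≡ A k′
write-that A i x k′≢k rewrite ≢⇒≡ᵇ k′≢k = refl

record AgreeExcept (V K : ℕ → Set) (s s′ : State) : Set where
  constructor agree
  field
    agree-vars : ∀ x → ¬ V x → vars s′ x ≡ vars s x
    agree-arrs : ∀ k → ¬ K k → arrs s′ k ≡ arrs s k

open AgreeExcept

agree-trans : ∀ {V K s s′ s″} → AgreeExcept V K s s′ → AgreeExcept V K s′ s″ → AgreeExcept V K s s″
agree-trans (agree v a) (agree v′ a′) =
  agree (λ x ¬V → trans (v′ x ¬V) (v x ¬V)) (λ k ¬K → trans (a′ k ¬K) (a k ¬K))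

agree-set : ∀ {V K s} cap x e → V x → AgreeExcept V K s (run cap (x := e) s)
agree-set {s = s} cap x e Vx = agree (λ y ¬V → set-other (vars s) (eval e s) λ { refl → ¬V Vx }) (λ _ _ → refl)

agree-write : ∀ {V K s} cap k i e → K k → AgreeExcept V K s (run cap (k ⟦ i ⟧:= e) s)
agree-write {s = s} cap k i e Kk = agree (λ _ _ → refl)
  (λ l ¬K → write-that {cap} (arrs s) (eval i s) (eval e s) λ { refl → ¬K Kk })

agree-tick : ∀ {V K s} → AgreeExcept V K s (tick s)
agree-tick = agree (λ _ _ → refl) (λ _ _ → refl)

n≤n*n : ∀ n → n ≤ n * n
n≤n*n zero    = z≤n
n≤n*n (suc n) = m≤m+n (suc n) (n * suc n)

cell< : ∀ {n} (i j : Fin n) → toℕ i * n + toℕ j < n * n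
cell< {n} i j = subst (_< n * n) (trans (toℕ-combine i j) (cong (_+ toℕ j) (*-comm n (toℕ i)))) (toℕ<n (combine i j))

-- Traversing an array and a matrix

U : ℕ
U = 1

each-body : ℕ → Expr → Cmd
each-body k e = k ⟦ var U ⟧:= e ⨾ U := var U ⊕ lit 1

each : Expr → ℕ → Expr → Cmd
each g k e = U := lit 0 ⨾ loop g (each-body k e)

-- When round `u` evaluates `e`, the earlier entries of array `k` are already new and entry `u` is
-- still old. The new entry may therefore depend on the old one at `u` and on everything outside
-- `k`, but on no other entry of `k`.
each-spec : ∀ {n} g k e s (F : Fin n → ℕ → ℕ) → eval g (run (n * n) (U := lit 0) s) ≡ n →
  (∀ s′ u → AgreeExcept (_≡ U) (_≡ k) s s′ → vars s′ U ≡ toℕ u → eval e s′ ≡ F u (arrs s′ k (toℕ u))) →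
  let s′ = run (n * n) (each g k e) s in
  (∀ u → arrs s′ k (toℕ u) ≡ F u (arrs s k (toℕ u))) × clock s′ ≡ n + clock s
each-spec {n} g k e s F g≡ ev =
  subst (λ N → let s′ = iterate N body s₁ in (∀ u → arrs s′ k (toℕ u) ≡ F u (arrs s k (toℕ u))) × clock s′ ≡ n + clock s)
    (sym g≡) (case iterate-invariant {body} {n} I advance s₁ (agree-set {s = s} (n * n) U (lit 0) refl , refl , (λ _ ()) , (λ _ _ → refl) , refl) of λ
      { (_ , _ , below , _ , clk) → (λ u → below u (toℕ<n u)) , clk })
  where
  body = λ s → run (n * n) (each-body k e) (tick s)
  s₁ = run (n * n) (U := lit 0) s
  I : ℕ → State → Set
  I t s′ = AgreeExcept (_≡ U) (_≡ k) s s′ × vars s′ U ≡ t ×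
    (∀ u → toℕ u < t → arrs s′ k (toℕ u) ≡ F u (arrs s k (toℕ u))) ×
    (∀ u → t ≤ toℕ u → arrs s′ k (toℕ u) ≡ arrs s k (toℕ u)) ×
    clock s′ ≡ t + clock s
  advance : ∀ (i : Fin n) s′ → I (toℕ i) s′ → I (suc (toℕ i)) (body s′)
  advance i s′ (ag , u≡ , below , above , clk) =
    agree-trans ag (agree-trans (agree-tick {s = s′}) (agree-trans {s′ = s₂} (agree-write (n * n) k (var U) e refl) (agree-set (n * n) U (var U ⊕ lit 1) refl))) ,
    trans (cong (_+ 1) u≡) (+-comm (toℕ i) 1) ,
    (λ u u≤i → case toℕ u ≟ toℕ i of λ
      { (yes u≡i) → trans (arr≡ (toℕ u)) (trans (set-same (arrs s′ k) val (trans u≡i (sym u≡)))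
          (trans (ev (tick s′) i (agree-trans ag agree-tick) u≡)
            (trans (cong (F i) (above i ≤-refl)) (cong (λ u → F u (arrs s k (toℕ u))) (sym (toℕ-injective u≡i))))))
      ; (no u≢i) → trans (arr≡ (toℕ u)) (trans (set-other (arrs s′ k) val (λ eq → u≢i (trans eq u≡)))
          (below u (≤∧≢⇒< (≤-pred u≤i) u≢i))) }) ,
    (λ u i<u → trans (arr≡ (toℕ u)) (trans (set-other (arrs s′ k) val (λ eq → <⇒≢ i<u (sym (trans eq u≡))))
      (above u (<⇒≤ i<u)))) ,
    cong suc clk
    where
    val = eval e (tick s′)
    s₂ = run (n * n) (k ⟦ var U ⟧:= e) (tick s′)
    arr≡ : ∀ j → arrs (body s′) k j ≡ set (arrs s′ k) (vars s′ U) val j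
    arr≡ j = cong (λ A → A j) (write-this (arrs s′) k val
      (subst (_< n * n) (sym u≡) (≤-trans (toℕ<n i) (n≤n*n n))))

-- `ROW` is n times `I`, kept up to date by addition. `KROW`, `VROW` and `WROW` accompany `K`, `V`
-- and `W` in the same way.
ROW I J : ℕ
ROW = 2
I = 3
J = 4

sweep : ℕ → Expr → Cmd
sweep k e =
  ROW := lit 0 ⨾ I := lit 0 ⨾
  loop (var size)
    (J := lit 0 ⨾
     loop (var size) (k ⟦ var ROW ⊕ var J ⟧:= e ⨾ J := var J ⊕ lit 1) ⨾
     ROW := var ROW ⊕ var size ⨾ I := var I ⊕ lit 1)

data SweepVar : ℕ → Set where
  isROW : SweepVar ROW
  isI   : SweepVar I
  isJ   : SweepVar J

-- Floyd-Warshall updates its matrix in place, so a new entry is not given by a formula in the old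
-- matrix. Hence two kinds of facts: `Inv` holds throughout, while `R i j` is established by the
-- write to that cell and survives all later writes.
sweep-spec : ∀ {n} k e s → vars s size ≡ n → (Inv : (ℕ → ℕ) → Set) (R : Fin n → Fin n → (ℕ → ℕ) → Set) →
  (∀ s′ i j → AgreeExcept SweepVar (_≡ k) s s′ → vars s′ ROW ≡ toℕ i * n → vars s′ I ≡ toℕ i → vars s′ J ≡ toℕ j →
     Inv (arrs s′ k) → let A = set (arrs s′ k) (toℕ i * n + toℕ j) (eval e s′) in
     Inv A × R i j A × (∀ i′ j′ → R i′ j′ (arrs s′ k) → R i′ j′ A)) →
  Inv (arrs s k) → let s′ = run (n * n) (sweep k e) s in Inv (arrs s′ k) × (∀ i j → R i j (arrs s′ k))
sweep-spec {n} k e s sz Inv R adv inv =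
  subst (λ N → let s′ = iterate N outer s₁ in Inv (arrs s′ k) × (∀ i j → R i j (arrs s′ k))) (sym sz)
    (case iterate-invariant {outer} {n} Outer outer-adv s₁
       (agree-trans {s′ = R′ (ROW := lit 0) s} (agree-set (n * n) ROW (lit 0) isROW) (agree-set (n * n) I (lit 0) isI) , refl , refl , inv , λ _ _ ()) of λ
     { (_ , _ , _ , inv , rows) → inv , λ i j → rows i j (toℕ<n i) })
  where
  R′ = run (n * n)
  s₁ = R′ (ROW := lit 0 ⨾ I := lit 0) s
  inner-cmd outer-cmd : Cmd
  inner-cmd = k ⟦ var ROW ⊕ var J ⟧:= e ⨾ J := var J ⊕ lit 1
  outer-cmd = J := lit 0 ⨾ loop (var size) inner-cmd ⨾ ROW := var ROW ⊕ var size ⨾ I := var I ⊕ lit 1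
  inner outer : State → State
  inner s = R′ inner-cmd (tick s)
  outer s = R′ outer-cmd (tick s)
  Outer : ℕ → State → Set
  Outer t s′ = AgreeExcept SweepVar (_≡ k) s s′ × vars s′ ROW ≡ t * n × vars s′ I ≡ t ×
    Inv (arrs s′ k) × (∀ i j → toℕ i < t → R i j (arrs s′ k))
  Inner : Fin n → ℕ → State → Set
  Inner i t s′ = AgreeExcept SweepVar (_≡ k) s s′ × vars s′ ROW ≡ toℕ i * n × vars s′ I ≡ toℕ i × vars s′ J ≡ t ×
    Inv (arrs s′ k) × (∀ i′ j → toℕ i′ < toℕ i → R i′ j (arrs s′ k)) × (∀ j → toℕ j < t → R i j (arrs s′ k))
  inner-adv : ∀ i (j : Fin n) s′ → Inner i (toℕ j) s′ → Inner i (suc (toℕ j)) (inner s′)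
  inner-adv i j s′ (ag , row≡ , i≡ , j≡ , inv , rows , cols) =
    agree-trans ag (agree-trans (agree-tick {s = s′})
      (agree-trans {s′ = R′ (k ⟦ var ROW ⊕ var J ⟧:= e) (tick s′)} (agree-write (n * n) k (var ROW ⊕ var J) e refl) (agree-set (n * n) J (var J ⊕ lit 1) isJ))) ,
    row≡ , i≡ , trans (cong (_+ 1) j≡) (+-comm (toℕ j) 1) ,
    subst Inv (sym arr≡) inv′ ,
    (λ i′ j′ i′<i → subst (R i′ j′) (sym arr≡) (keep i′ j′ (rows i′ j′ i′<i))) ,
    (λ j′ j′≤j → subst (R i j′) (sym arr≡) (case toℕ j′ ≟ toℕ j of λ
      { (yes eq) → subst (λ j′ → R i j′ _) (sym (toℕ-injective eq)) r
      ; (no ≢) → keep i j′ (cols j′ (≤∧≢⇒< (≤-pred j′≤j) ≢)) }))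
    where
    st = adv (tick s′) i j (agree-trans ag agree-tick) row≡ i≡ j≡ inv
    inv′ = proj₁ st
    r = proj₁ (proj₂ st)
    keep = proj₂ (proj₂ st)
    at : vars s′ ROW + vars s′ J ≡ toℕ i * n + toℕ j
    at = cong₂ _+_ row≡ j≡
    arr≡ : arrs (inner s′) k ≡ set (arrs s′ k) (toℕ i * n + toℕ j) (eval e (tick s′))
    arr≡ = trans (write-this (arrs s′) k (eval e (tick s′)) (subst (_< n * n) (sym at) (cell< i j)))
                 (cong (λ a → set (arrs s′ k) a (eval e (tick s′))) at)
  outer-adv : ∀ (i : Fin n) s′ → Outer (toℕ i) s′ → Outer (suc (toℕ i)) (outer s′)
  outer-adv i s′ (ag , row≡ , i≡ , inv , rows) =
    finish (subst (λ N → Inner i n (iterate N inner s₂)) (sym sz′)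
      (iterate-invariant {inner} {n} (Inner i) (inner-adv i) s₂
        (agree-trans ag (agree-trans (agree-tick {s = s′}) (agree-set (n * n) J (lit 0) isJ)) , row≡ , i≡ , refl , inv , rows , λ _ ())))
    where
    s₂ = R′ (J := lit 0) (tick s′)
    sz′ : vars s′ size ≡ n
    sz′ = trans (agree-vars ag size λ ()) sz
    s₃ = iterate (vars s′ size) inner s₂
    finish : Inner i n s₃ → Outer (suc (toℕ i)) (outer s′)
    finish (ag , row≡ , i≡ , _ , inv , rows , cols) =
      agree-trans ag (agree-trans {s′ = R′ (ROW := var ROW ⊕ var size) s₃} (agree-set (n * n) ROW (var ROW ⊕ var size) isROW) (agree-set (n * n) I (var I ⊕ lit 1) isI)) ,
      trans (cong₂ _+_ row≡ (trans (agree-vars ag size λ ()) sz)) (+-comm (toℕ i * n) n) ,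
      trans (cong (_+ 1) i≡) (+-comm (toℕ i) 1) ,
      inv ,
      λ i′ j i′≤i → case toℕ i′ ≟ toℕ i of λ
        { (yes eq) → subst (λ i′ → R i′ j _) (sym (toℕ-injective eq)) (cols j (toℕ<n j))
        ; (no ≢) → rows i′ j (≤∧≢⇒< (≤-pred i′≤i) ≢) }

-- Distances and resolving sets

module _ {n : ℕ} (G : ConnectedGraph n) where

  dist-path : ∀ u v → Path (graph G) u v (dist G u v)
  dist-path u v = proj₁ (proj₂ (dist-least G u v))

  dist-≤ : ∀ {u v k} → Path (graph G) u v k → dist G u v ≤ k
  dist-≤ {u} {v} {k} p = proj₂ (proj₂ (dist-least G u v)) k p

  dist-self : ∀ u → dist G u u ≡ 0
  dist-self u = n≤0⇒n≡0 (dist-≤ [])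

  dist≡0⇒≡ : ∀ {u v} → dist G u v ≡ 0 → u ≡ v
  dist≡0⇒≡ {u} {v} eq with dist G u v | dist-path u v
  ... | .0 | [] = refl

  dist≡1⇒Adj : ∀ {u v} → dist G u v ≡ 1 → Adj (graph G) u v
  dist≡1⇒Adj {u} {v} eq with dist G u v | dist-path u v
  ... | .1 | e ∷ [] = e
  ... | .(suc (suc _)) | _ ∷ (_ ∷ _) = contradiction eq λ ()

  Adj⇒dist≡1 : ∀ {u v} → Adj (graph G) u v → dist G u v ≡ 1
  Adj⇒dist≡1 {u} {v} e = ≤-antisym (dist-≤ (e ∷ [])) (n≢0⇒n>0 λ eq → irrefl (graph G) (dist≡0⇒≡ eq) e)

  -- The last component exchanges the final `j` steps for any other path; on a shortest path this
  -- shows that the final part is itself shortest.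
  suffix : ∀ {u v k} → Path (graph G) u v k → ∀ j → j ≤ k →
           ∃[ w ] Path (graph G) w v j × (∀ {i} → Path (graph G) w v i → Path (graph G) u v (k ∸ j + i))
  suffix {u} {v} {k} p j j≤k with j ≟ k
  suffix {u} p j j≤k | yes refl = u , p , λ {i} q → subst (Path _ u _) (cong (_+ i) (sym (n∸n≡0 j))) q
  suffix [] .0 z≤n | no j≢k = contradiction refl j≢k
  suffix {u} {v} {suc k} (e ∷ p) j j≤k | no j≢k =
    let j≤k′ = ≤-pred (≤∧≢⇒< j≤k j≢k)
        w , q , extend = suffix p j j≤k′
    in w , q , λ {i} r → subst (Path _ u v) (cong (_+ i) (sym (+-∸-assoc 1 j≤k′))) (e ∷ extend r)

  -- A shortest path passes through a node at each distance from its end.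
  dist<n : ∀ u v → dist G u v < n
  dist<n u v = injective⇒≤ {f = λ i → proj₁ (level i)} λ {i} {j} eq →
    toℕ-injective (trans (sym (proj₂ (level i))) (trans (cong (λ w → dist G w v) eq) (proj₂ (level j))))
    where
    level : (i : Fin (suc (dist G u v))) → ∃[ w ] dist G w v ≡ toℕ i
    level i with suffix (dist-path u v) (toℕ i) (≤-pred (toℕ<n i))
    ... | w , q , extend = w , ≤-antisym (dist-≤ q) (+-cancelˡ-≤ (dist G u v ∸ toℕ i) _ _
      (≤-trans (≤-reflexive (m∸n+n≡m (≤-pred (toℕ<n i)))) (dist-≤ (extend (dist-path w v)))))

  -- The walks accounted for after k rounds of Floyd–Warshall.
  data Via (k : ℕ) : Fin n → Fin n → ℕ → Set where
    stop  : ∀ {u} → Via k u u 0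
    edge  : ∀ {u v} → Adj (graph G) u v → Via k u v 1
    cross : ∀ {u w v ℓ} → Adj (graph G) u w → toℕ w < k → Via k w v ℓ → Via k u v (suc ℓ)

  Path⇒Via : ∀ {u v ℓ} → Path (graph G) u v ℓ → Via n u v ℓ
  Path⇒Via []               = stop
  Path⇒Via (_∷_ {w = w} e p) = cross e (toℕ<n w) (Path⇒Via p)

  -- Cut the walk at its first and its last intermediate visit to `k`. What lies between is a closed
  -- walk and is dropped, whence the inequality.
  split : ∀ (k : Fin n) {u v ℓ} → Via (suc (toℕ k)) u v ℓ →
          Via (toℕ k) u v ℓ ⊎ (∃[ a ] ∃[ b ] Via (toℕ k) u k a × Via (toℕ k) k v b × a + b ≤ ℓ)
  split k stop     = inj₁ stop
  split k (edge e) = inj₁ (edge e)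
  split k (cross {w = w} e w≤k p) with toℕ w ≟ toℕ k | split k p
  ... | yes w≡k | inj₁ q with refl ← toℕ-injective w≡k = inj₂ (1 , _ , edge e , q , ≤-refl)
  ... | yes w≡k | inj₂ (a , b , q , r , a+b≤) with refl ← toℕ-injective w≡k =
    inj₂ (1 , b , edge e , r , s≤s (≤-trans (m≤n+m b a) a+b≤))
  ... | no w≢k | inj₁ q = inj₁ (cross e (≤∧≢⇒< (≤-pred w≤k) w≢k) q)
  ... | no w≢k | inj₂ (a , b , q , r , a+b≤) =
    inj₂ (suc a , b , cross e (≤∧≢⇒< (≤-pred w≤k) w≢k) q , r , s≤s a+b≤)

  -- This makes {v} a class. The nodes of W need no separate treatment, since
  -- each of them distinguishes itself from v.
  Resolves : Fin n → Subset n → Set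
  Resolves v W = v ∉ W × (∀ w → w ≢ v → ∃[ u ] u ∈ W × dist G w u ≢ dist G v u)

  resolves? : ∀ v W → Dec (Resolves v W)
  resolves? v W = ¬? (v ∈? W) ×-dec
    all? λ w → ¬? (w ≟ᶠ v) →-dec any? λ u → u ∈? W ×-dec ¬? (dist G w u ≟ dist G v u)

  -- Every instance is solvable: this gives the existence of an optimum, and in `pickBest-spec` a
  -- node of positive gain as long as something remains to be covered.
  resolves-complement : ∀ v → Resolves v (∁ ⁅ v ⁆)
  resolves-complement v = (λ v∈ → x∈∁p⇒x∉p v∈ (x∈⁅x⁆ v)) ,
    λ w w≢v → w , x∉p⇒x∈∁p (x≢y⇒x∉⁅y⁆ w≢v) , λ eq → w≢v (sym (dist≡0⇒≡ (trans (sym eq) (dist-self w))))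

  other : 2 ≤ n → ∀ (v : Fin n) → ∃[ w ] w ≢ v
  other (s≤s (s≤s _)) zero    = suc zero , λ ()
  other (s≤s (s≤s _)) (suc v) = zero , λ ()

-- Cardinalities of subsets

∣p∣≡0⇒∉ : ∀ {n} {p : Subset n} {x} → ∣ p ∣ ≡ 0 → x ∉ p
∣p∣≡0⇒∉ {p = p} {x} eq x∈p = <⇒≢ (≤-trans (≤-reflexive (sym (∣⁅x⁆∣≡1 x))) (p⊆q⇒∣p∣≤∣q∣ λ y∈ → subst (_∈ p) (sym (x∈⁅y⁆⇒x≡y x y∈)) x∈p)) (sym eq)

∈⇒0<∣p∣ : ∀ {n} {p : Subset n} {x} → x ∈ p → 0 < ∣ p ∣
∈⇒0<∣p∣ x∈p = n≢0⇒n>0 λ eq → ∣p∣≡0⇒∉ eq x∈p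

∣p∣≡1⇒unique : ∀ {n} {p : Subset n} {x y} → ∣ p ∣ ≡ 1 → x ∈ p → y ∈ p → x ≡ y
∣p∣≡1⇒unique {p = p} {x} {y} eq x∈p y∈p with x ≟ᶠ y
... | yes x≡y = x≡y
... | no x≢y = contradiction (≤-trans (p⊂q⇒∣p∣<∣q∣ {p = ⁅ x ⁆} {q = p}
      ((λ z∈ → subst (_∈ p) (sym (x∈⁅y⁆⇒x≡y x z∈)) x∈p) , y , y∈p , λ y∈ → x≢y (sym (x∈⁅y⁆⇒x≡y x y∈))))
      (≤-reflexive eq)) (≤⇒≯ (≤-reflexive (sym (∣⁅x⁆∣≡1 x))))

∣p∪q∣≤∣p∣+∣q∣ : ∀ {n} (p q : Subset n) → ∣ p ∪ q ∣ ≤ ∣ p ∣ + ∣ q ∣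
∣p∪q∣≤∣p∣+∣q∣ []          []          = z≤n
∣p∪q∣≤∣p∣+∣q∣ (false ∷ p) (false ∷ q) = ∣p∪q∣≤∣p∣+∣q∣ p q
∣p∪q∣≤∣p∣+∣q∣ (true ∷ p)  (false ∷ q) = s≤s (∣p∪q∣≤∣p∣+∣q∣ p q)
∣p∪q∣≤∣p∣+∣q∣ (false ∷ p) (true ∷ q)  =
  ≤-trans (s≤s (∣p∪q∣≤∣p∣+∣q∣ p q)) (≤-reflexive (sym (+-suc ∣ p ∣ ∣ q ∣)))
∣p∪q∣≤∣p∣+∣q∣ (true ∷ p)  (true ∷ q)  =
  s≤s (≤-trans (∣p∪q∣≤∣p∣+∣q∣ p q) (+-monoʳ-≤ ∣ p ∣ (n≤1+n ∣ q ∣)))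

-- Feasible sets and bounds on the optimum

module _ {n : ℕ} (G : ConnectedGraph n) (2≤n : 2 ≤ n) where

  -- The class {v} attains the minimum because each class contains the node that defines it. `W` is
  -- nonempty because, by `2 ≤ n`, some node other than `v` has to be separated.
  resolves⇒feasible : ∀ {v W} → Resolves G v W → Feasible G W
  resolves⇒feasible {v} {W} (v∉W , res) =
    ((λ x∈ → contradiction x∈ ∉⊥) , proj₁ witness , proj₁ (proj₂ witness) , ∉⊥) ,
    ((λ _ → ∈⊤) , v , ∈⊤ , v∉W) ,
    (⁅ v ⁆ , (v , v∉W , λ w → mk⇔ (to w) (from w)) , ∣⁅x⁆∣≡1 v) ,
    λ { j (C , (x , x∉W , class) , refl) → ∈⇒0<∣p∣ (Equivalence.from (class x) (x∉W , λ _ → refl)) }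
    where
    to : ∀ w → w ∈ ⁅ v ⁆ → w ∉ W × metricRep G W w ≗ metricRep G W v
    to w w∈ with refl ← x∈⁅y⁆⇒x≡y v w∈ = v∉W , λ _ → refl
    from : ∀ w → w ∉ W × metricRep G W w ≗ metricRep G W v → w ∈ ⁅ v ⁆
    from w (_ , same) with w ≟ᶠ v
    ... | yes refl = x∈⁅x⁆ v
    ... | no w≢v = let u , u∈W , ≢ = res w w≢v in contradiction (same (u , u∈W)) ≢
    witness = res (proj₁ (other G 2≤n v)) (proj₂ (other G 2≤n v))

  feasible⇒resolves : ∀ {W} → Feasible G W → ∃[ v ] Resolves G v W
  feasible⇒resolves {W} (_ , _ , (C , (v , v∉W , class) , ∣C∣≡1) , _) = v , v∉W , res
    where
    v∈C : v ∈ C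
    v∈C = Equivalence.from (class v) (v∉W , λ _ → refl)
    res : ∀ w → w ≢ v → ∃[ u ] u ∈ W × dist G w u ≢ dist G v u
    res w w≢v with w ∈? W
    ... | yes w∈W = w , w∈W , λ eq → w≢v (sym (dist≡0⇒≡ G (trans (sym eq) (dist-self G w))))
    ... | no w∉W with any? (λ u → u ∈? W ×-dec ¬? (dist G w u ≟ dist G v u))
    ... | yes r = r
    ... | no none = contradiction (∣p∣≡1⇒unique ∣C∣≡1 (Equivalence.from (class w) (w∉W , λ (u , u∈W) →
            decidable-stable (dist G w u ≟ dist G v u) λ ≢ → none (u , u∈W , ≢))) v∈C) w≢v

  feasible⇒0<∣W∣ : ∀ {W} → Feasible G W → 0 < ∣ W ∣
  feasible⇒0<∣W∣ ((_ , x , x∈W , _) , _) = ∈⇒0<∣p∣ x∈W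

  node : Fin n
  node = fromℕ< {0} (≤-trans (s≤s z≤n) 2≤n)

  -- `least` asks for decidability. Feasibility speaks of a minimum over classes, but it is
  -- equivalent to the existence of a `v` with `Resolves`, which only quantifies over nodes.
  IsLopt-exists : ∃[ L ] IsLopt G L
  IsLopt-exists = least
    (λ k → anySubset? λ W → map′ (λ (v , r) → resolves⇒feasible r) feasible⇒resolves (any? λ v → resolves? G v W)
                            ×-dec (∣ W ∣ ≟ k))
    (_ , ∁ ⁅ node ⁆ , resolves⇒feasible (resolves-complement G node) , refl)

  resolves-singleton⇒IsLopt : ∀ {v W} → Resolves G v W → ∣ W ∣ ≡ 1 → IsLopt G 1
  resolves-singleton⇒IsLopt {v} {W} r ∣W∣≡1 =
    (W , resolves⇒feasible r , ∣W∣≡1) , λ { j (W′ , f , refl) → feasible⇒0<∣W∣ f }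

  leaf-resolves : ∀ {v x} → Adj (graph G) v x → (∀ {y} → Adj (graph G) v y → y ≡ x) → Resolves G x ⁅ v ⁆
  leaf-resolves {v} {x} e unique = (λ x∈ → irrefl (graph G) (sym (x∈⁅y⁆⇒x≡y v x∈)) e) ,
    λ w w≢x → v , x∈⁅x⁆ v , λ eq → w≢x (unique (symm (graph G) (dist≡1⇒Adj G (trans eq (Adj⇒dist≡1 G (symm (graph G) e))))))

  neighbour : ∀ v → ∃[ w ] Adj (graph G) v w
  neighbour v = let w , w≢v = other G 2≤n v in first w≢v (proj₂ (connected G v w))
    where
    first : ∀ {w k} → w ≢ v → Path (graph G) v w k → ∃[ w ] Adj (graph G) v w
    first w≢v []      = contradiction refl w≢v
    first w≢v (e ∷ _) = _ , e

  degree-one⇒IsLopt : ∀ v → degree (graph G) v ≡ 1 → IsLopt G 1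
  degree-one⇒IsLopt v deg =
    let x , e = neighbour v
    in resolves-singleton⇒IsLopt (leaf-resolves e λ e′ → ∣p∣≡1⇒unique deg (member e′) (member e)) (∣⁅x⁆∣≡1 v)
    where
    member : ∀ {y} → Adj (graph G) v y → y ∈ tabulate (λ w → does (adj? (graph G) v w))
    member {y} e = lookup⇒[]= y _ (trans (lookup∘tabulate _ y) (dec-true (adj? (graph G) v y) e))

  pair-resolves : ¬ HasFourCycle (graph G) → ∀ {v p q} → Adj (graph G) v p → Adj (graph G) v q → p ≢ q →
                  Resolves G v (⁅ p ⁆ ∪ ⁅ q ⁆)
  pair-resolves no4 {v} {p} {q} ep eq p≢q =
    (λ v∈ → case x∈p∪q⁻ ⁅ p ⁆ ⁅ q ⁆ v∈ of λ
      { (inj₁ v∈p) → irrefl (graph G) (x∈⁅y⁆⇒x≡y p v∈p) ep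
      ; (inj₂ v∈q) → irrefl (graph G) (x∈⁅y⁆⇒x≡y q v∈q) eq }) ,
    λ w w≢v → case (dist G w p ≟ dist G v p) of λ
      { (no ≢) → p , x∈p∪q⁺ (inj₁ (x∈⁅x⁆ p)) , ≢
      ; (yes ≡₁) → q , x∈p∪q⁺ (inj₂ (x∈⁅x⁆ q)) , λ ≡₂ →
          let wp = dist≡1⇒Adj G (trans ≡₁ (Adj⇒dist≡1 G ep))
              wq = dist≡1⇒Adj G (trans ≡₂ (Adj⇒dist≡1 G eq))
          in no4 (v , p , w , q ,
               ((λ { refl → irrefl (graph G) refl ep }) ∷ (λ v≡w → w≢v (sym v≡w)) ∷ (λ { refl → irrefl (graph G) refl eq }) ∷ []) ∷
               ((λ { refl → irrefl (graph G) refl wp }) ∷ p≢q ∷ []) ∷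
               ((λ { refl → irrefl (graph G) refl wq }) ∷ []) ∷ [] ∷ [] ,
               ep , symm (graph G) wp , wq , symm (graph G) eq) }

  ∣pair∣≤2 : ∀ (p q : Fin n) → ∣ ⁅ p ⁆ ∪ ⁅ q ⁆ ∣ ≤ 2
  ∣pair∣≤2 p q = ≤-trans (∣p∪q∣≤∣p∣+∣q∣ ⁅ p ⁆ ⁅ q ⁆) (≤-reflexive (cong₂ _+_ (∣⁅x⁆∣≡1 p) (∣⁅x⁆∣≡1 q)))

  -- If `node` has no second neighbour to form a pair with, it is a leaf and a single node suffices.
  no-four-cycle⇒IsLopt≤2 : ¬ HasFourCycle (graph G) → ∃[ L ] (IsLopt G L × L ≤ 2)
  no-four-cycle⇒IsLopt≤2 no4 with neighbour node
  ... | p , ep with any? (λ q → adj? (graph G) node q ×-dec ¬? (p ≟ᶠ q))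
  ... | yes (q , eq , p≢q) =
    let L , lopt = IsLopt-exists
    in L , lopt , ≤-trans (proj₂ lopt _ (_ , resolves⇒feasible (pair-resolves no4 ep eq p≢q) , refl)) (∣pair∣≤2 p q)
  ... | no none = 1 ,
    resolves-singleton⇒IsLopt
      (leaf-resolves ep λ {y} e → decidable-stable (y ≟ᶠ p) λ y≢p → none (y , e , λ p≡y → y≢p (sym p≡y)))
      (∣⁅x⁆∣≡1 node) ,
    s≤s z≤n

-- The greedy set cover ratio

recip : ℕ → ℚ
recip k = ℤ.+ 1 / suc k

toℚᵘ-/ : ∀ a b → ℚ.toℚᵘ (ℤ.+ a / suc b) ℚᵘ.≃ ℚᵘ.mkℚᵘ (ℤ.+ a) b
toℚᵘ-/ a b = ℚ.toℚᵘ-fromℚᵘ (ℚᵘ.mkℚᵘ (ℤ.+ a) b)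

-- Cross-multiplication. Since `/` reduces to lowest terms, the comparison passes through
-- unnormalised fractions, whose numerators and denominators are as written.
/-mono-≤ : ∀ {a b c d} → a * suc d ≤ c * suc b → ℤ.+ a / suc b ℚ.≤ ℤ.+ c / suc d
/-mono-≤ {a} {b} {c} {d} le = ℚ.toℚᵘ-cancel-≤ (begin
  ℚ.toℚᵘ (ℤ.+ a / suc b)  ≃⟨ toℚᵘ-/ a b ⟩
  ℚᵘ.mkℚᵘ (ℤ.+ a) b       ≤⟨ ℚᵘ.*≤* (subst₂ ℤ._≤_ (ℤ.pos-* a (suc d)) (ℤ.pos-* c (suc b)) (ℤ.+≤+ le)) ⟩
  ℚᵘ.mkℚᵘ (ℤ.+ c) d       ≃⟨ toℚᵘ-/ c d ⟨
  ℚ.toℚᵘ (ℤ.+ c / suc d)  ∎)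
  where open ℚᵘ.≤-Reasoning

fromℕ-+ : ∀ a b → fromℕ (a + b) ≡ fromℕ a ℚ.+ fromℕ b
fromℕ-+ a b = ℚ.toℚᵘ-injective (begin
  ℚ.toℚᵘ (fromℕ (a + b))                         ≈⟨ toℚᵘ-/ (a + b) 0 ⟩
  ℚᵘ.mkℚᵘ (ℤ.+ (a + b)) 0                           ≈⟨ ℚᵘ.*≡* (cong (ℤ._* ℤ.+ 1) (trans (ℤ.pos-+ a b) (cong₂ ℤ._+_ (sym (ℤ.*-identityʳ (ℤ.+ a))) (sym (ℤ.*-identityʳ (ℤ.+ b)))))) ⟩
  ℚᵘ.mkℚᵘ (ℤ.+ a) 0 ℚᵘ.+ ℚᵘ.mkℚᵘ (ℤ.+ b) 0          ≈⟨ ℚᵘ.+-cong (toℚᵘ-/ a 0) (toℚᵘ-/ b 0) ⟨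
  ℚ.toℚᵘ (fromℕ a) ℚᵘ.+ ℚ.toℚᵘ (fromℕ b)        ≈⟨ ℚ.toℚᵘ-homo-+ (fromℕ a) (fromℕ b) ⟨
  ℚ.toℚᵘ (fromℕ a ℚ.+ fromℕ b)                   ∎)
  where open ℚᵘ.≃-Reasoning

fromℕ-*-recip : ∀ a b → fromℕ a ℚ.* recip b ≡ ℤ.+ a / suc b
fromℕ-*-recip a b = ℚ.toℚᵘ-injective (begin
  ℚ.toℚᵘ (fromℕ a ℚ.* recip b)              ≈⟨ ℚ.toℚᵘ-homo-* (fromℕ a) (recip b) ⟩
  ℚ.toℚᵘ (fromℕ a) ℚᵘ.* ℚ.toℚᵘ (recip b)   ≈⟨ ℚᵘ.*-cong (toℚᵘ-/ a 0) (toℚᵘ-/ 1 b) ⟩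
  ℚᵘ.mkℚᵘ (ℤ.+ a) 0 ℚᵘ.* ℚᵘ.mkℚᵘ (ℤ.+ 1) b     ≈⟨ ℚᵘ.*≡* (cong₂ ℤ._*_ (ℤ.*-identityʳ (ℤ.+ a)) (cong (λ x → ℤ.+ suc x) (sym (+-identityʳ b)))) ⟩
  ℚᵘ.mkℚᵘ (ℤ.+ a) b                            ≈⟨ toℚᵘ-/ a b ⟨
  ℚ.toℚᵘ (ℤ.+ a / suc b)                       ∎)
  where open ℚᵘ.≃-Reasoning

fromℕ-* : ∀ a b → fromℕ (a * b) ≡ fromℕ a ℚ.* fromℕ b
fromℕ-* zero    b = sym (ℚ.*-zeroˡ (fromℕ b))
fromℕ-* (suc a) b = trans (fromℕ-+ b (a * b)) (trans (cong₂ ℚ._+_ (sym (ℚ.*-identityˡ (fromℕ b))) (fromℕ-* a b))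
  (trans (sym (ℚ.*-distribʳ-+ (fromℕ b) 1ℚ (fromℕ a))) (cong (ℚ._* fromℕ b) (sym (fromℕ-+ 1 a)))))

fromℕ-mono : ∀ {a b} → a ≤ b → fromℕ a ℚ.≤ fromℕ b
fromℕ-mono {a} {b} a≤b = /-mono-≤ {a} {0} {b} {0} (*-monoˡ-≤ 1 a≤b)

fromℕ-nonNeg : ∀ a → ℚ.NonNegative (fromℕ a)
fromℕ-nonNeg a = ℚ.nonNegative (fromℕ-mono {0} {a} z≤n)

harmonic : ℕ → ℚ
harmonic zero    = 0ℚ
harmonic (suc k) = recip k ℚ.+ harmonic k

-- The `g` terms that distinguish the two harmonic numbers have denominators at most `g + r`, hence
-- at most `suc R`.
harmonic-block : ∀ R r g → g + r ≤ suc R → fromℕ g ℚ.* recip R ℚ.+ harmonic r ℚ.≤ harmonic (g + r)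
harmonic-block R r zero    le = ℚ.≤-reflexive (trans (cong (ℚ._+ harmonic r) (ℚ.*-zeroˡ (recip R))) (ℚ.+-identityˡ (harmonic r)))
harmonic-block R r (suc g) le = begin
  fromℕ (suc g) ℚ.* recip R ℚ.+ harmonic r             ≡⟨ cong (λ x → x ℚ.* recip R ℚ.+ harmonic r) (fromℕ-+ 1 g) ⟩
  (1ℚ ℚ.+ fromℕ g) ℚ.* recip R ℚ.+ harmonic r          ≡⟨ cong (ℚ._+ harmonic r) (ℚ.*-distribʳ-+ (recip R) 1ℚ (fromℕ g)) ⟩
  1ℚ ℚ.* recip R ℚ.+ fromℕ g ℚ.* recip R ℚ.+ harmonic r ≡⟨ ℚ.+-assoc (1ℚ ℚ.* recip R) (fromℕ g ℚ.* recip R) (harmonic r) ⟩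
  1ℚ ℚ.* recip R ℚ.+ (fromℕ g ℚ.* recip R ℚ.+ harmonic r) ≡⟨ cong (ℚ._+ (fromℕ g ℚ.* recip R ℚ.+ harmonic r)) (ℚ.*-identityˡ (recip R)) ⟩
  recip R ℚ.+ (fromℕ g ℚ.* recip R ℚ.+ harmonic r)     ≤⟨ ℚ.+-mono-≤ (/-mono-≤ {1} {R} {1} {g + r} (+-monoˡ-≤ 0 le)) (harmonic-block R r g (<⇒≤ le)) ⟩
  recip (g + r) ℚ.+ harmonic (g + r)                   ∎
  where open ℚ.≤-Reasoning

-- A greedy covering run with N elements to cover: r of them remain after k
-- picks, and whenever r remain, the next pick covers at least r / L of them.
data Greedy (L N : ℕ) : ℕ → ℕ → Set where
  initially : Greedy L N N 0
  pick  : ∀ {r g k} → Greedy L N (g + r) k → 0 < g → g + r ≤ L * g → Greedy L N r (suc k)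

-- Each pick covers at least one element. So a greedy cover has at most n - 1 nodes, which beats the
-- initial value n of `BEST`.
greedy-count : ∀ {L N r k} → Greedy L N r k → k + r ≤ N
greedy-count initially = ≤-refl
greedy-count {r = r} {suc k} (pick {g = g} run 0<g _) =
  ≤-trans (≤-trans (≤-reflexive (sym (+-suc k r))) (+-monoʳ-≤ k (+-monoˡ-≤ r 0<g))) (greedy-count run)

-- For `L = 1` a pick has to cover all that remains, leaving nothing for a second one.
greedy-single : ∀ {N k} → Greedy 1 N 0 k → k ≤ 1
greedy-single initially = z≤n
greedy-single (pick initially _ _) = ≤-refl
greedy-single (pick {g = g} (pick {g = g′} run 0<g′ le) 0<g _) =
  contradiction (≤-trans (+-monoʳ-≤ g′ (≤-trans 0<g (m≤m+n g 0))) (≤-trans le (≤-reflexive (*-identityˡ g′))))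
    (m+1≰ g′)
  where
  m+1≰ : ∀ m → ¬ m + 1 ≤ m
  m+1≰ m le = <⇒≱ (≤-reflexive (+-comm 1 m)) le

-- A potential argument: going from g + r remaining elements down to r lowers the harmonic number by
-- at least g / (g + r), which is at least 1 / L, so each pick is paid for.
greedy-harmonic : ∀ {L N r k} → Greedy L N r k →
                  fromℕ k ℚ.+ fromℕ L ℚ.* harmonic r ℚ.≤ fromℕ L ℚ.* harmonic N
greedy-harmonic {L} {N} initially = ℚ.≤-reflexive (ℚ.+-identityˡ (fromℕ L ℚ.* harmonic N))
greedy-harmonic {L} {N} {r} {suc k} (pick {g = suc g} run _ le) = begin
  fromℕ (suc k) ℚ.+ fromℕ L ℚ.* harmonic r             ≡⟨ cong (ℚ._+ fromℕ L ℚ.* harmonic r) (trans (cong fromℕ (+-comm 1 k)) (fromℕ-+ k 1)) ⟩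
  fromℕ k ℚ.+ 1ℚ ℚ.+ fromℕ L ℚ.* harmonic r            ≡⟨ ℚ.+-assoc (fromℕ k) 1ℚ (fromℕ L ℚ.* harmonic r) ⟩
  fromℕ k ℚ.+ (1ℚ ℚ.+ fromℕ L ℚ.* harmonic r)          ≤⟨ ℚ.+-monoʳ-≤ (fromℕ k) gain ⟩
  fromℕ k ℚ.+ fromℕ L ℚ.* harmonic (suc g + r)         ≤⟨ greedy-harmonic run ⟩
  fromℕ L ℚ.* harmonic N                               ∎
  where
  open ℚ.≤-Reasoning
  gain : 1ℚ ℚ.+ fromℕ L ℚ.* harmonic r ℚ.≤ fromℕ L ℚ.* harmonic (suc g + r)
  gain = begin
    1ℚ ℚ.+ fromℕ L ℚ.* harmonic r
      ≤⟨ ℚ.+-monoˡ-≤ (fromℕ L ℚ.* harmonic r) (/-mono-≤ {1} {0} {L * suc g} {g + r}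
           (≤-trans (≤-reflexive (*-identityˡ _)) (≤-trans le (≤-reflexive (sym (*-identityʳ _)))))) ⟩
    ℤ.+ (L * suc g) / suc (g + r) ℚ.+ fromℕ L ℚ.* harmonic r
      ≡⟨ cong (ℚ._+ fromℕ L ℚ.* harmonic r) (sym (fromℕ-*-recip (L * suc g) (g + r))) ⟩
    fromℕ (L * suc g) ℚ.* recip (g + r) ℚ.+ fromℕ L ℚ.* harmonic r
      ≡⟨ cong (ℚ._+ fromℕ L ℚ.* harmonic r) (trans (cong (ℚ._* recip (g + r)) (fromℕ-* L (suc g))) (ℚ.*-assoc (fromℕ L) (fromℕ (suc g)) (recip (g + r)))) ⟩
    fromℕ L ℚ.* (fromℕ (suc g) ℚ.* recip (g + r)) ℚ.+ fromℕ L ℚ.* harmonic r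
      ≡⟨ sym (ℚ.*-distribˡ-+ (fromℕ L) (fromℕ (suc g) ℚ.* recip (g + r)) (harmonic r)) ⟩
    fromℕ L ℚ.* (fromℕ (suc g) ℚ.* recip (g + r) ℚ.+ harmonic r)
      ≤⟨ ℚ.*-monoˡ-≤-nonNeg (fromℕ L) {{fromℕ-nonNeg L}} (harmonic-block (g + r) r (suc g) ≤-refl) ⟩
    fromℕ L ℚ.* harmonic (suc g + r)
      ∎

-- Harmonic numbers and the logarithm

prefixSum : (ℕ → ℚ) → ℕ → ℚ
prefixSum f m = foldr ℚ._+_ 0ℚ (applyUpTo f m)

prefixSum-+ : ∀ f a b → prefixSum f (a + b) ≡ prefixSum f a ℚ.+ prefixSum (λ i → f (a + i)) b
prefixSum-+ f zero    b = sym (ℚ.+-identityˡ (prefixSum f b))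
prefixSum-+ f (suc a) b = trans (cong (f 0 ℚ.+_) (prefixSum-+ (λ i → f (suc i)) a b))
  (sym (ℚ.+-assoc (f 0) (prefixSum (λ i → f (suc i)) a) _))

prefixSum-≥ : ∀ f b c → (∀ i → i < b → c ℚ.≤ f i) → fromℕ b ℚ.* c ℚ.≤ prefixSum f b
prefixSum-≥ f zero    c le = ℚ.≤-reflexive (ℚ.*-zeroˡ c)
prefixSum-≥ f (suc b) c le = begin
  fromℕ (suc b) ℚ.* c            ≡⟨ cong (ℚ._* c) (fromℕ-+ 1 b) ⟩
  (1ℚ ℚ.+ fromℕ b) ℚ.* c         ≡⟨ ℚ.*-distribʳ-+ c 1ℚ (fromℕ b) ⟩
  1ℚ ℚ.* c ℚ.+ fromℕ b ℚ.* c     ≡⟨ cong (ℚ._+ fromℕ b ℚ.* c) (ℚ.*-identityˡ c) ⟩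
  c ℚ.+ fromℕ b ℚ.* c            ≤⟨ ℚ.+-mono-≤ (le 0 (s≤s z≤n)) (prefixSum-≥ (λ i → f (suc i)) b c λ i i<b → le (suc i) (s≤s i<b)) ⟩
  f 0 ℚ.+ prefixSum (λ i → f (suc i)) b ∎
  where open ℚ.≤-Reasoning

-- The j-th block of m = suc k terms of the Darboux sum is at least 1/(j+2).
harmonic≤1+upperSum : ∀ k N → harmonic (suc N) ℚ.≤ 1ℚ ℚ.+ upperSum (suc N) k
harmonic≤1+upperSum k N = ℚ.≤-trans (blocks N)
  (ℚ.≤-reflexive (cong (λ x → 1ℚ ℚ.+ prefixSum term x) (*-comm N (suc k))))
  where
  term : ℕ → ℚ
  term i = ℤ.+ 1 / (suc k + i)
  block : ∀ j → recip (suc j) ℚ.≤ prefixSum (λ i → term (j * suc k + i)) (suc k)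
  block j = ℚ.≤-trans (ℚ.≤-trans (/-mono-≤ {1} {suc j} {suc k} {k + suc j * suc k} (≤-reflexive (trans (*-identityˡ _) (*-comm (2 + j) (suc k)))))
      (ℚ.≤-reflexive (sym (fromℕ-*-recip (suc k) (k + suc j * suc k)))))
    (prefixSum-≥ _ (suc k) (recip (k + suc j * suc k)) λ i i<m →
      /-mono-≤ {1} {k + suc j * suc k} {1} {k + (j * suc k + i)}
        (+-monoˡ-≤ 0 (s≤s (+-monoʳ-≤ k (≤-trans (≤-reflexive (+-comm (j * suc k) i)) (+-monoˡ-≤ (j * suc k) (<⇒≤ i<m)))))))
  blocks : ∀ N → harmonic (suc N) ℚ.≤ 1ℚ ℚ.+ prefixSum term (N * suc k)
  blocks zero    = ℚ.≤-refl
  blocks (suc N) = begin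
    recip (suc N) ℚ.+ harmonic (suc N)                 ≤⟨ ℚ.+-mono-≤ (block N) (blocks N) ⟩
    B ℚ.+ (1ℚ ℚ.+ prefixSum term (N * suc k))          ≡⟨ ℚ.+-comm B (1ℚ ℚ.+ prefixSum term (N * suc k)) ⟩
    1ℚ ℚ.+ prefixSum term (N * suc k) ℚ.+ B            ≡⟨ ℚ.+-assoc 1ℚ (prefixSum term (N * suc k)) B ⟩
    1ℚ ℚ.+ (prefixSum term (N * suc k) ℚ.+ B)          ≡⟨ cong (1ℚ ℚ.+_) (sym (prefixSum-+ term (N * suc k) (suc k))) ⟩
    1ℚ ℚ.+ prefixSum term (N * suc k + suc k)          ≡⟨ cong (λ x → 1ℚ ℚ.+ prefixSum term x) (+-comm (N * suc k) (suc k)) ⟩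
    1ℚ ℚ.+ prefixSum term (suc N * suc k)              ∎
    where
    open ℚ.≤-Reasoning
    B = prefixSum (λ i → term (N * suc k + i)) (suc k)

-- A rational `q` in the cut comes with one upper sum below `q - 1`, and this one sum already bounds
-- `harmonic N` by `q`.
greedy-approximation : ∀ {L N k} → 1 ≤ N → Greedy L N 0 k → k ≤[ 1+ (ln N) ]· L
greedy-approximation {L} {suc N} {k} _ run q (m , sum<q-1) = begin
  fromℕ k                                      ≡⟨ sym (ℚ.+-identityʳ (fromℕ k)) ⟩
  fromℕ k ℚ.+ 0ℚ                               ≡⟨ cong (fromℕ k ℚ.+_) (sym (ℚ.*-zeroʳ (fromℕ L))) ⟩
  fromℕ k ℚ.+ fromℕ L ℚ.* harmonic 0           ≤⟨ greedy-harmonic run ⟩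
  fromℕ L ℚ.* harmonic (suc N)                 ≤⟨ ℚ.*-monoˡ-≤-nonNeg (fromℕ L) {{fromℕ-nonNeg L}} H≤q ⟩
  fromℕ L ℚ.* q                                ≡⟨ ℚ.*-comm (fromℕ L) q ⟩
  q ℚ.* fromℕ L                                ∎
  where
  open ℚ.≤-Reasoning
  H≤q : harmonic (suc N) ℚ.≤ q
  H≤q = begin
    harmonic (suc N)                 ≤⟨ harmonic≤1+upperSum m N ⟩
    1ℚ ℚ.+ upperSum (suc N) m        ≤⟨ ℚ.+-monoʳ-≤ 1ℚ (ℚ.<⇒≤ sum<q-1) ⟩
    1ℚ ℚ.+ (q ℚ.- 1ℚ)                ≡⟨ ℚ.+-comm 1ℚ (q ℚ.- 1ℚ) ⟩
    q ℚ.- 1ℚ ℚ.+ 1ℚ                  ≡⟨ ℚ.+-assoc q (ℚ.- 1ℚ) 1ℚ ⟩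
    q ℚ.+ (ℚ.- 1ℚ ℚ.+ 1ℚ)            ≡⟨ cong (q ℚ.+_) (ℚ.+-inverseˡ 1ℚ) ⟩
    q ℚ.+ 0ℚ                         ≡⟨ ℚ.+-identityʳ q ⟩
    q                                ∎

-- All-pairs distances

-- The indicator of inequality: the two truncated differences add up to the absolute difference, and
-- `1 ∸ (1 ∸ x)` turns every positive x into 1.
distinct : ℕ → ℕ → ℕ
distinct a b = 1 ∸ (1 ∸ ((a ∸ b) + (b ∸ a)))

distinctE : Expr → Expr → Expr
distinctE a b = lit 1 ⊖ (lit 1 ⊖ ((a ⊖ b) ⊕ (b ⊖ a)))

distinct-≡ : ∀ {a b} → a ≡ b → distinct a b ≡ 0
distinct-≡ {a} refl rewrite n∸n≡0 a = refl

distinct-≢ : ∀ {a b} → a ≢ b → distinct a b ≡ 1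
distinct-≢ {zero}  {zero}  a≢b = contradiction refl a≢b
distinct-≢ {zero}  {suc b} a≢b = cong (1 ∸_) (0∸n≡0 b)
distinct-≢ {suc a} {zero}  a≢b = cong (1 ∸_) (0∸n≡0 (a + 0))
distinct-≢ {suc a} {suc b} a≢b = distinct-≢ (a≢b ∘ cong suc)

K KROW : ℕ
K = 5
KROW = 6

-- Array 0 occupies the first memory cells: the input matrix stands there, and the output is written
-- over it at the very end.
ADJ DIST : ℕ
ADJ = 0
DIST = 5

-- The value n stands for infinity: by `dist<n` it is an upper bound on every distance, and without
-- a walk accounted for `AtMostVia` demands nothing. `relaxE` takes a minimum in the form z ⊖ (z ⊖
-- t).
initE relaxE : Expr
initE = ifz (distinctE (var I) (var J)) (lit 0) (ifz (ADJ ⟦ var ROW ⊕ var J ⟧) (var size) (lit 1))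
relaxE = DIST ⟦ var ROW ⊕ var J ⟧ ⊖
  (DIST ⟦ var ROW ⊕ var J ⟧ ⊖ (DIST ⟦ var ROW ⊕ var K ⟧ ⊕ DIST ⟦ var KROW ⊕ var J ⟧))

relaxations distances : Cmd
relaxations = loop (var size) (sweep DIST relaxE ⨾ KROW := var KROW ⊕ var size ⨾ K := var K ⊕ lit 1)
distances = sweep DIST initE ⨾ KROW := lit 0 ⨾ K := lit 0 ⨾ relaxations

cell : ∀ {n} → Fin n → Fin n → ℕ
cell {n} i j = toℕ i * n + toℕ j

set-cell : ∀ {n} (P : ℕ → Set) A (i j i′ j′ : Fin n) x → (i ≡ i′ → j ≡ j′ → P x) → P (A (cell i′ j′)) →
           P (set A (cell i j) x (cell i′ j′))
set-cell {n} P A i j i′ j′ x hit miss with cell i′ j′ ≟ cell i j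
... | yes eq = let i≡ , j≡ = cell-injective {k = toℕ i′} (toℕ<n j′) (toℕ<n j) eq
               in subst P (sym (set-same A x eq)) (hit (sym (toℕ-injective i≡)) (sym (toℕ-injective j≡)))
... | no ≢ = subst P (sym (set-other A x ≢)) miss

min≤ˡ : ∀ z s → z ∸ (z ∸ s) ≤ z
min≤ˡ z s = m∸n≤m z (z ∸ s)

min≤ʳ : ∀ z s → z ∸ (z ∸ s) ≤ s
min≤ʳ z s = m≤n+o⇒m∸n≤o z (z ∸ s) (≤-trans (m≤n+m∸n z s) (≤-reflexive (+-comm s (z ∸ s))))

≤min : ∀ {d} z s → d ≤ z → d ≤ s → d ≤ z ∸ (z ∸ s)
≤min {d} z s d≤z d≤s with ≤-total z s
... | inj₁ z≤s rewrite m≤n⇒m∸n≡0 z≤s = d≤z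
... | inj₂ s≤z rewrite m∸[m∸n]≡n s≤z = d≤s

module _ {n : ℕ} (G : ConnectedGraph n) where

  HoldsAdjacency HoldsDistances : State → Set
  HoldsAdjacency s = ∀ i j → arrs s ADJ (cell i j) ≡ bit (does (adj? (graph G) i j))
  HoldsDistances s = ∀ i j → arrs s DIST (cell i j) ≡ dist G i j

  AtLeastDist : (ℕ → ℕ) → Set
  AtLeastDist A = ∀ i j → dist G i j ≤ A (cell i j)

  AtMostVia : ℕ → (ℕ → ℕ) → Set
  AtMostVia k A = ∀ i j {ℓ} → Via G k i j ℓ → A (cell i j) ≤ ℓ

  dist-triangle : ∀ i k j → dist G i j ≤ dist G i k + dist G k j
  dist-triangle i k j = dist-≤ G (append (dist-path G i k) (dist-path G k j))
    where
    append : ∀ {u v w a b} → Path (graph G) u v a → Path (graph G) v w b → Path (graph G) u w (a + b)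
    append []      q = q
    append (e ∷ p) q = e ∷ append p q

  data InitialEntry (i j : Fin n) (a : ℕ) : Set where
    diagonal : i ≡ j → a ≡ 0 → InitialEntry i j a
    adjacent : Adj (graph G) i j → a ≡ 1 → InitialEntry i j a
    far      : i ≢ j → ¬ Adj (graph G) i j → a ≡ n → InitialEntry i j a

  init-spec : ∀ s → vars s size ≡ n → HoldsAdjacency s →
              ∀ i j → InitialEntry i j (arrs (run (n * n) (sweep DIST initE) s) DIST (cell i j))
  init-spec s sz adj = proj₂ (sweep-spec DIST initE s sz (λ _ → ⊤) (λ i j A → InitialEntry i j (A (cell i j)))
    (λ s′ i j ag row i≡ j≡ _ →
      let A = arrs s′ DIST
          value = entry s′ i j ag row i≡ j≡
      in tt ,
         subst (InitialEntry i j) (sym (set-same A {cell i j} _ refl)) value ,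
         λ i′ j′ r → set-cell (InitialEntry i′ j′) A i j i′ j′ _ (λ { refl refl → value }) r)
    tt)
    where
    entry : ∀ s′ i j → AgreeExcept SweepVar (_≡ DIST) s s′ → vars s′ ROW ≡ toℕ i * n → vars s′ I ≡ toℕ i →
            vars s′ J ≡ toℕ j → InitialEntry i j (eval initE s′)
    entry s′ i j ag row i≡ j≡ = go (i ≟ᶠ j) (adj? (graph G) i j) (adj i j)
      where
      val : eval initE s′ ≡ ifzero (distinct (toℕ i) (toℕ j)) 0 (ifzero (arrs s ADJ (cell i j)) n 1)
      val rewrite row | i≡ | j≡ | agree-vars ag size (λ ()) | sz | agree-arrs ag ADJ (λ ()) = refl
      go : Dec (i ≡ j) → (d : Dec (Adj (graph G) i j)) →
           arrs s ADJ (cell i j) ≡ bit (does d) → InitialEntry i j (eval initE s′)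
      go (yes i≡j) _ _ = diagonal i≡j (trans val (cong (λ x → ifzero x 0 (ifzero (arrs s ADJ (cell i j)) n 1)) (distinct-≡ (cong toℕ i≡j))))
      go (no i≢j) d ad with trans val (trans (cong (λ x → ifzero x 0 (ifzero (arrs s ADJ (cell i j)) n 1)) (distinct-≢ (i≢j ∘ toℕ-injective))) (cong (λ x → ifzero x n 1) ad))
      go (no i≢j) (yes e) ad | eq = adjacent e eq
      go (no i≢j) (no ¬e) ad | eq = far i≢j ¬e eq

  initial-atLeastDist : ∀ {i j a} → InitialEntry i j a → dist G i j ≤ a
  initial-atLeastDist {i} {j} (diagonal refl a≡) = ≤-trans (≤-reflexive (dist-self G i)) z≤n
  initial-atLeastDist {i} {j} (adjacent e refl)  = dist-≤ G (e ∷ [])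
  initial-atLeastDist {i} {j} (far _ _ refl)     = <⇒≤ (dist<n G i j)

  initial-atMostVia : ∀ {i j a ℓ} → InitialEntry i j a → Via G 0 i j ℓ → a ≤ ℓ
  initial-atMostVia (diagonal _ refl) _        = z≤n
  initial-atMostVia (adjacent e refl) stop     = contradiction e (irrefl (graph G) refl)
  initial-atMostVia (adjacent _ refl) (edge _) = ≤-refl
  initial-atMostVia (far i≢j _ _)     stop     = contradiction refl i≢j
  initial-atMostVia (far _ ¬e _)      (edge e) = contradiction e ¬e

  -- Working in place is harmless: entries only decrease, so each relaxation uses values no larger
  -- than those at the start of the round, while the triangle inequality keeps all entries at or
  -- above the distance.
  relax-spec : ∀ s (k : Fin n) → vars s size ≡ n → vars s K ≡ toℕ k → vars s KROW ≡ toℕ k * n →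
    AtLeastDist (arrs s DIST) → AtMostVia (toℕ k) (arrs s DIST) →
    let A = arrs (run (n * n) (sweep DIST relaxE) s) DIST in AtLeastDist A × AtMostVia (suc (toℕ k)) A
  relax-spec s k sz k≡ krow≡ low up =
    let (low′ , below) , relaxed = sweep-spec DIST relaxE s sz
          (λ A → AtLeastDist A × (∀ i j → A (cell i j) ≤ A₀ (cell i j)))
          (λ i j A → A (cell i j) ≤ A₀ (cell i k) + A₀ (cell k j))
          body (low , λ _ _ → ≤-refl)
    in low′ , λ i j p → case split G k p of λ
      { (inj₁ q) → ≤-trans (below i j) (up i j q)
      ; (inj₂ (a , b , q , r , a+b≤)) → ≤-trans (relaxed i j) (≤-trans (+-mono-≤ (up i k q) (up k j r)) a+b≤) }
    where
    A₀ = arrs s DIST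
    body : ∀ s′ (i j : Fin n) → AgreeExcept SweepVar (_≡ DIST) s s′ → vars s′ ROW ≡ toℕ i * n → vars s′ I ≡ toℕ i →
      vars s′ J ≡ toℕ j → AtLeastDist (arrs s′ DIST) × (∀ i j → arrs s′ DIST (cell i j) ≤ A₀ (cell i j)) →
      let A = set (arrs s′ DIST) (cell i j) (eval relaxE s′) in
      (AtLeastDist A × (∀ i j → A (cell i j) ≤ A₀ (cell i j))) × A (cell i j) ≤ A₀ (cell i k) + A₀ (cell k j) ×
      (∀ i′ j′ → arrs s′ DIST (cell i′ j′) ≤ A₀ (cell i′ k) + A₀ (cell k j′) → A (cell i′ j′) ≤ A₀ (cell i′ k) + A₀ (cell k j′))
    body s′ i j ag row _ j≡ (low , below) =
      ((λ i′ j′ → set-cell (dist G i′ j′ ≤_) B i j i′ j′ _ (λ { refl refl → lower }) (low i′ j′)) ,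
       (λ i′ j′ → set-cell (_≤ A₀ (cell i′ j′)) B i j i′ j′ _ (λ { refl refl → ≤-trans upperˡ (below i j) }) (below i′ j′))) ,
      subst (_≤ A₀ (cell i k) + A₀ (cell k j)) (sym (set-same B {cell i j} _ refl)) upperʳ ,
      λ i′ j′ → set-cell (_≤ A₀ (cell i′ k) + A₀ (cell k j′)) B i j i′ j′ _ (λ { refl refl → upperʳ })
      where
      B = arrs s′ DIST
      z = B (cell i j)
      t = B (cell i k) + B (cell k j)
      val : eval relaxE s′ ≡ z ∸ (z ∸ t)
      val = trans (cong₂ (λ r c → f r c (vars s′ K) (vars s′ KROW)) row j≡)
                  (cong₂ (f (toℕ i * n) (toℕ j)) (trans (agree-vars ag K λ ()) k≡) (trans (agree-vars ag KROW λ ()) krow≡))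
        where
        f : ℕ → ℕ → ℕ → ℕ → ℕ
        f r c k kr = B (r + c) ∸ (B (r + c) ∸ (B (r + k) + B (kr + c)))
      lower : dist G i j ≤ eval relaxE s′
      lower = subst (dist G i j ≤_) (sym val) (≤min z t (low i j) (≤-trans (dist-triangle i k j) (+-mono-≤ (low i k) (low k j))))
      upperˡ : eval relaxE s′ ≤ z
      upperˡ = subst (_≤ z) (sym val) (min≤ˡ z t)
      upperʳ : eval relaxE s′ ≤ A₀ (cell i k) + A₀ (cell k j)
      upperʳ = subst (_≤ A₀ (cell i k) + A₀ (cell k j)) (sym val) (≤-trans (min≤ʳ z t) (+-mono-≤ (below i k) (below k j)))

  distances-spec : ∀ s → vars s size ≡ n → HoldsAdjacency s → HoldsDistances (run (n * n) distances s)
  distances-spec s sz adj =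
    let _ , _ , _ , low , up = subst (λ N → Inv n (iterate N body s₁)) (sym sz₁)
          (iterate-invariant {body} {n} Inv advance s₁
            (sz₁ , refl , refl , (λ i j → initial-atLeastDist (entries i j)) , λ i j → initial-atMostVia (entries i j)))
    in λ i j → ≤-antisym (up i j (Path⇒Via G (dist-path G i j))) (low i j)
    where
    s₀ = run (n * n) (sweep DIST initE) s
    s₁ = run (n * n) (KROW := lit 0 ⨾ K := lit 0) s₀
    entries = init-spec s sz adj
    sz₁ : vars s₀ size ≡ n
    sz₁ = trans (vars-frame (n * n) (sweep DIST initE) s refl) sz
    body = λ s → run (n * n) (sweep DIST relaxE ⨾ KROW := var KROW ⊕ var size ⨾ K := var K ⊕ lit 1) (tick s)
    Inv : ℕ → State → Set
    Inv t s = vars s size ≡ n × vars s K ≡ t × vars s KROW ≡ t * n × AtLeastDist (arrs s DIST) × AtMostVia t (arrs s DIST)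
    advance : ∀ (k : Fin n) s → Inv (toℕ k) s → Inv (suc (toℕ k)) (body s)
    advance k s (sz , k≡ , krow≡ , low , up) =
      sz′ ,
      trans (cong (_+ 1) (trans (vars-frame (n * n) (sweep DIST relaxE) (tick s) refl) k≡)) (+-comm (toℕ k) 1) ,
      trans (cong₂ _+_ (trans (vars-frame (n * n) (sweep DIST relaxE) (tick s) refl) krow≡) sz′) (+-comm (toℕ k * n) n) ,
      relax-spec (tick s) k sz k≡ krow≡ low up
      where
      sz′ : vars (run (n * n) (sweep DIST relaxE) (tick s)) size ≡ n
      sz′ = trans (vars-frame (n * n) (sweep DIST relaxE) (tick s) refl) sz

-- Sums over nodes

sum-mono : ∀ {n} {f g : Fin n → ℕ} → (∀ i → f i ≤ g i) → sum f ≤ sum g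
sum-mono {zero}  f≤g = z≤n
sum-mono {suc n} f≤g = +-mono-≤ (f≤g zero) (sum-mono (f≤g ∘ suc))

sum-update : ∀ {n} {f g : Fin n → ℕ} w → (∀ i → i ≢ w → f i ≡ g i) → sum f + g w ≡ sum g + f w
sum-update {suc n} {f} {g} zero    eq
  rewrite sum-cong-≗ {n} {f ∘ suc} {g ∘ suc} (λ i → eq (suc i) λ ()) = lemma (f zero) _ (g zero)
  where
  lemma : ∀ a b c → a + b + c ≡ c + b + a
  lemma = solve-∀
sum-update {suc n} {f} {g} (suc w) eq = begin
  f zero + sum (f ∘ suc) + g (suc w)    ≡⟨ +-assoc (f zero) _ _ ⟩
  f zero + (sum (f ∘ suc) + g (suc w))  ≡⟨ cong₂ _+_ (eq zero λ ()) (sum-update w λ i i≢ → eq (suc i) λ { refl → i≢ refl }) ⟩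
  g zero + (sum (g ∘ suc) + f (suc w))  ≡⟨ +-assoc (g zero) _ _ ⟨
  g zero + sum (g ∘ suc) + f (suc w)    ∎
  where open ≡-Reasoning

≤-sum : ∀ {n} (f : Fin n → ℕ) i → f i ≤ sum f
≤-sum f zero    = m≤m+n (f zero) _
≤-sum f (suc i) = ≤-trans (≤-sum (f ∘ suc) i) (m≤n+m _ (f zero))

sum-zero : ∀ {n} {f : Fin n → ℕ} → (∀ i → f i ≡ 0) → sum f ≡ 0
sum-zero {zero}  eq = refl
sum-zero {suc n} eq = cong₂ _+_ (eq zero) (sum-zero (eq ∘ suc))

sum-one : ∀ n → sum {n} (λ _ → 1) ≡ n
sum-one zero    = refl
sum-one (suc n) = cong suc (sum-one n)

sum-bits : ∀ {n} (W : Subset n) b → sum (λ u → bit (lookup W u) * b) ≡ ∣ W ∣ * b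
sum-bits []          b = refl
sum-bits (true ∷ W)  b = cong₂ _+_ (*-identityˡ b) (sum-bits W b)
sum-bits (false ∷ W) b = sum-bits W b

∣tabulate∣≤sum : ∀ {n} (p : Fin n → Bool) f → (∀ i → bit (p i) ≤ f i) → ∣ tabulate p ∣ ≤ sum f
∣tabulate∣≤sum {zero}  p f le = z≤n
∣tabulate∣≤sum {suc n} p f le with p zero | le zero
... | true  | 1≤ = +-mono-≤ 1≤ (∣tabulate∣≤sum (p ∘ suc) (f ∘ suc) (le ∘ suc))
... | false | _  = ≤-trans (∣tabulate∣≤sum (p ∘ suc) (f ∘ suc) (le ∘ suc)) (m≤n+m _ (f zero))

sum-lower : ∀ {n} {o o′ : Fin n → ℕ} {w e} → (∀ i → i ≢ w → o′ i ≡ o i) → o′ w + e ≡ o w → sum o′ + e ≡ sum o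
sum-lower {o = o} {o′} {w} {e} off at = +-cancelʳ-≡ (o′ w) _ _ (begin
  sum o′ + e + o′ w    ≡⟨ +-assoc (sum o′) e (o′ w) ⟩
  sum o′ + (e + o′ w)  ≡⟨ cong (sum o′ +_) (trans (+-comm e (o′ w)) at) ⟩
  sum o′ + o w         ≡⟨ sum-update w off ⟩
  sum o + o′ w         ∎)
  where open ≡-Reasoning

sum-lower-weighted : ∀ {n} {o o′ : Fin n → ℕ} {w e} (S : Fin n → ℕ) → (∀ i → i ≢ w → o′ i ≡ o i) → o′ w + e ≡ o w →
                     sum (λ i → o′ i * S i) + e * S w ≡ sum (λ i → o i * S i)
sum-lower-weighted {o′ = o′} {w} {e} S off at =
  sum-lower (λ i i≢w → cong (_* S i) (off i i≢w)) (trans (sym (*-distribʳ-+ (S w) (o′ w) e)) (cong (_* S w) at))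

-- Greedy covering for one node

erase : ∀ {n} → (Fin n → ℕ) → Fin n → Fin n → ℕ
erase o v w = if does (w ≟ᶠ v) then 0 else o w

erase-same : ∀ {n} (o : Fin n → ℕ) v → erase o v v ≡ 0
erase-same o v rewrite dec-true (v ≟ᶠ v) refl = refl

erase-other : ∀ {n} (o : Fin n → ℕ) {v w} → w ≢ v → erase o v w ≡ o w
erase-other o {v} {w} w≢v rewrite dec-false (w ≟ᶠ v) w≢v = refl

sum-erase : ∀ {n} (o : Fin n → ℕ) {v r} → o v ≡ 1 → sum o ≡ suc r → sum (erase o v) ≡ r
sum-erase o {v} {r} ov≡1 eq = suc-injective (trans (+-comm 1 (sum (erase o v)))
  (trans (sum-lower {o = o} {erase o v} {v} (λ i → erase-other o) (trans (cong (_+ 1) (erase-same o v)) (sym ov≡1))) eq))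

-- By averaging over W, some u ∈ W carries a 1/∣W∣ share of the weight r.
cover-bound : ∀ {n} {v : Fin n} (W : Subset n) (sep : Fin n → Fin n → ℕ) (o : Fin n → ℕ) {b r} →
  v ∉ W → (∀ w → w ≢ v → ∃[ u ] u ∈ W × sep u w ≡ 1) → o v ≡ 1 → sum o ≡ suc r →
  (∀ u → u ≢ v → sum (λ w → o w * sep u w) ≤ b) → r ≤ ∣ W ∣ * b
cover-bound {n} {v} W sep o {b} {r} v∉W cover ov≡1 sum≡ gain = begin
  r                                                             ≡⟨ sum-erase o ov≡1 sum≡ ⟨
  sum (erase o v)                                               ≤⟨ sum-mono pointwise ⟩
  sum (λ w → sum (λ u → bit (lookup W u) * (o w * sep u w)))    ≡⟨ ∑-comm (λ w u → bit (lookup W u) * (o w * sep u w)) ⟩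
  sum (λ u → sum (λ w → bit (lookup W u) * (o w * sep u w)))    ≡⟨ sum-cong-≗ (λ u → *-distribˡ-sum (bit (lookup W u)) (λ w → o w * sep u w)) ⟨
  sum (λ u → bit (lookup W u) * sum (λ w → o w * sep u w))      ≤⟨ sum-mono bounded ⟩
  sum (λ u → bit (lookup W u) * b)                              ≡⟨ sum-bits W b ⟩
  ∣ W ∣ * b                                                     ∎
  where
  open ≤-Reasoning
  pointwise : ∀ w → erase o v w ≤ sum (λ u → bit (lookup W u) * (o w * sep u w))
  pointwise w with w ≟ᶠ v
  ... | yes _ = z≤n
  ... | no w≢v with cover w w≢v
  ... | u , u∈W , s≡1 = ≤-trans
    (≤-reflexive (sym (trans (cong₂ (λ x y → bit x * (o w * y)) ([]=⇒lookup u∈W) s≡1) (trans (*-identityˡ (o w * 1)) (*-identityʳ (o w))))))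
    (≤-sum (λ u → bit (lookup W u) * (o w * sep u w)) u)
  bounded : ∀ u → bit (lookup W u) * sum (λ w → o w * sep u w) ≤ bit (lookup W u) * b
  bounded u with lookup W u in eq
  ... | false = z≤n
  ... | true  = *-monoʳ-≤ 1 (gain u λ { refl → v∉W (lookup⇒[]= v W eq) })

V VROW W WROW REM CNT TOP ARG NEW CAND : ℕ
V = 7
VROW = 8
W = 9
WROW = 10
REM = 11
CNT = 12
TOP = 13
ARG = 14
NEW = 15
CAND = 16

-- OPEN marks v and the nodes not yet separated from v, REM of them without v;
-- GAIN u counts the open nodes that u separates from v.
GAIN OPEN CHOSEN : ℕ
GAIN = 1
OPEN = 2
CHOSEN = 3

separatesE : Expr → Expr
separatesE u = distinctE (DIST ⟦ var WROW ⊕ u ⟧) (DIST ⟦ var VROW ⊕ u ⟧)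

nextW : Cmd
nextW = WROW := var WROW ⊕ var size ⨾ W := var W ⊕ lit 1

-- `v` is opened like all other nodes and stays open for ever: nothing separates it from itself, so
-- it contributes to no gain. Thus n nodes are open while `REM` starts at n - 1. Opening a node adds
-- to the gains exactly what closing it takes away.
openAll openNode clearArrays setup select closeNode cover pickBest greedy : Cmd
openNode = OPEN ⟦ var W ⟧:= lit 1 ⨾ each (var size) GAIN (GAIN ⟦ var U ⟧ ⊕ separatesE (var U)) ⨾ nextW
openAll = W := lit 0 ⨾ WROW := lit 0 ⨾ loop (var size) openNode
clearArrays = each (var size) GAIN (lit 0) ⨾ each (var size) OPEN (lit 0) ⨾ each (var size) CHOSEN (lit 0)
setup = clearArrays ⨾ REM := var size ⊖ lit 1 ⨾ CNT := lit 0 ⨾ openAll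

-- `v` separates all other nodes from itself and would have the largest gain, but it must stay
-- outside the set; its candidate value is therefore 0. Adding the truncated difference to `TOP`
-- takes a maximum.
selectBody : Cmd
selectBody =
  CAND := ifz (distinctE (var U) (var V)) (lit 0) (GAIN ⟦ var U ⟧) ⨾
  ARG := ifz (var CAND ⊖ var TOP) (var ARG) (var U) ⨾
  TOP := var TOP ⊕ (var CAND ⊖ var TOP) ⨾
  U := var U ⊕ lit 1
select = TOP := lit 0 ⨾ ARG := lit 0 ⨾ U := lit 0 ⨾ loop (var size) selectBody

closeNode =
  NEW := ifz (OPEN ⟦ var W ⟧) (lit 0) (separatesE (var ARG)) ⨾
  OPEN ⟦ var W ⟧:= OPEN ⟦ var W ⟧ ⊖ var NEW ⨾
  REM := var REM ⊖ var NEW ⨾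
  -- No round at all unless the node is being closed, which happens to each node at most once.
  each (ifz (var NEW) (lit 0) (var size)) GAIN (GAIN ⟦ var U ⟧ ⊖ separatesE (var U)) ⨾
  nextW
cover = W := lit 0 ⨾ WROW := lit 0 ⨾ loop (var size) closeNode
pickBest = select ⨾ CHOSEN ⟦ var ARG ⟧:= lit 1 ⨾ CNT := var CNT ⊕ lit 1 ⨾ cover
-- The number of picks is not known beforehand, but n guarded rounds suffice, since every pick
-- closes a node; the inner loop acts as the guard.
greedy = setup ⨾ loop (var size) (loop (ifz (var REM) (lit 0) (lit 1)) pickBest)

set-toℕ : ∀ {n} A (w i : Fin n) x → set A (toℕ w) x (toℕ i) ≡ (if does (i ≟ᶠ w) then x else A (toℕ i))
set-toℕ A w i x with i ≟ᶠ w
... | yes refl = set-same A x refl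
... | no i≢w = set-other A x (i≢w ∘ toℕ-injective)

at : ∀ {n} → ℕ → State → Fin n → ℕ
at k s u = arrs s k (toℕ u)

w<n² : ∀ {n} (w : Fin n) → toℕ w < n * n
w<n² {n} w = ≤-trans (toℕ<n w) (n≤n*n n)

write-at : ∀ {n} {s} k i e (w : Fin n) → eval i s ≡ toℕ w → ∀ u →
           at k (run (n * n) (k ⟦ i ⟧:= e) s) u ≡ (if does (u ≟ᶠ w) then eval e s else at k s u)
write-at {n} {s} k i e w i≡ u = trans
  (cong (λ A → A (toℕ u)) (trans (cong (λ i → write (n * n) (arrs s) k i (eval e s) k) i≡) (write-this (arrs s) k (eval e s) (w<n² w))))
  (set-toℕ (arrs s k) w u (eval e s))

write-at-same : ∀ {n} {s} k i e (w : Fin n) → eval i s ≡ toℕ w → at k (run (n * n) (k ⟦ i ⟧:= e) s) w ≡ eval e s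
write-at-same {n} {s} k i e w i≡ = trans (write-at k i e w i≡ w) (cong (λ b → if b then eval e s else at k s w) (dec-true (w ≟ᶠ w) refl))

write-at-other : ∀ {n} {s} k i e (w : Fin n) → eval i s ≡ toℕ w → ∀ u → u ≢ w → at k (run (n * n) (k ⟦ i ⟧:= e) s) u ≡ at k s u
write-at-other {n} {s} k i e w i≡ u u≢w = trans (write-at k i e w i≡ u) (cong (λ b → if b then eval e s else at k s u) (dec-false (u ≟ᶠ w) u≢w))

module _ {n : ℕ} (G : ConnectedGraph n) (v : Fin n) where

  sep : Fin n → Fin n → ℕ
  sep u w = distinct (dist G w u) (dist G v u)

  record Context (s : State) : Set where
    constructor context
    field
      size≡ : vars s size ≡ n
      V≡    : vars s V ≡ toℕ v
      VROW≡ : vars s VROW ≡ toℕ v * n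
      dist≡ : HoldsDistances G s

  open Context

  Context-frame : ∀ c {s} → assigns c size ≡ false → assigns c V ≡ false → assigns c VROW ≡ false →
                  stores c DIST ≡ false → Context s → Context (run (n * n) c s)
  Context-frame c {s} a₁ a₂ a₃ st (context p q r d) = context
    (trans (vars-frame (n * n) c s a₁) p) (trans (vars-frame (n * n) c s a₂) q) (trans (vars-frame (n * n) c s a₃) r)
    λ i j → trans (cong (λ A → A (cell i j)) (arrs-frame (n * n) c s st)) (d i j)

  separates-eval : ∀ {s e u w} → Context s → vars s WROW ≡ toℕ w * n → eval e s ≡ toℕ u → eval (separatesE e) s ≡ sep u w
  separates-eval {s} {e} {u} {w} ctx row≡ e≡ = cong₂ distinct
    (trans (cong₂ (λ r x → arrs s DIST (r + x)) row≡ e≡) (dist≡ ctx w u))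
    (trans (cong₂ (λ r x → arrs s DIST (r + x)) (VROW≡ ctx) e≡) (dist≡ ctx v u))

  GainOK : State → Set
  GainOK s = ∀ (u : Fin n) → at GAIN s u ≡ sum (λ w → at OPEN s w * sep u w)

  sep-self : ∀ (u : Fin n) → sep u v ≡ 0
  sep-self u = distinct-≡ {dist G v u} refl

  agree-Context : ∀ {k s s′} → k ≢ DIST → AgreeExcept (_≡ U) (_≡ k) s s′ → Context s → Context s′
  agree-Context k≢ ag (context p q r d) = context
    (trans (agree-vars ag size λ ()) p) (trans (agree-vars ag V λ ()) q) (trans (agree-vars ag VROW λ ()) r)
    λ i j → trans (cong (λ A → A (cell i j)) (agree-arrs ag DIST (λ eq → k≢ (sym eq)))) (d i j)

  record Opening (t : ℕ) (s : State) : Set where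
    field
      ctx   : Context s
      gain  : GainOK s
      W≡    : vars s W ≡ t
      WROW≡ : vars s WROW ≡ t * n
      below : ∀ (w : Fin n) → toℕ w < t → at OPEN s w ≡ 1
      above : ∀ (w : Fin n) → t ≤ toℕ w → at OPEN s w ≡ 0

  openNode-spec : ∀ (i : Fin n) s → Opening (toℕ i) s → Opening (suc (toℕ i)) (run (n * n) openNode (tick s))
  openNode-spec i s o = record
    { ctx   = ctx₃
    ; gain  = λ u → trans (proj₁ added u) (trans (cong (_+ sep u i) (Opening.gain o u)) (gain-sum u))
    ; W≡    = trans (cong (_+ 1) (trans (kept W refl) (Opening.W≡ o))) (+-comm (toℕ i) 1)
    ; WROW≡ = trans (cong₂ _+_ (trans (kept WROW refl) (Opening.WROW≡ o)) (trans (kept size refl) (size≡ (Opening.ctx o)))) (+-comm (toℕ i * n) n)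
    ; below = λ w w≤i → trans (open-eq w) (case w ≟ᶠ i of λ
        { (yes refl) → opened
        ; (no w≢i) → trans (unopened w w≢i) (Opening.below o w (≤∧≢⇒< (≤-pred w≤i) (w≢i ∘ toℕ-injective))) })
    ; above = λ w i<w → trans (open-eq w) (trans (unopened w λ { refl → <⇒≢ i<w refl }) (Opening.above o w (<⇒≤ i<w)))
    }
    where
    s₁ = run (n * n) (OPEN ⟦ var W ⟧:= lit 1) (tick s)
    addE = GAIN ⟦ var U ⟧ ⊕ separatesE (var U)
    s₂ = run (n * n) (each (var size) GAIN addE) s₁
    kept : ∀ x → assigns (each (var size) GAIN addE) x ≡ false → vars s₂ x ≡ vars s₁ x
    kept x = vars-frame (n * n) (each (var size) GAIN addE) {x} s₁
    ctx₁ : Context s₁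
    ctx₁ = Context-frame (OPEN ⟦ var W ⟧:= lit 1) {tick s} refl refl refl refl (context (size≡ (Opening.ctx o)) (V≡ (Opening.ctx o)) (VROW≡ (Opening.ctx o)) (dist≡ (Opening.ctx o)))
    ctx₃ : Context (run (n * n) nextW s₂)
    ctx₃ = Context-frame nextW {s₂} refl refl refl refl (Context-frame (each (var size) GAIN addE) {s₁} refl refl refl refl ctx₁)
    added = each-spec (var size) GAIN addE s₁ (λ u x → x + sep u i) (size≡ ctx₁) λ s′ u ag u≡ →
      cong₂ _+_ (cong (arrs s′ GAIN) u≡)
        (separates-eval {e = var U} (agree-Context (λ ()) ag ctx₁) (trans (agree-vars ag WROW λ ()) (Opening.WROW≡ o)) u≡)
    open-eq : ∀ (w : Fin n) → at OPEN (run (n * n) openNode (tick s)) w ≡ at OPEN s₁ w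
    open-eq w = cong (λ A → A (toℕ w)) (arrs-frame (n * n) (each (var size) GAIN addE ⨾ nextW) s₁ refl)
    opened : at OPEN s₁ i ≡ 1
    opened = write-at-same {s = tick s} OPEN (var W) (lit 1) i (Opening.W≡ o)
    unopened : ∀ (w : Fin n) → w ≢ i → at OPEN s₁ w ≡ at OPEN s w
    unopened = write-at-other {s = tick s} OPEN (var W) (lit 1) i (Opening.W≡ o)
    gain-sum : ∀ (u : Fin n) → sum (λ w → at OPEN s w * sep u w) + sep u i ≡ sum (λ w → at OPEN (run (n * n) openNode (tick s)) w * sep u w)
    gain-sum u = trans (cong (sum (λ w → at OPEN s w * sep u w) +_) (sym (*-identityˡ (sep u i))))
      (sum-lower-weighted {o = at OPEN (run (n * n) openNode (tick s))} {at OPEN s} {i} {1} (sep u)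
        (λ w w≢i → sym (trans (open-eq w) (unopened w w≢i)))
        (trans (cong (_+ 1) (Opening.above o i ≤-refl)) (sym (trans (open-eq i) opened))))

  record AfterSetup (s s′ : State) : Set where
    field
      ctx    : Context s′
      gain   : GainOK s′
      open≡1 : ∀ (w : Fin n) → at OPEN s′ w ≡ 1
      chosen : ∀ (u : Fin n) → at CHOSEN s′ u ≡ 0
      rem    : vars s′ REM ≡ n ∸ 1
      cnt    : vars s′ CNT ≡ 0
      clk    : clock s′ ≡ cost setup n + clock s

  setup-spec : ∀ s → Context s → AfterSetup s (run (n * n) setup s)
  setup-spec s c = record
    { ctx    = Opening.ctx opening
    ; gain   = Opening.gain opening
    ; open≡1 = λ w → Opening.below opening w (toℕ<n w)
    ; chosen = λ u → trans (cong (λ A → A (toℕ u)) (arrs-frame (n * n) openAll s₄ refl)) (proj₁ clear₃ u)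
    ; rem    = trans (vars-frame (n * n) openAll s₄ refl) (cong (_∸ 1) (size≡ c₃))
    ; cnt    = vars-frame (n * n) openAll s₄ refl
    ; clk    = regular-clock (n * n) setup n s refl refl (size≡ c)
    }
    where
    s₁ = run (n * n) (each (var size) GAIN (lit 0)) s
    s₂ = run (n * n) (each (var size) OPEN (lit 0)) s₁
    s₃ = run (n * n) (each (var size) CHOSEN (lit 0)) s₂
    s₄ = run (n * n) (REM := var size ⊖ lit 1 ⨾ CNT := lit 0) s₃
    s₅ = run (n * n) (W := lit 0 ⨾ WROW := lit 0) s₄
    c₁ = Context-frame (each (var size) GAIN (lit 0)) {s} refl refl refl refl c
    c₂ = Context-frame (each (var size) OPEN (lit 0)) {s₁} refl refl refl refl c₁
    c₃ = Context-frame (each (var size) CHOSEN (lit 0)) {s₂} refl refl refl refl c₂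
    c₅ : Context s₅
    c₅ = Context-frame (REM := var size ⊖ lit 1 ⨾ CNT := lit 0 ⨾ W := lit 0 ⨾ WROW := lit 0) {s₃} refl refl refl refl c₃
    clear₁ = each-spec (var size) GAIN (lit 0) s (λ _ _ → 0) (size≡ c) λ _ _ _ _ → refl
    clear₂ = each-spec (var size) OPEN (lit 0) s₁ (λ _ _ → 0) (size≡ c₁) λ _ _ _ _ → refl
    clear₃ = each-spec (var size) CHOSEN (lit 0) s₂ (λ _ _ → 0) (size≡ c₂) λ _ _ _ _ → refl
    open₀ : ∀ (w : Fin n) → at OPEN s₅ w ≡ 0
    open₀ w = trans (cong (λ A → A (toℕ w)) (arrs-frame (n * n) (each (var size) CHOSEN (lit 0)) s₂ refl)) (proj₁ clear₂ w)
    gain₀ : ∀ (u : Fin n) → at GAIN s₅ u ≡ 0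
    gain₀ u = trans (cong (λ A → A (toℕ u)) (arrs-frame (n * n) (each (var size) OPEN (lit 0) ⨾ each (var size) CHOSEN (lit 0)) s₁ refl)) (proj₁ clear₁ u)
    opening : Opening n (run (n * n) setup s)
    opening = subst (λ N → Opening n (iterate N (λ s → run (n * n) openNode (tick s)) s₅)) (sym (size≡ c₅))
      (iterate-invariant {N = n} Opening openNode-spec s₅ (record
        { ctx = c₅ ; W≡ = refl ; WROW≡ = refl ; below = λ _ () ; above = λ w _ → open₀ w
        ; gain = λ u → trans (gain₀ u) (sym (sum-zero λ w → cong (_* sep u w) (open₀ w))) }))

  -- With `TOP` equal to 0, `ARG` is only an initial value and might denote `v`; `pickBest-spec`
  -- rules this case out.
  record Selected (s s′ : State) : Set where
    field
      top : ∀ (u : Fin n) → u ≢ v → at GAIN s u ≤ vars s′ TOP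
      arg : vars s′ TOP ≡ 0 ⊎ (∃[ u ] u ≢ v × vars s′ ARG ≡ toℕ u × at GAIN s u ≡ vars s′ TOP)

  select-spec : ∀ s → Context s → Selected s (run (n * n) select s)
  select-spec s c = subst (λ N → Selected s (iterate N body s₁)) (sym (size≡ c))
    (case iterate-invariant {body} {n} Inv advance s₁ (refl , refl , refl , (λ _ ()) , inj₁ refl) of λ
      { (_ , _ , _ , top , arg) → record { top = λ u → top u (toℕ<n u) ; arg = arg } })
    where
    body = λ s → run (n * n) selectBody (tick s)
    s₁ = run (n * n) (TOP := lit 0 ⨾ ARG := lit 0 ⨾ U := lit 0) s
    Inv : ℕ → State → Set
    Inv t s′ = vars s′ U ≡ t × vars s′ V ≡ vars s V × arrs s′ GAIN ≡ arrs s GAIN ×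
      (∀ (u : Fin n) → toℕ u < t → u ≢ v → at GAIN s u ≤ vars s′ TOP) ×
      (vars s′ TOP ≡ 0 ⊎ (∃[ u ] u ≢ v × vars s′ ARG ≡ toℕ u × at GAIN s u ≡ vars s′ TOP))
    advance : ∀ (i : Fin n) s′ → Inv (toℕ i) s′ → Inv (suc (toℕ i)) (body s′)
    advance i s′ (u≡ , v≡ , g≡ , top , arg) =
      trans (cong (_+ 1) u≡) (+-comm (toℕ i) 1) , v≡ , g≡ , top′ , arg′ (cand ∸ vars s′ TOP) refl
      where
      cand = eval (ifz (distinctE (var U) (var V)) (lit 0) (GAIN ⟦ var U ⟧)) s′
      cand-form : cand ≡ ifzero (distinct (toℕ i) (toℕ v)) 0 (at GAIN s i)
      cand-form = trans (cong₂ (λ a b → ifzero (distinct a b) 0 (arrs s′ GAIN a)) u≡ (trans v≡ (V≡ c)))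
        (cong (λ A → ifzero (distinct (toℕ i) (toℕ v)) 0 (A (toℕ i))) g≡)
      cand-v : i ≡ v → cand ≡ 0
      cand-v i≡v = trans cand-form (cong (λ x → ifzero x 0 (at GAIN s i)) (distinct-≡ (cong toℕ i≡v)))
      cand-i : i ≢ v → cand ≡ at GAIN s i
      cand-i i≢v = trans cand-form (cong (λ x → ifzero x 0 (at GAIN s i)) (distinct-≢ (i≢v ∘ toℕ-injective)))
      top′ : ∀ (u : Fin n) → toℕ u < suc (toℕ i) → u ≢ v → at GAIN s u ≤ vars s′ TOP + (cand ∸ vars s′ TOP)
      top′ u u≤i u≢v with u ≟ᶠ i
      ... | yes refl = ≤-trans (≤-reflexive (sym (cand-i u≢v))) (m≤n+m∸n cand (vars s′ TOP))
      ... | no u≢i = ≤-trans (top u (≤∧≢⇒< (≤-pred u≤i) (u≢i ∘ toℕ-injective)) u≢v) (m≤m+n (vars s′ TOP) _)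
      arg′ : ∀ x → cand ∸ vars s′ TOP ≡ x →
        vars s′ TOP + x ≡ 0 ⊎ (∃[ u ] u ≢ v × ifzero x (vars s′ ARG) (vars s′ U) ≡ toℕ u × at GAIN s u ≡ vars s′ TOP + x)
      arg′ zero _ = case arg of λ
        { (inj₁ z) → inj₁ (trans (+-identityʳ _) z)
        ; (inj₂ (u , u≢v , a , g)) → inj₂ (u , u≢v , a , trans g (sym (+-identityʳ _))) }
      arg′ (suc x) eq = inj₂ (i , i≢v , u≡ , trans (sym (cand-i i≢v)) (sym (trans (cong (vars s′ TOP +_) (sym eq))
        (m+[n∸m]≡n {vars s′ TOP} (<⇒≤ (m∸n≢0⇒n<m {cand} λ z → 0≢1+n (trans (sym z) eq)))))))
        where
        i≢v : i ≢ v
        i≢v i≡v = 0≢1+n (trans (sym (trans (cong (_∸ vars s′ TOP) (cand-v i≡v)) (0∸n≡0 (vars s′ TOP)))) eq)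

open Context

distinct≤1 : ∀ a b → distinct a b ≤ 1
distinct≤1 a b = m∸n≤m 1 (1 ∸ ((a ∸ b) + (b ∸ a)))

-- `o` is the open bit of a node, `σ` says whether the new pick separates it, and `e` is the value
-- given to `NEW`. In turn, the facts keep `NEW` a bit, make the subtraction exact, show that the
-- node is swept, give the loss of gain, and justify coverage.
closing-facts : ∀ o σ → o ≤ 1 → σ ≤ 1 → let e = ifzero o 0 σ in
  e ≤ 1 × (o ∸ e) + e ≡ o × (o ∸ e) * σ ≡ 0 × e * σ ≡ e × (o ∸ e ≡ 0 → o ≡ 0 ⊎ σ ≡ 1)
closing-facts zero    σ       _ _ = z≤n , refl , refl , refl , λ _ → inj₁ refl
closing-facts (suc zero) zero _ _ = z≤n , refl , refl , refl , λ ()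
closing-facts (suc zero) (suc zero) _ _ = ≤-refl , refl , refl , refl , λ _ → inj₂ refl
closing-facts (suc zero) (suc (suc _)) _ (s≤s ())
closing-facts (suc (suc _)) _ (s≤s ()) _

module _ {n : ℕ} (G : ConnectedGraph n) (v : Fin n) where

  sep≤1 : ∀ u w → sep G v u w ≤ 1
  sep≤1 u w = distinct≤1 (dist G w u) (dist G v u)

  decreaseE : Expr
  decreaseE = GAIN ⟦ var U ⟧ ⊖ separatesE (var U)

  decrease : Cmd
  decrease = each (ifz (var NEW) (lit 0) (var size)) GAIN decreaseE

  decrease-spec : ∀ s (w : Fin n) → Context G v s → vars s WROW ≡ toℕ w * n → vars s NEW ≤ 1 →
    let s′ = run (n * n) decrease s in
    (∀ (u : Fin n) → at GAIN s′ u ≡ at GAIN s u ∸ vars s NEW * sep G v u w) × clock s′ ≡ vars s NEW * n + clock s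
  decrease-spec s w c row≡ new≤1 = go (vars s NEW) refl new≤1
    where
    s₁ = run (n * n) (U := lit 0) s
    body = λ s → run (n * n) (each-body GAIN decreaseE) (tick s)
    go : ∀ e → vars s NEW ≡ e → e ≤ 1 → let s′ = run (n * n) decrease s in
      (∀ (u : Fin n) → at GAIN s′ u ≡ at GAIN s u ∸ e * sep G v u w) × clock s′ ≡ e * n + clock s
    go zero eq _ = subst (λ x → let s′ = iterate (ifzero x 0 (vars s size)) body s₁ in
      (∀ (u : Fin n) → at GAIN s′ u ≡ at GAIN s u) × clock s′ ≡ clock s) (sym eq) ((λ _ → refl) , refl)
    go (suc (suc _)) _ (s≤s ())
    go (suc zero) eq _ =
      let lowered , clk = each-spec (ifz (var NEW) (lit 0) (var size)) GAIN decreaseE s (λ u x → x ∸ sep G v u w)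
            (trans (cong (λ x → ifzero x 0 (vars s size)) eq) (size≡ c))
            (λ s′ u ag u≡ → cong₂ _∸_ (cong (arrs s′ GAIN) u≡)
              (separates-eval G v {e = var U} (agree-Context G v (λ ()) ag c) (trans (agree-vars ag WROW λ ()) row≡) u≡))
      in (λ u → trans (lowered u) (cong (at GAIN s u ∸_) (sym (+-identityʳ (sep G v u w))))) ,
         trans clk (cong (_+ clock s) (sym (+-identityʳ n)))

  -- By the balance, the number of nodes closed after picking u₀ is its gain.
  -- In clk, n · REM is the potential that pays for updating the gains.
  record Closing (u₀ : Fin n) (s₀ : State) (t : ℕ) (s : State) : Set where
    field
      ctx       : Context G v s
      gain      : GainOK G v s
      open≤1    : ∀ (w : Fin n) → at OPEN s w ≤ 1
      open-v    : at OPEN s v ≡ 1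
      open-sum  : sum {n} (at OPEN s) ≡ suc (vars s REM)
      covered   : ∀ (w : Fin n) → at OPEN s w ≡ 0 → ∃[ u ] at CHOSEN s u ≡ 1 × sep G v u w ≡ 1
      chosen-u₀ : at CHOSEN s u₀ ≡ 1
      W≡        : vars s W ≡ t
      WROW≡     : vars s WROW ≡ t * n
      ARG≡      : vars s ARG ≡ toℕ u₀
      swept     : ∀ (w : Fin n) → toℕ w < t → at OPEN s w * sep G v u₀ w ≡ 0
      balance   : vars s REM + at GAIN s₀ u₀ ≡ vars s₀ REM + at GAIN s u₀
      clk       : clock s + n * vars s REM ≡ t + (clock s₀ + n * vars s₀ REM)

  closeNode-spec : ∀ u₀ s₀ (w : Fin n) s → Closing u₀ s₀ (toℕ w) s →
                   Closing u₀ s₀ (suc (toℕ w)) (run (n * n) closeNode (tick s))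
  closeNode-spec u₀ s₀ w s inv = record
    { ctx = Context-frame G v nextW {s₄} refl refl refl refl c₄
    ; gain = λ u → trans (gain′ u) (trans (cong (_∸ e * sep G v u w) (trans (Closing.gain inv u) (sym (weighted u))))
        (m+n∸n≡m (sum (λ i → at OPEN s′ i * sep G v u i)) (e * sep G v u w)))
    ; open≤1 = λ i → case i ≟ᶠ w of λ
        { (yes refl) → ≤-trans (≤-reflexive opened) (≤-trans (m∸n≤m o e) (Closing.open≤1 inv w))
        ; (no i≢w) → ≤-trans (≤-reflexive (unopened i i≢w)) (Closing.open≤1 inv i) }
    ; open-v = open-v′
    ; open-sum = trans sum′ (cong suc (sym (proj₂ rem′)))
    ; covered = covered′
    ; chosen-u₀ = trans (chosen≡ u₀) (Closing.chosen-u₀ inv)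
    ; W≡ = trans (cong (_+ 1) (trans (kept W refl) (Closing.W≡ inv))) (+-comm (toℕ w) 1)
    ; WROW≡ = trans (cong₂ _+_ (trans (kept WROW refl) (Closing.WROW≡ inv)) (trans (kept size refl) (size≡ c₀))) (+-comm (toℕ w * n) n)
    ; ARG≡ = trans (kept ARG refl) (Closing.ARG≡ inv)
    ; swept = λ i i≤w → case i ≟ᶠ w of λ
        { (yes refl) → trans (cong (_* σ) opened) closed
        ; (no i≢w) → trans (cong (_* sep G v u₀ i) (unopened i i≢w)) (Closing.swept inv i (≤∧≢⇒< (≤-pred i≤w) (i≢w ∘ toℕ-injective))) }
    ; balance = balance′
    ; clk = clk′
    }
    where
    newE = ifz (OPEN ⟦ var W ⟧) (lit 0) (separatesE (var ARG))
    s₁ = run (n * n) (NEW := newE) (tick s)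
    s₂ = run (n * n) (OPEN ⟦ var W ⟧:= OPEN ⟦ var W ⟧ ⊖ var NEW) s₁
    s₃ = run (n * n) (REM := var REM ⊖ var NEW) s₂
    s₄ = run (n * n) decrease s₃
    s′ = run (n * n) nextW s₄
    o = at OPEN s w
    σ = sep G v u₀ w
    e = ifzero o 0 σ
    facts = closing-facts o σ (Closing.open≤1 inv w) (sep≤1 u₀ w)
    lowered = proj₁ (proj₂ facts)
    closed = proj₁ (proj₂ (proj₂ facts))
    eσ≡e = proj₁ (proj₂ (proj₂ (proj₂ facts)))
    c₀ = Closing.ctx inv
    ctick : Context G v (tick s)
    ctick = context (size≡ c₀) (V≡ c₀) (VROW≡ c₀) (dist≡ c₀)
    new≡ : vars s₁ NEW ≡ e
    new≡ = cong₂ (λ x y → ifzero x 0 y) (cong (arrs s OPEN) (Closing.W≡ inv))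
             (separates-eval G v {tick s} {var ARG} ctick (Closing.WROW≡ inv) (Closing.ARG≡ inv))
    c₃ : Context G v s₃
    c₃ = Context-frame G v (NEW := newE ⨾ OPEN ⟦ var W ⟧:= OPEN ⟦ var W ⟧ ⊖ var NEW ⨾ REM := var REM ⊖ var NEW) {tick s} refl refl refl refl ctick
    c₄ : Context G v s₄
    c₄ = Context-frame G v decrease {s₃} refl refl refl refl c₃
    kept : ∀ x → assigns decrease x ≡ false → vars s₄ x ≡ vars s₃ x
    kept x = vars-frame (n * n) decrease {x} s₃
    dec = decrease-spec s₃ w c₃ (Closing.WROW≡ inv) (≤-trans (≤-reflexive new≡) (proj₁ facts))
    gain′ : ∀ (u : Fin n) → at GAIN s′ u ≡ at GAIN s u ∸ e * sep G v u w
    gain′ u = trans (proj₁ dec u) (cong (λ x → at GAIN s u ∸ x * sep G v u w) new≡)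
    open≡ : ∀ (i : Fin n) → at OPEN s′ i ≡ at OPEN s₂ i
    open≡ i = cong (λ A → A (toℕ i)) (arrs-frame (n * n) decrease s₃ refl)
    opened : at OPEN s′ w ≡ o ∸ e
    opened = trans (open≡ w) (trans (write-at-same {s = s₁} OPEN (var W) (OPEN ⟦ var W ⟧ ⊖ var NEW) w (Closing.W≡ inv))
      (cong₂ _∸_ (cong (arrs s OPEN) (Closing.W≡ inv)) new≡))
    unopened : ∀ (i : Fin n) → i ≢ w → at OPEN s′ i ≡ at OPEN s i
    unopened i i≢w = trans (open≡ i) (write-at-other {s = s₁} OPEN (var W) (OPEN ⟦ var W ⟧ ⊖ var NEW) w (Closing.W≡ inv) i i≢w)
    lowered′ : at OPEN s′ w + e ≡ at OPEN s w
    lowered′ = trans (cong (_+ e) opened) lowered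
    weighted : ∀ (u : Fin n) → sum (λ i → at OPEN s′ i * sep G v u i) + e * sep G v u w ≡ sum (λ i → at OPEN s i * sep G v u i)
    weighted u = sum-lower-weighted {o = at OPEN s} {at OPEN s′} {w} {e} (sep G v u) unopened lowered′
    chosen≡ : ∀ (u : Fin n) → at CHOSEN s′ u ≡ at CHOSEN s u
    chosen≡ u = cong (λ A → A (toℕ u)) (arrs-frame (n * n) closeNode (tick s) refl)
    -- By `sep-self`, the bit `e` is 0 when the sweep reaches `v`.
    open-v′ : at OPEN s′ v ≡ 1
    open-v′ with v ≟ᶠ w
    ... | no v≢w = trans (unopened v v≢w) (Closing.open-v inv)
    ... | yes refl = trans opened (cong₂ _∸_ (Closing.open-v inv) (trans (cong (λ x → ifzero x 0 σ) (Closing.open-v inv)) (sep-self G v u₀)))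
    sum-e : sum {n} (at OPEN s′) + e ≡ suc (vars s REM)
    sum-e = trans (sum-lower {o = at OPEN s} {at OPEN s′} {w} {e} unopened lowered′) (Closing.open-sum inv)
    -- As `v` remains open, the sum stays positive; this is why the truncated subtraction from `REM`
    -- loses nothing.
    sum≥1 : 1 ≤ sum {n} (at OPEN s′)
    sum≥1 = ≤-trans (≤-reflexive (sym open-v′)) (≤-sum (at OPEN s′) v)
    rem-e : pred (sum {n} (at OPEN s′)) + e ≡ vars s REM
    rem-e = suc-injective (trans (cong (_+ e) (suc-pred _ {{>-nonZero sum≥1}})) sum-e)
    rem′ : vars s′ REM + e ≡ vars s REM × vars s′ REM ≡ pred (sum {n} (at OPEN s′))
    rem′ = trans (cong (_+ e) eq) rem-e , eq
      where
      eq : vars s′ REM ≡ pred (sum {n} (at OPEN s′))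
      eq = trans (kept REM refl) (trans (cong₂ _∸_ (sym rem-e) new≡) (m+n∸n≡m _ e))
    sum′ : sum {n} (at OPEN s′) ≡ suc (pred (sum {n} (at OPEN s′)))
    sum′ = sym (suc-pred _ {{>-nonZero sum≥1}})
    covered′ : ∀ (i : Fin n) → at OPEN s′ i ≡ 0 → ∃[ u ] at CHOSEN s′ u ≡ 1 × sep G v u i ≡ 1
    covered′ i z with i ≟ᶠ w
    ... | no i≢w = let u , ch , sp = Closing.covered inv i (trans (sym (unopened i i≢w)) z) in u , trans (chosen≡ u) ch , sp
    ... | yes refl = case proj₂ (proj₂ (proj₂ (proj₂ facts))) (trans (sym opened) z) of λ
      { (inj₁ o≡0) → let u , ch , sp = Closing.covered inv i o≡0 in u , trans (chosen≡ u) ch , sp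
      ; (inj₂ σ≡1) → u₀ , trans (chosen≡ u₀) (Closing.chosen-u₀ inv) , σ≡1 }
    gain-e : at GAIN s′ u₀ + e ≡ at GAIN s u₀
    gain-e = trans (cong₂ _+_ (trans (gain′ u₀) (cong (_∸ e * σ) (trans (Closing.gain inv u₀) (sym (weighted u₀))))) (sym eσ≡e))
      (trans (cong (_+ e * σ) (m+n∸n≡m (sum (λ i → at OPEN s′ i * sep G v u₀ i)) (e * σ))) (trans (weighted u₀) (sym (Closing.gain inv u₀))))
    balance′ : vars s′ REM + at GAIN s₀ u₀ ≡ vars s₀ REM + at GAIN s′ u₀
    balance′ = +-cancelʳ-≡ e _ _ (trans (lemma (vars s′ REM) (at GAIN s₀ u₀) e)
      (trans (cong (_+ at GAIN s₀ u₀) (proj₁ rem′)) (trans (Closing.balance inv)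
        (trans (cong (vars s₀ REM +_) (sym gain-e)) (sym (+-assoc (vars s₀ REM) _ e))))))
      where
      lemma : ∀ a b c → a + b + c ≡ a + c + b
      lemma = solve-∀
    clk′ : clock s′ + n * vars s′ REM ≡ suc (toℕ w) + (clock s₀ + n * vars s₀ REM)
    clk′ = trans (cong (_+ n * vars s′ REM) (trans (proj₂ dec) (cong (λ x → x * n + suc (clock s)) new≡)))
      (trans (lemma e n (clock s) (vars s′ REM)) (cong suc (trans (cong (λ x → clock s + n * x) (proj₁ rem′)) (Closing.clk inv))))
      where
      lemma : ∀ e n c r → e * n + suc c + n * r ≡ suc (c + n * (r + e))
      lemma = solve-∀

module _ {n : ℕ} (G : ConnectedGraph n) (v : Fin n) where

  -- The invariant between picks. The picks do not depend on the competitor `W`, whose size is only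
  -- a parameter of `Greedy`, so `runs` can hold for all competitors together. `chosen-sum` is an
  -- inequality because a pick adds to the sum only if its mark was not yet set.
  record Partial (s : State) : Set where
    field
      ctx        : Context G v s
      gain       : GainOK G v s
      open≤1     : ∀ (w : Fin n) → at OPEN s w ≤ 1
      open-v     : at OPEN s v ≡ 1
      open-sum   : sum {n} (at OPEN s) ≡ suc (vars s REM)
      covered    : ∀ (w : Fin n) → at OPEN s w ≡ 0 → ∃[ u ] at CHOSEN s u ≡ 1 × sep G v u w ≡ 1
      chosen≤1   : ∀ (u : Fin n) → at CHOSEN s u ≤ 1
      chosen-v   : at CHOSEN s v ≡ 0
      chosen-sum : sum {n} (at CHOSEN s) ≤ vars s CNT
      runs       : ∀ W → Resolves G v W → Greedy ∣ W ∣ (n ∸ 1) (vars s REM) (vars s CNT)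

  Partial-tick : ∀ {s} → Partial s → Partial (tick s)
  Partial-tick p = record { Partial p ; ctx = context (size≡ ctx) (V≡ ctx) (VROW≡ ctx) (dist≡ ctx) }
    where ctx = Partial.ctx p

  -- The term 2n is for the loop of `select` and the outer loop of `cover`; updating the gains is
  -- paid for by the fall of n times `REM`.
  record Progress (s s′ : State) : Set where
    field
      partial : Partial s′
      rem<    : vars s′ REM < vars s REM
      clk     : clock s′ + n * vars s′ REM ≡ 2 * n + (clock s + n * vars s REM)

  pickBest-spec : ∀ s → Partial s → 0 < vars s REM → Progress s (run (n * n) pickBest s)
  pickBest-spec s p 0<rem = case Selected.arg selected of λ
    { (inj₁ b≡0) → contradiction b≡0 (<⇒≢ 0<b ∘ sym)
    ; (inj₂ (u₀ , u₀≢v , arg≡ , g≡)) → picked u₀ u₀≢v arg≡ g≡ }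
    where
    s₁ = run (n * n) select s
    selected = select-spec G v s (Partial.ctx p)
    b = vars s₁ TOP
    -- Averaging over a competitor: its nodes together cover all that remains, and none of them
    -- gains more than the maximum `b`.
    share : ∀ W → Resolves G v W → vars s REM ≤ ∣ W ∣ * b
    share W (v∉W , res) = cover-bound W (sep G v) (at OPEN s) v∉W
      (λ w w≢v → let u , u∈W , d = res w w≢v in u , u∈W , distinct-≢ d)
      (Partial.open-v p) (Partial.open-sum p)
      (λ u u≢v → ≤-trans (≤-reflexive (sym (Partial.gain p u))) (Selected.top selected u u≢v))
    -- The complement of `v` is a competitor, so with all gains zero nothing could remain.
    0<b : 0 < b
    0<b = n≢0⇒n>0 λ b≡0 → <⇒≱ 0<rem
      (≤-trans (share (∁ ⁅ v ⁆) (resolves-complement G v)) (≤-reflexive (trans (cong (∣ ∁ ⁅ v ⁆ ∣ *_) b≡0) (*-zeroʳ ∣ ∁ ⁅ v ⁆ ∣))))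
    picked : ∀ u₀ → u₀ ≢ v → vars s₁ ARG ≡ toℕ u₀ → at GAIN s u₀ ≡ b → Progress s (run (n * n) pickBest s)
    picked u₀ u₀≢v arg≡ g≡ = record
      { partial = record
        { ctx = Closing.ctx closed
        ; gain = Closing.gain closed
        ; open≤1 = Closing.open≤1 closed
        ; open-v = Closing.open-v closed
        ; open-sum = Closing.open-sum closed
        ; covered = Closing.covered closed
        ; chosen≤1 = λ u → ≤-trans (≤-reflexive (chosen₅ u)) (case u ≟ᶠ u₀ of λ
            { (yes refl) → ≤-reflexive chosen-u₀
            ; (no u≢) → ≤-trans (≤-reflexive (chosen-other u u≢)) (Partial.chosen≤1 p u) })
        ; chosen-v = trans (chosen₅ v) (trans (chosen-other v (u₀≢v ∘ sym)) (Partial.chosen-v p))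
        ; chosen-sum = begin
            sum {n} (at CHOSEN s₅)                               ≡⟨ sum-cong-≗ {n} chosen₅ ⟩
            sum {n} (at CHOSEN s₄)                               ≡⟨ sum-lower {n} {at CHOSEN s₄} {at CHOSEN s} {u₀} {1 ∸ at CHOSEN s u₀}
                (λ u u≢ → sym (chosen-other u u≢)) (trans (m+[n∸m]≡n (Partial.chosen≤1 p u₀)) (sym chosen-u₀)) ⟨
            sum {n} (at CHOSEN s) + (1 ∸ at CHOSEN s u₀)         ≤⟨ +-mono-≤ (Partial.chosen-sum p) (m∸n≤m 1 (at CHOSEN s u₀)) ⟩
            vars s CNT + 1                                       ≡⟨ cnt≡ ⟨
            vars s₅ CNT                                          ∎
        ; runs = λ W r → subst (Greedy ∣ W ∣ (n ∸ 1) (vars s₅ REM)) (trans (+-comm 1 (vars s CNT)) (sym cnt≡))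
            (pick (subst (λ x → Greedy ∣ W ∣ (n ∸ 1) x (vars s CNT)) (sym b+rem) (Partial.runs p W r)) 0<b
              (≤-trans (≤-reflexive b+rem) (share W r)))
        }
      ; rem< = ≤-trans (+-monoˡ-≤ (vars s₅ REM) 0<b) (≤-reflexive b+rem)
      ; clk = trans (Closing.clk closed) (trans (cong₂ (λ x y → n + (x + n * y)) clock₄ rem₄) (lemma n (clock s) (vars s REM)))
      }
      where
      open ≤-Reasoning
      s₂ = run (n * n) (CHOSEN ⟦ var ARG ⟧:= lit 1) s₁
      s₃ = run (n * n) (CNT := var CNT ⊕ lit 1) s₂
      s₄ = run (n * n) (W := lit 0 ⨾ WROW := lit 0) s₃
      s₅ = run (n * n) pickBest s
      lemma : ∀ n c r → n + (n * 1 + c + n * r) ≡ 2 * n + (c + n * r)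
      lemma = solve-∀
      same : ∀ k → (k ≡ᵇ CHOSEN) ≡ false → arrs s₄ k ≡ arrs s k
      same k k≢ = arrs-frame (n * n) (select ⨾ CHOSEN ⟦ var ARG ⟧:= lit 1 ⨾ CNT := var CNT ⊕ lit 1 ⨾ W := lit 0 ⨾ WROW := lit 0) {k} s
        (trans (cong (λ b → b ∨ false) k≢) refl)
      rem₄ : vars s₄ REM ≡ vars s REM
      rem₄ = vars-frame (n * n) select s refl
      clock₄ : clock s₄ ≡ n * 1 + clock s
      clock₄ = regular-clock (n * n) select n s refl refl (size≡ (Partial.ctx p))
      cnt≡ : vars s₅ CNT ≡ vars s CNT + 1
      cnt≡ = trans (vars-frame (n * n) cover s₃ refl) (cong (_+ 1) (vars-frame (n * n) select s refl))
      chosen₅ : ∀ (u : Fin n) → at CHOSEN s₅ u ≡ at CHOSEN s₄ u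
      chosen₅ u = cong (λ A → A (toℕ u)) (arrs-frame (n * n) cover s₃ refl)
      chosen₁ : ∀ (u : Fin n) → at CHOSEN s₁ u ≡ at CHOSEN s u
      chosen₁ u = cong (λ A → A (toℕ u)) (arrs-frame (n * n) select s refl)
      chosen-u₀ : at CHOSEN s₄ u₀ ≡ 1
      chosen-u₀ = write-at-same {s = s₁} CHOSEN (var ARG) (lit 1) u₀ arg≡
      chosen-other : ∀ (u : Fin n) → u ≢ u₀ → at CHOSEN s₄ u ≡ at CHOSEN s u
      chosen-other u u≢ = trans (write-at-other {s = s₁} CHOSEN (var ARG) (lit 1) u₀ arg≡ u u≢) (chosen₁ u)
      ctx₄ : Context G v s₄
      ctx₄ = Context-frame G v (select ⨾ CHOSEN ⟦ var ARG ⟧:= lit 1 ⨾ CNT := var CNT ⊕ lit 1 ⨾ W := lit 0 ⨾ WROW := lit 0)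
        {s} refl refl refl refl (Partial.ctx p)
      open₄ : ∀ (w : Fin n) → at OPEN s₄ w ≡ at OPEN s w
      open₄ w = cong (λ A → A (toℕ w)) (same OPEN refl)
      gain₄ : ∀ (u : Fin n) → at GAIN s₄ u ≡ at GAIN s u
      gain₄ u = cong (λ A → A (toℕ u)) (same GAIN refl)
      start₄ : Closing G v u₀ s₄ 0 s₄
      start₄ = record
        { ctx = ctx₄
        ; gain = λ u → trans (gain₄ u) (trans (Partial.gain p u) (sum-cong-≗ {n} λ w → cong (_* sep G v u w) (sym (open₄ w))))
        ; open≤1 = λ w → ≤-trans (≤-reflexive (open₄ w)) (Partial.open≤1 p w)
        ; open-v = trans (open₄ v) (Partial.open-v p)
        ; open-sum = trans (sum-cong-≗ {n} open₄) (trans (Partial.open-sum p) (cong suc (sym rem₄)))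
        ; covered = λ w z → let u , ch , sp = Partial.covered p w (trans (sym (open₄ w)) z) in
            u , (case u ≟ᶠ u₀ of λ { (yes refl) → chosen-u₀ ; (no u≢) → trans (chosen-other u u≢) ch }) , sp
        ; chosen-u₀ = chosen-u₀
        ; W≡ = refl
        ; WROW≡ = refl
        ; ARG≡ = arg≡
        ; swept = λ _ ()
        ; balance = refl
        ; clk = refl
        }
      closed : Closing G v u₀ s₄ n s₅
      closed = subst (λ N → Closing G v u₀ s₄ n (iterate N (λ s → run (n * n) closeNode (tick s)) s₄)) (sym (size≡ ctx₄))
        (iterate-invariant {N = n} (Closing G v u₀ s₄) (closeNode-spec G v u₀ s₄) s₄ start₄)
      -- After the sweep the pick separates no open node; the balance then says that exactly `b`
      -- nodes were closed.
      gain₅ : at GAIN s₅ u₀ ≡ 0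
      gain₅ = trans (Closing.gain closed u₀) (sum-zero λ w → Closing.swept closed w (toℕ<n w))
      b+rem : b + vars s₅ REM ≡ vars s REM
      b+rem = trans (+-comm b (vars s₅ REM)) (trans (cong (vars s₅ REM +_) (sym (trans (gain₄ u₀) g≡)))
        (trans (Closing.balance closed) (trans (cong₂ _+_ rem₄ gain₅) (+-identityʳ (vars s REM)))))

  -- In `clk`, the term n · (n - 1) is the initial potential, and each of the n rounds contributes
  -- two ticks of its own loops and 2n for a pick.
  record Solved (c : ℕ) (s : State) : Set where
    field
      ctx      : Context G v s
      solution : Subset n
      bits     : ∀ (u : Fin n) → at CHOSEN s u ≡ bit (lookup solution u)
      resolves : Resolves G v solution
      small    : ∣ solution ∣ ≤ vars s CNT
      runs     : ∀ W → Resolves G v W → Greedy ∣ W ∣ (n ∸ 1) 0 (vars s CNT)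
      clk      : clock s ≤ cost setup n + n * (n ∸ 1) + n * (2 + 2 * n) + c

  Partial-start : ∀ {s₀ s} → AfterSetup G v s₀ s → Partial s
  Partial-start {s = s} ready = record
    { ctx = AfterSetup.ctx ready
    ; gain = AfterSetup.gain ready
    ; open≤1 = λ w → ≤-reflexive (AfterSetup.open≡1 ready w)
    ; open-v = AfterSetup.open≡1 ready v
    ; open-sum = trans (sum-cong-≗ {n} (AfterSetup.open≡1 ready)) (trans (sum-one n)
        (trans (sym (m+[n∸m]≡n (0<n v))) (cong suc (sym (AfterSetup.rem ready)))))
    ; covered = λ w z → contradiction (trans (sym (AfterSetup.open≡1 ready w)) z) λ ()
    ; chosen≤1 = λ u → ≤-trans (≤-reflexive (AfterSetup.chosen ready u)) z≤n
    ; chosen-v = AfterSetup.chosen ready v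
    ; chosen-sum = ≤-trans (≤-reflexive (sum-zero {n} (AfterSetup.chosen ready))) z≤n
    ; runs = λ W r → subst₂ (Greedy ∣ W ∣ (n ∸ 1)) (sym (AfterSetup.rem ready)) (sym (AfterSetup.cnt ready)) initially
    }
    where
    0<n : ∀ {n} → Fin n → 1 ≤ n
    0<n zero    = s≤s z≤n
    0<n (suc _) = s≤s z≤n

  Partial-finish : ∀ {c} s → Partial s → vars s REM ≡ 0 →
                   clock s ≤ cost setup n + n * (n ∸ 1) + n * (2 + 2 * n) + c → Solved c s
  Partial-finish s final rem≡0 clk≤ = record
    { ctx = Partial.ctx final
    ; solution = sol
    ; bits = bits
    ; resolves = v∉ , λ w w≢v →
        let u , ch , sp = Partial.covered final w (open≡0 w w≢v)
        in u , lookup⇒[]= u sol (trans (lookup∘tabulate _ u) (dec-true (at CHOSEN s u ≟ 1) ch)) ,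
           λ eq → 0≢1+n (trans (sym (distinct-≡ eq)) sp)
    ; small = ≤-trans (∣tabulate∣≤sum {n} _ (at CHOSEN s) (λ u → bit≤ (at CHOSEN s u))) (Partial.chosen-sum final)
    ; runs = λ W r → subst (λ x → Greedy ∣ W ∣ (n ∸ 1) x (vars s CNT)) rem≡0 (Partial.runs final W r)
    ; clk = clk≤
    }
    where
    sol : Subset n
    sol = tabulate λ u → does (at CHOSEN s u ≟ 1)
    bit≤ : ∀ x → bit (does (x ≟ 1)) ≤ x
    bit≤ zero          = z≤n
    bit≤ (suc zero)    = ≤-refl
    bit≤ (suc (suc x)) = z≤n
    bit≡ : ∀ x → x ≤ 1 → x ≡ bit (does (x ≟ 1))
    bit≡ zero       _ = refl
    bit≡ (suc zero) _ = refl
    bit≡ (suc (suc _)) (s≤s ())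
    bits : ∀ (u : Fin n) → at CHOSEN s u ≡ bit (lookup sol u)
    bits u = trans (bit≡ (at CHOSEN s u) (Partial.chosen≤1 final u)) (cong bit (sym (lookup∘tabulate _ u)))
    v∉ : v ∉ sol
    v∉ v∈ = 0≢1+n (trans (sym (Partial.chosen-v final)) (trans (bits v) (cong bit ([]=⇒lookup v∈))))
    -- With `REM` at 0 the open marks add up to 1, and `v` alone accounts for that.
    open≡0 : ∀ (w : Fin n) → w ≢ v → at OPEN s w ≡ 0
    open≡0 w w≢v = n≤0⇒n≡0 (≤-trans (≤-reflexive (sym (erase-other (at OPEN s) w≢v)))
      (≤-trans (≤-sum (erase (at OPEN s) v) w)
        (≤-reflexive (sum-erase (at OPEN s) (Partial.open-v final) (trans (Partial.open-sum final) (cong suc rem≡0))))))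

  rounds : Cmd
  rounds = loop (var size) (loop (ifz (var REM) (lit 0) (lit 1)) pickBest)

  rounds-spec : ∀ s → Partial s → vars s REM ≡ n ∸ 1 →
    let s′ = run (n * n) rounds s in
    Partial s′ × vars s′ REM ≡ 0 × clock s′ ≤ n * (2 + 2 * n) + (clock s + n * (n ∸ 1))
  rounds-spec s₁ begun rem≡ =
    subst (λ N → let s′ = iterate N body s₁ in
             Partial s′ × vars s′ REM ≡ 0 × clock s′ ≤ n * (2 + 2 * n) + (clock s₁ + n * (n ∸ 1)))
      (sym (size≡ (Partial.ctx begun)))
      (conclude (iterate n body s₁) (iterate-invariant {body} {n} Inv advance s₁ (begun , ≤-reflexive rem≡ , ≤-reflexive (cong (λ x → clock s₁ + n * x) rem≡))))
    where
    body = λ s → run (n * n) (loop (ifz (var REM) (lit 0) (lit 1)) pickBest) (tick s)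
    total = clock s₁ + n * (n ∸ 1)
    Inv : ℕ → State → Set
    Inv t s = Partial s × vars s REM ≤ (n ∸ 1) ∸ t × clock s + n * vars s REM ≤ t * (2 + 2 * n) + total
    conclude : ∀ s → Inv n s → Partial s × vars s REM ≡ 0 × clock s ≤ n * (2 + 2 * n) + total
    conclude s (p , rem≤ , clk≤) = p , n≤0⇒n≡0 (≤-trans rem≤ (≤-reflexive (m≤n⇒m∸n≡0 (m∸n≤m n 1)))) ,
      ≤-trans (m≤m+n (clock s) (n * vars s REM)) clk≤
    advance : ∀ (i : Fin n) s → Inv (toℕ i) s → Inv (suc (toℕ i)) (body s)
    advance i s (p , rem≤ , clk≤) = go (vars s REM) refl
      where
      go : ∀ r → vars s REM ≡ r → Inv (suc (toℕ i)) (iterate (ifzero r 0 1) (λ s → run (n * n) pickBest (tick s)) (tick s))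
      go zero eq = Partial-tick p , ≤-trans (≤-reflexive eq) z≤n ,
        ≤-trans (s≤s clk≤) (+-monoˡ-≤ total (+-monoˡ-≤ (toℕ i * (2 + 2 * n)) {1} {2 + 2 * n} (s≤s z≤n)))
      go (suc r) eq = Progress.partial q ,
        ≤-trans (<⇒≤pred (≤-trans (Progress.rem< q) rem≤)) (≤-reflexive (pred[m∸n]≡m∸[1+n] (n ∸ 1) (toℕ i))) ,
        ≤-trans (≤-reflexive (trans (Progress.clk q) (lemma n (clock s) (vars s REM))))
          (≤-trans (+-monoʳ-≤ (2 + 2 * n) clk≤) (≤-reflexive (sym (+-assoc (2 + 2 * n) (toℕ i * (2 + 2 * n)) total))))
        where
        lemma : ∀ n c r → 2 * n + (suc (suc c) + n * r) ≡ 2 + 2 * n + (c + n * r)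
        lemma = solve-∀
        q = pickBest-spec (tick (tick s)) (Partial-tick (Partial-tick p)) (≤-trans (s≤s z≤n) (≤-reflexive (sym eq)))

  greedy-spec : ∀ s → Context G v s → Solved (clock s) (run (n * n) greedy s)
  greedy-spec s c = conclude (run (n * n) setup s) (setup-spec G v s c)
    where
    conclude : ∀ s₁ → AfterSetup G v s s₁ → Solved (clock s) (run (n * n) rounds s₁)
    conclude s₁ ready =
      let p , rem≡0 , clk≤ = rounds-spec s₁ (Partial-start ready) (AfterSetup.rem ready)
      in Partial-finish (run (n * n) rounds s₁) p rem≡0 (≤-trans clk≤ (≤-reflexive
           (trans (cong (λ x → n * (2 + 2 * n) + (x + n * (n ∸ 1))) (AfterSetup.clk ready))
                  (lemma (n * (2 + 2 * n)) (cost setup n) (clock s) (n * (n ∸ 1))))))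
      where
      lemma : ∀ a b c d → a + (b + c + d) ≡ b + d + a + c
      lemma = solve-∀

-- The search over all nodes

ANSWER BEST : ℕ
ANSWER = 4
BEST = 17

-- `ANSWER` is replaced before `BEST`, because both decisions test the old value of `BEST`. The
-- start value n makes the first greedy result win.
keepBest nextV tryNode search solve : Cmd
keepBest =
  each (var size) ANSWER (ifz (var BEST ⊖ var CNT) (ANSWER ⟦ var U ⟧) (CHOSEN ⟦ var U ⟧)) ⨾
  BEST := ifz (var BEST ⊖ var CNT) (var BEST) (var CNT)
nextV = VROW := var VROW ⊕ var size ⨾ V := var V ⊕ lit 1
tryNode = greedy ⨾ keepBest ⨾ nextV
search = BEST := var size ⨾ V := lit 0 ⨾ VROW := lit 0 ⨾ loop (var size) tryNode
solve = distances ⨾ search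

greedyCost tryCost solveCost : ℕ → ℕ
greedyCost n = cost setup n + n * (n ∸ 1) + n * (2 + 2 * n)
tryCost n = 1 + greedyCost n + n
solveCost n = n * tryCost n + cost distances n

module _ {n : ℕ} (G : ConnectedGraph n) where

  record Answered (s : State) : Set where
    field
      {centre} : Fin n
      {answer} : Subset n
      bits     : ∀ (u : Fin n) → at ANSWER s u ≡ bit (lookup answer u)
      resolves : Resolves G centre answer
      small    : ∣ answer ∣ ≤ vars s BEST

  -- The kept answer may belong to another centre than `v`. What survives its replacement is that
  -- `BEST` is at most the length of a greedy run for `v`.
  Beats : State → Fin n → Set
  Beats s v = ∀ W → Resolves G v W → ∃[ k ] vars s BEST ≤ k × Greedy ∣ W ∣ (n ∸ 1) 0 k

  record Kept (s s′ : State) : Set where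
    field
      best≤  : vars s′ BEST ≤ vars s BEST
      cnt≤   : vars s′ BEST ≤ vars s CNT
      choice : (vars s′ BEST ≡ vars s BEST × (∀ (u : Fin n) → at ANSWER s′ u ≡ at ANSWER s u))
             ⊎ (vars s′ BEST ≡ vars s CNT × (∀ (u : Fin n) → at ANSWER s′ u ≡ at CHOSEN s u))
      clk    : clock s′ ≡ n + clock s

  keepBest-spec : ∀ s → vars s size ≡ n → Kept s (run (n * n) keepBest s)
  keepBest-spec s sz = record
    { best≤ = ≤-trans (≤-reflexive best≡) (proj₁ (proj₂ m))
    ; cnt≤ = ≤-trans (≤-reflexive best≡) (proj₂ (proj₂ m))
    ; choice = case proj₁ m of λ
        { (inj₁ z) → inj₁ (trans best≡ (cong (λ x → ifzero x (vars s BEST) (vars s CNT)) z) ,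
            λ u → trans (proj₁ spec u) (cong (λ x → ifzero x (at ANSWER s u) (at CHOSEN s u)) z))
        ; (inj₂ (k , e)) → inj₂ (trans best≡ (cong (λ x → ifzero x (vars s BEST) (vars s CNT)) e) ,
            λ u → trans (proj₁ spec u) (cong (λ x → ifzero x (at ANSWER s u) (at CHOSEN s u)) e)) }
    ; clk = proj₂ spec
    }
    where
    e = ifz (var BEST ⊖ var CNT) (ANSWER ⟦ var U ⟧) (CHOSEN ⟦ var U ⟧)
    s₁ = run (n * n) (each (var size) ANSWER e) s
    spec = each-spec (var size) ANSWER e s (λ u x → ifzero (vars s BEST ∸ vars s CNT) x (at CHOSEN s u)) sz
      λ s′ u ag u≡ → trans
        (cong₂ (λ x y → ifzero (x ∸ y) (arrs s′ ANSWER (vars s′ U)) (arrs s′ CHOSEN (vars s′ U))) (agree-vars ag BEST λ ()) (agree-vars ag CNT λ ()))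
        (cong₂ (ifzero (vars s BEST ∸ vars s CNT)) (cong (arrs s′ ANSWER) u≡) (cong₂ (λ A i → A i) (agree-arrs ag CHOSEN λ ()) u≡))
    min = ifzero (vars s BEST ∸ vars s CNT) (vars s BEST) (vars s CNT)
    best≡ : vars (run (n * n) keepBest s) BEST ≡ min
    best≡ = cong₂ (λ x y → ifzero (x ∸ y) x y)
      (vars-frame (n * n) (each (var size) ANSWER e) s refl) (vars-frame (n * n) (each (var size) ANSWER e) s refl)
    smaller : ∀ b c → let m = ifzero (b ∸ c) b c in
              (b ∸ c ≡ 0 ⊎ ∃[ k ] b ∸ c ≡ suc k) × m ≤ b × m ≤ c
    smaller b c with b ∸ c in eq
    ... | zero  = inj₁ refl , ≤-refl , m∸n≡0⇒m≤n eq
    ... | suc k = inj₂ (k , refl) , <⇒≤ (m∸n≢0⇒n<m {b} λ z → 0≢1+n (trans (sym z) eq)) , ≤-refl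
    m = smaller (vars s BEST) (vars s CNT)

  record Searching (c t : ℕ) (s : State) : Set where
    field
      size≡  : vars s size ≡ n
      V≡     : vars s V ≡ t
      VROW≡  : vars s VROW ≡ t * n
      dist≡  : HoldsDistances G s
      answer : vars s BEST ≡ n ⊎ Answered s
      beats  : ∀ v → toℕ v < t → Beats s v
      clk    : clock s ≤ t * tryCost n + c

  tryNode-spec : ∀ {c} (v : Fin n) s → Searching c (toℕ v) s → Searching c (suc (toℕ v)) (run (n * n) tryNode (tick s))
  tryNode-spec {c} v s inv =
    conclude (run (n * n) greedy (tick s)) (greedy-spec G v (tick s) (context I.size≡ I.V≡ I.VROW≡ I.dist≡))
      (vars-frame (n * n) greedy (tick s) refl) (λ u → cong (λ A → A (toℕ u)) (arrs-frame (n * n) greedy (tick s) refl))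
    where
    module I = Searching inv
    conclude : ∀ s₁ → Solved G v (suc (clock s)) s₁ → vars s₁ BEST ≡ vars s BEST →
      (∀ (u : Fin n) → at ANSWER s₁ u ≡ at ANSWER s u) →
      Searching c (suc (toℕ v)) (run (n * n) (keepBest ⨾ nextV) s₁)
    conclude s₁ solved best≡ ans≡ = record
      { size≡ = Context.size≡ ctx₂
      ; V≡ = trans (cong (_+ 1) (Context.V≡ ctx₂)) (+-comm (toℕ v) 1)
      ; VROW≡ = trans (cong₂ _+_ (Context.VROW≡ ctx₂) (Context.size≡ ctx₂)) (+-comm (toℕ v * n) n)
      ; dist≡ = Context.dist≡ ctx₂
      ; answer = case Kept.choice kept of λ
          { (inj₁ (b≡ , a≡)) → case I.answer of λ
              { (inj₁ b≡n) → inj₁ (trans b≡ (trans best≡ b≡n))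
              ; (inj₂ a) → inj₂ (record
                  { bits = λ u → trans (a≡ u) (trans (ans≡ u) (Answered.bits a u))
                  ; resolves = Answered.resolves a
                  ; small = ≤-trans (Answered.small a) (≤-reflexive (sym (trans b≡ best≡))) }) }
          ; (inj₂ (b≡ , a≡)) → inj₂ (record
              { bits = λ u → trans (a≡ u) (Solved.bits solved u)
              ; resolves = Solved.resolves solved
              ; small = ≤-trans (Solved.small solved) (≤-reflexive (sym b≡)) }) }
      ; beats = λ w w≤v → case w ≟ᶠ v of λ
          { (yes refl) → λ W r → vars s₁ CNT , Kept.cnt≤ kept , Solved.runs solved W r
          ; (no w≢v) → λ W r → let k , le , g = I.beats w (≤∧≢⇒< (≤-pred w≤v) (w≢v ∘ toℕ-injective)) W r
                                in k , ≤-trans (Kept.best≤ kept) (≤-trans (≤-reflexive best≡) le) , g }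
      ; clk = ≤-trans (≤-reflexive (Kept.clk kept)) (≤-trans (+-monoʳ-≤ n (Solved.clk solved))
          (≤-trans (+-monoʳ-≤ n (+-monoʳ-≤ (greedyCost n) (s≤s I.clk))) (≤-reflexive (lemma n (greedyCost n) (toℕ v * tryCost n) c))))
      }
      where
      kept = keepBest-spec s₁ (Context.size≡ (Solved.ctx solved))
      ctx₂ = Context-frame G v keepBest {s₁} refl refl refl refl (Solved.ctx solved)
      lemma : ∀ n g a c → n + (g + suc (a + c)) ≡ suc (g + n) + a + c
      lemma = solve-∀

  record Found (c : ℕ) (s : State) : Set where
    field
      size≡  : vars s size ≡ n
      dist≡  : HoldsDistances G s
      answer : Answered s
      beats  : ∀ v → Beats s v
      clk    : clock s ≤ c

  solve-spec : ∀ s → vars s size ≡ n → HoldsAdjacency G s → clock s ≡ 0 → Fin n → Found (solveCost n) (run (n * n) solve s)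
  solve-spec s sz adj clk₀ v = searched (run (n * n) distances s) (distances-spec G s sz adj)
      (trans (vars-frame (n * n) distances s refl) sz)
      (trans (regular-clock (n * n) distances n s refl refl sz) (trans (cong (cost distances n +_) clk₀) (+-identityʳ _)))
    where
    searched : ∀ s → HoldsDistances G s → vars s size ≡ n → clock s ≡ cost distances n → Found (solveCost n) (run (n * n) search s)
    searched s d sz clk = subst (λ N → Found (solveCost n) (iterate N body s₁)) (sym sz)
      (conclude (iterate n body s₁) (iterate-invariant {body} {n} (Searching (cost distances n)) tryNode-spec s₁ (record
        { size≡ = sz ; V≡ = refl ; VROW≡ = refl ; dist≡ = d ; answer = inj₁ sz ; beats = λ _ () ; clk = ≤-reflexive clk })))
      where
      body = λ s → run (n * n) tryNode (tick s)
      s₁ = run (n * n) (BEST := var size ⨾ V := lit 0 ⨾ VROW := lit 0) s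
      conclude : ∀ s → Searching (cost distances n) n s → Found (solveCost n) s
      conclude s inv = record
        { size≡ = Searching.size≡ inv
        ; dist≡ = Searching.dist≡ inv
        ; answer = case Searching.answer inv of λ
            { (inj₂ a) → a
            ; (inj₁ b≡n) → let k , le , g = Searching.beats inv v (toℕ<n v) (∁ ⁅ v ⁆) (resolves-complement G v) in
                contradiction (≤-trans (≤-reflexive (sym b≡n)) (≤-trans le (≤-trans (m≤m+n k 0) (greedy-count g)))) (n≰n∸1 v) }
        ; beats = λ w → Searching.beats inv w (toℕ<n w)
        ; clk = Searching.clk inv
        }
        where
        n≰n∸1 : ∀ {n} → Fin n → ¬ n ≤ n ∸ 1
        n≰n∸1 {suc n} _ = 1+n≰n

  record Published (s : State) (W : Subset n) (c : ℕ) : Set where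
    constructor published
    field
      outputs : ∀ (u : Fin n) → at ADJ s u ≡ bit (lookup W u)
      clk     : clock s ≤ c

-- Output, optimality and approximation ratio

publish : Cmd
publish = each (var size) ADJ (ANSWER ⟦ var U ⟧)

greedyProgram : Cmd
greedyProgram = solve ⨾ publish

module _ {n : ℕ} (G : ConnectedGraph n) (2≤n : 2 ≤ n) where

  publish-spec : ∀ {c} s (f : Found G c s) → Published G (run (n * n) publish s) (Answered.answer (Found.answer f)) (n + c)
  publish-spec s f = published (λ u → trans (proj₁ spec u) (Answered.bits (Found.answer f) u))
      (≤-trans (≤-reflexive (proj₂ spec)) (+-monoʳ-≤ n (Found.clk f)))
    where
    spec = each-spec (var size) ADJ (ANSWER ⟦ var U ⟧) s (λ u _ → at ANSWER s u) (Found.size≡ f)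
      λ s′ u ag u≡ → cong₂ (λ A i → A i) (agree-arrs ag ANSWER λ ()) u≡

  best≤1 : ∀ {c s v W} → Found G c s → Resolves G v W → ∣ W ∣ ≡ 1 → vars s BEST ≤ 1
  best≤1 {v = v} {W} f r ∣W∣≡1 = let k , le , g = Found.beats f v W r
    in ≤-trans le (greedy-single (subst (λ L → Greedy L (n ∸ 1) 0 k) ∣W∣≡1 g))

  best≤1⇒optimal : ∀ {c s} (f : Found G c s) → vars s BEST ≤ 1 → IsOptimal G (Answered.answer (Found.answer f))
  best≤1⇒optimal f b≤1 = feasible , subst (IsLopt G) (sym ∣W∣≡1) (resolves-singleton⇒IsLopt G 2≤n r ∣W∣≡1)
    where
    r = Answered.resolves (Found.answer f)
    feasible = resolves⇒feasible G 2≤n r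
    ∣W∣≡1 : ∣ Answered.answer (Found.answer f) ∣ ≡ 1
    ∣W∣≡1 = ≤-antisym (≤-trans (Answered.small (Found.answer f)) b≤1) (feasible⇒0<∣W∣ G 2≤n feasible)

  -- The competitor is an optimal set, taken with a node `v` for which it resolves: the greedy run
  -- for this `v` is within the ratio, and `BEST` is no larger.
  answer-approximates : ∀ {c s} (f : Found G c s) → IsApproximation (1+ (ln (n ∸ 1))) G (Answered.answer (Found.answer f))
  answer-approximates f =
    let L , lopt = IsLopt-exists G 2≤n
        W , feas , ∣W∣≡L = proj₁ lopt
        v , r = feasible⇒resolves G 2≤n feas
        k , le , g = Found.beats f v W r
    in resolves⇒feasible G 2≤n (Answered.resolves (Found.answer f)) , L , lopt ,
       λ q q∈ → ℚ.≤-trans (fromℕ-mono (≤-trans (Answered.small (Found.answer f)) le))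
         (subst (λ L → k ≤[ 1+ (ln (n ∸ 1)) ]· L) ∣W∣≡L (greedy-approximation (∸-monoˡ-≤ 1 2≤n) g) q q∈)

-- Graphs without a four-cycle

HIT P Q : ℕ
HIT = 18
P = 19
Q = 20

-- HIT is zero at a neighbour of node 0; P and Q are the last two neighbours found.
neighboursBody neighbours publishPair pairProgram : Cmd
neighboursBody =
  HIT := distinctE (DIST ⟦ var U ⟧) (lit 1) ⨾
  Q := ifz (var HIT) (var P) (var Q) ⨾
  P := ifz (var HIT) (var U) (var P) ⨾
  U := var U ⊕ lit 1
neighbours = U := lit 0 ⨾ loop (var size) neighboursBody

-- A single node found by greedy stands. Otherwise this is the indicator of the two neighbours, a
-- plain sum because they differ.
pairE : Expr
pairE = ifz (var BEST ⊖ lit 1) (ANSWER ⟦ var U ⟧)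
  ((lit 1 ⊖ distinctE (var U) (var P)) ⊕ (lit 1 ⊖ distinctE (var U) (var Q)))

publishPair = each (var size) ADJ pairE
pairProgram = solve ⨾ neighbours ⨾ publishPair

lookup-singleton : ∀ {n} (p u : Fin n) → bit (lookup ⁅ p ⁆ u) ≡ 1 ∸ distinct (toℕ u) (toℕ p)
lookup-singleton p u with u ≟ᶠ p
... | yes refl = trans (cong bit ([]=⇒lookup (x∈⁅x⁆ u))) (cong (1 ∸_) (sym (distinct-≡ {toℕ u} refl)))
... | no u≢p = trans (cong bit (false-lookup u≢p)) (cong (1 ∸_) (sym (distinct-≢ (u≢p ∘ toℕ-injective))))
  where
  false-lookup : ∀ {n} {p u : Fin n} → u ≢ p → lookup ⁅ p ⁆ u ≡ false
  false-lookup {p = p} {u} u≢p with lookup ⁅ p ⁆ u in eq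
  ... | false = refl
  ... | true  = contradiction (x∈⁅y⁆⇒x≡y p (lookup⇒[]= u ⁅ p ⁆ eq)) u≢p

lookup-pair : ∀ {n} {p q : Fin n} → p ≢ q → ∀ u →
  bit (lookup (⁅ p ⁆ ∪ ⁅ q ⁆) u) ≡ (1 ∸ distinct (toℕ u) (toℕ p)) + (1 ∸ distinct (toℕ u) (toℕ q))
lookup-pair {p = p} {q} p≢q u = trans (cong bit (lookup-zipWith _ u ⁅ p ⁆ ⁅ q ⁆))
  (trans (disjoint (lookup ⁅ p ⁆ u) (lookup ⁅ q ⁆ u) λ ep eq →
      p≢q (trans (sym (x∈⁅y⁆⇒x≡y p (lookup⇒[]= u ⁅ p ⁆ ep))) (x∈⁅y⁆⇒x≡y q (lookup⇒[]= u ⁅ q ⁆ eq))))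
    (cong₂ _+_ (lookup-singleton p u) (lookup-singleton q u)))
  where
  disjoint : ∀ a b → (a ≡ true → b ≡ true → ⊥) → bit (a ∨ b) ≡ bit a + bit b
  disjoint false b     _ = refl
  disjoint true  false _ = refl
  disjoint true  true  d = ⊥-elim (d refl refl)

module _ {n : ℕ} (G : ConnectedGraph n) (2≤n : 2 ≤ n) (root : Fin n) (root≡0 : toℕ root ≡ 0) where

  -- The bound on `p` makes the next neighbour found differ from it. The root has index 0, so its
  -- row of distances needs no offset.
  data Neighbours (t x y : ℕ) : Set where
    noneBelow : (∀ u → toℕ u < t → ¬ Adj (graph G) root u) → Neighbours t x y
    oneBelow  : ∀ p → x ≡ toℕ p → toℕ p < t → Adj (graph G) root p →
           (∀ u → toℕ u < t → Adj (graph G) root u → u ≡ p) → Neighbours t x y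
    twoBelow  : ∀ p q → x ≡ toℕ p → y ≡ toℕ q → toℕ p < t → p ≢ q →
           Adj (graph G) root p → Adj (graph G) root q → Neighbours t x y

  extend-miss : ∀ {x y} (i : Fin n) → ¬ Adj (graph G) root i → Neighbours (toℕ i) x y → Neighbours (suc (toℕ i)) x y
  extend-miss i ¬e (noneBelow no-nbr) = noneBelow λ u u≤i e → case u ≟ᶠ i of λ
    { (yes refl) → ¬e e
    ; (no u≢i) → no-nbr u (≤∧≢⇒< (≤-pred u≤i) (u≢i ∘ toℕ-injective)) e }
  extend-miss i ¬e (oneBelow p x≡ p< e only) = oneBelow p x≡ (m<n⇒m<1+n p<) e λ u u≤i e′ → case u ≟ᶠ i of λ
    { (yes refl) → contradiction e′ ¬e
    ; (no u≢i) → only u (≤∧≢⇒< (≤-pred u≤i) (u≢i ∘ toℕ-injective)) e′ }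
  extend-miss i ¬e (twoBelow p q x≡ y≡ p< p≢q e e′) = twoBelow p q x≡ y≡ (m<n⇒m<1+n p<) p≢q e e′

  extend-hit : ∀ {x y} (i : Fin n) → Adj (graph G) root i → Neighbours (toℕ i) x y → Neighbours (suc (toℕ i)) (toℕ i) x
  extend-hit i e (noneBelow no-nbr) = oneBelow i refl ≤-refl e λ u u≤i e′ → case u ≟ᶠ i of λ
    { (yes u≡i) → u≡i
    ; (no u≢i) → contradiction e′ (no-nbr u (≤∧≢⇒< (≤-pred u≤i) (u≢i ∘ toℕ-injective))) }
  extend-hit i e (oneBelow p x≡ p< e′ _) = twoBelow i p refl x≡ ≤-refl (λ { refl → <⇒≢ p< refl }) e e′
  extend-hit i e (twoBelow p q x≡ y≡ p< _ e′ _) = twoBelow i p refl x≡ ≤-refl (λ { refl → <⇒≢ p< refl }) e e′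

  neighbours-spec : ∀ {c} s → Found G c s → let s′ = run (n * n) neighbours s in Neighbours n (vars s′ P) (vars s′ Q)
  neighbours-spec s f = subst (λ N → let s′ = iterate N body s₁ in Neighbours n (vars s′ P) (vars s′ Q)) (sym (Found.size≡ f))
    (proj₂ (proj₂ (iterate-invariant {body} {n} Inv advance s₁ (refl , refl , noneBelow λ _ ()))))
    where
    body = λ s → run (n * n) neighboursBody (tick s)
    s₁ = run (n * n) (U := lit 0) s
    Inv : ℕ → State → Set
    Inv t s′ = vars s′ U ≡ t × arrs s′ DIST ≡ arrs s DIST × Neighbours t (vars s′ P) (vars s′ Q)
    advance : ∀ (i : Fin n) s′ → Inv (toℕ i) s′ → Inv (suc (toℕ i)) (body s′)
    advance i s′ (u≡ , d≡ , nbrs) =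
      trans (cong (_+ 1) u≡) (+-comm (toℕ i) 1) , d≡ ,
      subst (λ h → Neighbours (suc (toℕ i)) (ifzero h (vars s′ U) (vars s′ P)) (ifzero h (vars s′ P) (vars s′ Q))) (sym hit≡)
        (branch (dist G root i ≟ 1))
      where
      hit = distinct (arrs s′ DIST (vars s′ U)) 1
      hit≡ : hit ≡ distinct (dist G root i) 1
      hit≡ = cong (λ x → distinct x 1) (trans (cong₂ (λ A u → A u) d≡ u≡)
        (trans (cong (λ r → arrs s DIST (r * n + toℕ i)) (sym root≡0)) (Found.dist≡ f root i)))
      branch : Dec (dist G root i ≡ 1) → let h = distinct (dist G root i) 1 in
        Neighbours (suc (toℕ i)) (ifzero h (vars s′ U) (vars s′ P)) (ifzero h (vars s′ P) (vars s′ Q))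
      branch (yes d) = subst (λ h → Neighbours (suc (toℕ i)) (ifzero h (vars s′ U) (vars s′ P)) (ifzero h (vars s′ P) (vars s′ Q)))
        (sym (distinct-≡ d)) (subst (λ x → Neighbours (suc (toℕ i)) x (vars s′ P)) (sym u≡) (extend-hit i (dist≡1⇒Adj G d) nbrs))
      branch (no d) = subst (λ h → Neighbours (suc (toℕ i)) (ifzero h (vars s′ U) (vars s′ P)) (ifzero h (vars s′ P) (vars s′ Q)))
        (sym (distinct-≢ d)) (extend-miss i (λ e → d (Adj⇒dist≡1 G e)) nbrs)

  -- If `BEST` exceeds 1, the root has a second neighbour, for otherwise it would be a leaf and
  -- greedy would have found one node. For the same reason no feasible set has one node, so the pair
  -- is optimal.
  publishPair-spec : ¬ HasFourCycle (graph G) → ∀ {c} s → Found G c s → Neighbours n (vars s P) (vars s Q) →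
    ∃[ W ] (∀ (u : Fin n) → at ADJ (run (n * n) publishPair s) u ≡ bit (lookup W u)) × IsOptimal G W
  publishPair-spec no4 s f nbrs = choose (vars s BEST ∸ 1) refl
    where
    value : ℕ → Fin n → ℕ
    value b u = ifzero b (at ANSWER s u)
      ((1 ∸ distinct (toℕ u) (vars s P)) + (1 ∸ distinct (toℕ u) (vars s Q)))
    outputs : ∀ (u : Fin n) → at ADJ (run (n * n) publishPair s) u ≡ value (vars s BEST ∸ 1) u
    outputs = proj₁ (each-spec (var size) ADJ pairE s (λ u _ → value (vars s BEST ∸ 1) u) (Found.size≡ f)
      λ s′ u ag u≡ → cong₂ (λ b (x , y) → ifzero (b ∸ 1) x y) (agree-vars ag BEST λ ())
        (cong₂ _,_ (cong₂ (λ A i → A i) (agree-arrs ag ANSWER λ ()) u≡)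
          (cong₂ (λ i (p , q) → (1 ∸ distinct i p) + (1 ∸ distinct i q)) u≡
            (cong₂ _,_ (agree-vars ag P λ ()) (agree-vars ag Q λ ())))))
    choose : ∀ b → vars s BEST ∸ 1 ≡ b →
      ∃[ W ] (∀ (u : Fin n) → at ADJ (run (n * n) publishPair s) u ≡ bit (lookup W u)) × IsOptimal G W
    choose zero eq = _ , (λ u → trans (outputs u) (trans (cong (λ b → value b u) eq) (Answered.bits (Found.answer f) u))) ,
      best≤1⇒optimal G 2≤n f (m∸n≡0⇒m≤n eq)
    choose (suc b) eq = case nbrs of λ
      { (noneBelow no-nbr) → let x , e = neighbour G 2≤n root in contradiction e (no-nbr x (toℕ<n x))
      ; (oneBelow p _ _ e only) → contradiction
          (best≤1 G 2≤n f (leaf-resolves G 2≤n e λ {y} e′ → only y (toℕ<n y) e′) (∣⁅x⁆∣≡1 root)) (<⇒≱ 1<best)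
      ; (twoBelow p q x≡ y≡ _ p≢q e e′) →
          ⁅ p ⁆ ∪ ⁅ q ⁆ ,
          (λ u → trans (outputs u) (trans (cong (λ b → value b u) eq)
             (trans (cong₂ (λ p q → (1 ∸ distinct (toℕ u) p) + (1 ∸ distinct (toℕ u) q)) x≡ y≡) (sym (lookup-pair p≢q u))))) ,
          let feas = resolves⇒feasible G 2≤n (pair-resolves G 2≤n no4 e e′ p≢q)
          in feas , (_ , feas , refl) , λ { j (W , feasW , refl) → ≤-trans (∣pair∣≤2 G 2≤n p q) (≤∧≢⇒< (feasible⇒0<∣W∣ G 2≤n feasW) λ 1≡ →
               let v , r = feasible⇒resolves G 2≤n feasW in <⇒≱ 1<best (best≤1 G 2≤n f r (sym 1≡))) } }
      where
      1<best : 1 < vars s BEST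
      1<best = m∸n≢0⇒n<m {vars s BEST} {1} λ z → 0≢1+n (trans (sym z) eq)

  pair-spec : ¬ HasFourCycle (graph G) → ∀ {c} s → Found G c s →
    let s′ = run (n * n) (neighbours ⨾ publishPair) s in
    ∃[ W ] Published G s′ W (n + (n + c)) × IsOptimal G W
  pair-spec no4 s f =
    let W , out , opt = publishPair-spec no4 s₁ found₁ (neighbours-spec s f)
    in W , published out (≤-trans (≤-reflexive (regular-clock (n * n) publishPair n s₁ refl refl (Found.size≡ found₁)))
           (+-mono-≤ (≤-reflexive (*-identityʳ n)) (Found.clk found₁))) , opt
    where
    s₁ = run (n * n) neighbours s
    clock₁ : clock s₁ ≡ n + clock s
    clock₁ = trans (regular-clock (n * n) neighbours n s refl refl (Found.size≡ f)) (cong (_+ clock s) (*-identityʳ n))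
    found₁ : Found G _ s₁
    found₁ = record
      { size≡ = trans (vars-frame (n * n) neighbours s refl) (Found.size≡ f)
      ; dist≡ = λ i j → trans (cong (λ A → A (cell i j)) (arrs-frame (n * n) neighbours s refl)) (Found.dist≡ f i j)
      ; answer = record
          { bits = λ u → trans (cong (λ A → A (toℕ u)) (arrs-frame (n * n) neighbours s refl)) (Answered.bits a u)
          ; resolves = Answered.resolves a
          ; small = ≤-trans (Answered.small a) (≤-reflexive (sym best≡)) }
      ; beats = λ v W r → let k , le , g = Found.beats f v W r in k , ≤-trans (≤-reflexive best≡) le , g
      ; clk = ≤-trans (≤-reflexive clock₁) (+-monoʳ-≤ n (Found.clk f))
      }
      where
      a = Found.answer f
      best≡ = vars-frame (n * n) neighbours {BEST} s refl

-- Running times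

-- Restricting to `1 ≤ n` lets lower powers be absorbed by higher ones; at 0 the power of exponent 0
-- would be the larger.
record Poly (d : ℕ) (f : ℕ → ℕ) : Set where
  constructor poly
  field
    factor : ℕ
    bounds : ∀ n → 1 ≤ n → f n ≤ factor * n ^ d

poly-const : ∀ k → Poly 0 (λ _ → k)
poly-const k = poly k λ n _ → ≤-reflexive (sym (*-identityʳ k))

poly-≤ : ∀ {d f g} → (∀ n → f n ≤ g n) → Poly d g → Poly d f
poly-≤ f≤g (poly C p) = poly C λ n 1≤n → ≤-trans (f≤g n) (p n 1≤n)

poly-id : Poly 1 (λ n → n)
poly-id = poly 1 λ n _ → ≤-reflexive (sym (trans (*-identityˡ (n * 1)) (*-identityʳ n)))

poly-+ : ∀ {d f g} → Poly d f → Poly d g → Poly d (λ n → f n + g n)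
poly-+ {d} (poly C p) (poly D q) = poly (C + D) λ n 1≤n →
  ≤-trans (+-mono-≤ (p n 1≤n) (q n 1≤n)) (≤-reflexive (sym (*-distribʳ-+ (n ^ d) C D)))

poly-* : ∀ {d e f g} → Poly d f → Poly e g → Poly (d + e) (λ n → f n * g n)
poly-* {d} {e} (poly C p) (poly D q) = poly (C * D) λ n 1≤n →
  ≤-trans (*-mono-≤ (p n 1≤n) (q n 1≤n)) (≤-reflexive (trans ([m*n]*[o*p]≡[m*o]*[n*p] C (n ^ d) D (n ^ e))
    (cong (C * D *_) (sym (^-distribˡ-+-* n d e)))))

poly-weaken : ∀ {d e f} → d ≤ e → Poly d f → Poly e f
poly-weaken d≤e (poly C p) = poly C λ n 1≤n → ≤-trans (p n 1≤n) (*-monoʳ-≤ C (^-monoʳ-≤ n {{>-nonZero 1≤n}} d≤e))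

-- A bound on the degree of `cost`. It evaluates to 2 for `setup` and to 3 for `distances`, as the
-- cubic bound requires.
nesting : Cmd → ℕ
nesting (x := e)      = 0
nesting (k ⟦ i ⟧:= e) = 0
nesting (c ⨾ d)       = nesting c ⊔ nesting d
nesting (loop e c)    = suc (nesting c)

poly-cost : ∀ c → Poly (nesting c) (cost c)
poly-cost (x := e)      = poly-const 0
poly-cost (k ⟦ i ⟧:= e) = poly-const 0
poly-cost (c ⨾ d)       = poly-+ (poly-weaken (m≤m⊔n (nesting c) (nesting d)) (poly-cost c))
                                 (poly-weaken (m≤n⊔m (nesting c) (nesting d)) (poly-cost d))
poly-cost (loop e c)    = poly-* poly-id (poly-+ (poly-weaken z≤n (poly-const 1)) (poly-cost c))

poly-solveCost : Poly 3 solveCost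
poly-solveCost = poly-+ (poly-* poly-id (poly-+ (poly-+ (poly-weaken z≤n (poly-const 1)) poly-greedyCost) (poly-weaken (s≤s z≤n) poly-id)))
                        (poly-cost distances)
  where
  poly-greedyCost : Poly 2 greedyCost
  poly-greedyCost = poly-+ (poly-+ (poly-cost setup) (poly-* poly-id (poly-≤ (λ n → m∸n≤m n 1) poly-id)))
    (poly-* poly-id (poly-+ (poly-weaken z≤n (poly-const 2)) (poly-* (poly-const 2) poly-id)))

-- The length of the code is a constant, so a cubic bound on loop iterations is one on machine
-- steps; the linear term is the time for computing n².
solvable : ∀ c {bound} → Poly 3 bound → {𝒢 : ∀ n → ConnectedGraph n → Set} {Answer : ∀ n → ConnectedGraph n → Subset n → Set} →
  (∀ n (G : ConnectedGraph n) → 𝒢 n G → ∀ s → vars s size ≡ n → HoldsAdjacency G s → clock s ≡ 0 →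
     ∃[ A ] Published G (run (n * n) c s) A (bound n) × Answer n G A) →
  SolvableInTimeO (λ n → n ^ 3) 𝒢 Answer
solvable c {bound} cubic {𝒢} {Answer} correct =
  program c , (λ n → 3 + n * 4 + sizeC c * suc (bound n)) ,
  (let poly C p = poly-+ (poly-+ (poly-weaken z≤n (poly-const 3)) (poly-weaken (s≤s z≤n) (poly-* poly-id (poly-const 4))))
                      (poly-* (poly-const (sizeC c)) (poly-+ (poly-weaken z≤n (poly-const 1)) cubic))
   in C , 1 , p) ,
  λ n G g →
    let s = initial n (inputMem (graph G))
        A , pub , answer = correct n G g s refl (λ i j → adjacency G i j) refl
        f , m , t , r , t≤ , out = program-correct c n (inputMem (graph G))
    in ⟨ sizeC c + 6 , f , m ⟩ , t , A , r ,
       ≤-trans t≤ (+-monoʳ-≤ (3 + n * 4) (*-monoʳ-≤ (sizeC c) (s≤s (Published.clk pub)))) ,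
       (λ u → trans (out (toℕ u) (w<n² u)) (Published.outputs pub u)) , answer
  where
  adjacency : ∀ {n} (G : ConnectedGraph n) i j → arrs (initial n (inputMem (graph G))) ADJ (cell i j) ≡ bit (does (adj? (graph G) i j))
  adjacency {n} G i j = trans (initial-cell {n} (inputMem (graph G)) 0 (cell< i j)) (inputMem-entry (graph G) i j)

poly-greedyProgram : Poly 3 (λ n → n + solveCost n)
poly-greedyProgram = poly-+ (poly-weaken (s≤s z≤n) poly-id) poly-solveCost

poly-pairProgram : Poly 3 (λ n → n + (n + solveCost n))
poly-pairProgram = poly-+ (poly-weaken (s≤s z≤n) poly-id) poly-greedyProgram

greedy-solvable : {𝒢 : ∀ n → ConnectedGraph n → Set} {Answer : ∀ n → ConnectedGraph n → Subset n → Set} →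
  (∀ n G → 𝒢 n G → 2 ≤ n) →
  (∀ n G → 𝒢 n G → ∀ {c s} (f : Found G c s) → Answer n G (Answered.answer (Found.answer f))) →
  SolvableInTimeO (λ n → n ^ 3) 𝒢 Answer
greedy-solvable {𝒢} {Answer} large correct = solvable greedyProgram {λ n → n + solveCost n} poly-greedyProgram {𝒢} {Answer} answer
  where
  answer : ∀ n (G : ConnectedGraph n) → 𝒢 n G → ∀ s → vars s size ≡ n → HoldsAdjacency G s → clock s ≡ 0 →
           ∃[ A ] Published G (run (n * n) greedyProgram s) A (n + solveCost n) × Answer n G A
  answer n G g s sz adj clk₀ = conclude (run (n * n) solve s) (solve-spec G s sz adj clk₀ (node G (large n G g)))
    where
    conclude : ∀ {c} s → Found G c s → ∃[ A ] Published G (run (n * n) publish s) A (n + c) × Answer n G A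
    conclude s f = Answered.answer (Found.answer f) , publish-spec G (large n G g) s f , correct n G g f

pair-solvable : SolvableInTimeO (λ n → n ^ 3) (λ n G → 2 ≤ n × ¬ HasFourCycle (graph G)) (λ n G V′ → IsOptimal G V′)
pair-solvable = solvable pairProgram {λ n → n + (n + solveCost n)} poly-pairProgram answer
  where
  answer : ∀ n (G : ConnectedGraph n) → 2 ≤ n × ¬ HasFourCycle (graph G) → ∀ s → vars s size ≡ n → HoldsAdjacency G s → clock s ≡ 0 →
           ∃[ A ] Published G (run (n * n) pairProgram s) A (n + (n + solveCost n)) × IsOptimal G A
  answer n G (2≤n , no4) s sz adj clk₀ =
    pair-spec G 2≤n (node G 2≤n) (toℕ-fromℕ< _) no4 (run (n * n) solve s) (solve-spec G s sz adj clk₀ (node G 2≤n))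

theorem3 : SolvableInTimeO (λ n → n ^ 3)
    (λ n G → 2 ≤ n)
    (λ n G V′ → IsApproximation (1+ (ln (n ∸ 1))) G V′)
    × ( (∀ n (G : ConnectedGraph n) → 2 ≤ n → (∃[ v ] degree (graph G) v ≡ 1) → IsLopt G 1)
    × SolvableInTimeO (λ n → n ^ 3)
    (λ n G → 2 ≤ n × (∃[ v ] degree (graph G) v ≡ 1))
    (λ n G V′ → IsOptimal G V′))
    × ( (∀ n (G : ConnectedGraph n) → 2 ≤ n → ¬ HasFourCycle (graph G) → ∃[ L ] (IsLopt G L × L ≤ 2))
    × SolvableInTimeO (λ n → n ^ 3)
    (λ n G → 2 ≤ n × ¬ HasFourCycle (graph G))
    (λ n G V′ → IsOptimal G V′))
theorem3 =
  greedy-solvable (λ _ _ 2≤n → 2≤n) (λ n G 2≤n f → answer-approximates G 2≤n f) ,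
  ((λ n G 2≤n (v , deg) → degree-one⇒IsLopt G 2≤n v deg) ,
   greedy-solvable (λ _ _ → proj₁) λ n G (2≤n , v , deg) f →
     let W , feas , ∣W∣≡1 = proj₁ (degree-one⇒IsLopt G 2≤n v deg)
         w , r = feasible⇒resolves G 2≤n feas
     in best≤1⇒optimal G 2≤n f (best≤1 G 2≤n f r ∣W∣≡1)) ,
  ((λ n G 2≤n → no-four-cycle⇒IsLopt≤2 G 2≤n) , pair-solvable)
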